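{- Let $k \geq 3$ be an odd integer and let $a \in \mathbb{Q}$ with $\frac{k-1}{k+1} \leq a < 1$. Then there exists a natural number $c_k$ such that for every sufficiently large $n \in \mathbb{N}$, $$\operatorname{ex}\left(n^{a}, n, \theta_{k, c_{k}}\right)=\Theta_{k, a}\big(\left(n^{1+a}\right)^{\frac{k+1}{2 k}}\big).$$
   Context: For a graph $H$ and sizes $m,n$, $\operatorname{ex}(m,n,H)$ denotes the maximum number of edges in an $H$-free bipartite graph whose two parts have cardinalities $m$ and $n$ (a graph is $H$-free if it contains no subgraph isomorphic to $H$). For natural numbers $k,\ell$, $\theta_{k,\ell}$ denotes the graph consisting of two vertices joined by $\ell$ internally vertex-disjoint paths, each of length $k$ (i.e. with $k$ edges). The notation $\Theta_{k,a}(\cdot)$ means that the implied upper and lower constants depend only on $k$ and $a$, and not on $n$. -}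

module Defs where

open import Data.Nat using (ℕ; zero; suc; _+_; _*_; _∸_; _^_; _<_; _≤_; _<?_)
open import Data.Fin using (Fin; fromℕ<)
open import Data.Bool using (Bool; true; false; T; if_then_else_)
open import Data.Sum using (_⊎_; inj₁; inj₂)
open import Data.Product using (Σ; _×_; _,_)
open import Data.Empty using (⊥)
open import Relation.Nullary using (¬_; yes; no)
open import Relation.Binary.PropositionalEquality using (_≡_)
open import Function.Definitions using (Injective)

sumFin : (n : ℕ) → (Fin n → ℕ) → ℕ
sumFin zero f = 0
sumFin (suc n) f = f Fin.zero + sumFin n (λ i → f (Fin.suc i))

BipGraph : ℕ → ℕ → Set
BipGraph m n = Fin m → Fin n → Bool

edges : {m n : ℕ} → BipGraph m n → ℕ
edges {m} {n} G = sumFin m (λ i → sumFin n (λ j → if G i j then 1 else 0))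

BVertex : ℕ → ℕ → Set
BVertex m n = Fin m ⊎ Fin n

BAdj : {m n : ℕ} → BipGraph m n → BVertex m n → BVertex m n → Set
BAdj G (inj₁ i) (inj₁ i′) = ⊥
BAdj G (inj₁ i) (inj₂ j) = T (G i j)
BAdj G (inj₂ j) (inj₁ i) = T (G i j)
BAdj G (inj₂ j) (inj₂ j′) = ⊥

-- θ_{k,ℓ}: two endpoints (inj₁ false, inj₁ true) and, for each path i : Fin ℓ,
-- k-1 internal vertices (i , s), s : Fin (k ∸ 1).
ThetaVertex : ℕ → ℕ → Set
ThetaVertex k ℓ = Bool ⊎ (Fin ℓ × Fin (k ∸ 1))

-- the t-th vertex (0 ≤ t ≤ k) along path i
pathVertex : (k ℓ : ℕ) → Fin ℓ → ℕ → ThetaVertex k ℓ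
pathVertex k ℓ i zero = inj₁ false
pathVertex k ℓ i (suc s) with s <? (k ∸ 1)
... | yes p = inj₂ (i , fromℕ< p)
... | no _  = inj₁ true

ThetaAdj : (k ℓ : ℕ) → ThetaVertex k ℓ → ThetaVertex k ℓ → Set
ThetaAdj k ℓ u v = Σ (Fin ℓ) λ i → Σ ℕ λ t → t < k ×
  ((pathVertex k ℓ i t ≡ u × pathVertex k ℓ i (suc t) ≡ v)
   ⊎ (pathVertex k ℓ i t ≡ v × pathVertex k ℓ i (suc t) ≡ u))

ContainsTheta : {m n : ℕ} → (k ℓ : ℕ) → BipGraph m n → Set
ContainsTheta {m} {n} k ℓ G =
  Σ (ThetaVertex k ℓ → BVertex m n) λ f →
    Injective _≡_ _≡_ f × (∀ u v → ThetaAdj k ℓ u v → BAdj G (f u) (f v))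

ThetaFree : {m n : ℕ} → (k ℓ : ℕ) → BipGraph m n → Set
ThetaFree k ℓ G = ¬ ContainsTheta k ℓ G

-- m = ⌊ n ^ (p / q) ⌋ , i.e. m^q ≤ n^p < (m+1)^q
IsFloorPow : (n p q m : ℕ) → Set
IsFloorPow n p q m = (m ^ q ≤ n ^ p) × (n ^ p < suc m ^ q)

{-# OPTIONS --safe #-}

-- Write a = p / r and k = 2t + 1.
--
-- Upper bound.  After deleting vertices of small degree, explore the graph breadth first from a
-- left vertex.  If two consecutive layers span many edges per vertex, θ_{k,c} appears: inside the
-- layers one finds paths from a common vertex whose ends lie in distinct branches of the search
-- tree, and the tree joins these ends to a common ancestor.  So each layer is larger than the one
-- before by a constant times the minimum degree of its side, and the k-th layer has at most
-- m + n vertices.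
--
-- Lower bound.  Take a prime q with q^{kr} of order n and join u ∈ F_q^{kp} to w ∈ F_q^{kr} when
-- t(p + r) random polynomials take prescribed values at (u, w).  Suppose that for many coefficient
-- vectors g some u and w are joined by h(D + 1) disjoint paths of length k.  By a Sauer–Shelah
-- argument, all but h − 1 coordinates of g are algebraically independent up to degree D on the
-- bad set, and h coordinates taken from h of the paths, with D + 1 choices for each path, are
-- independent over them.  This makes T + 1 independent functions, where T is the number of
-- coefficients.  But lying on h disjoint paths imposes as many conditions on g as the paths have
-- coordinates, and by interpolation the constrained coefficients are rational functions of the
-- remaining data.  So there are only T parameters, and counting monomials gives a polynomial
-- relation between any T + 1 functions once D is large.  Hence bad vectors are rarer than any
-- fixed power of 1 / q, and no bound on the number of points of a variety over F_q is needed.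

module Submission where

-- No single hash of edge vectors into F separates all edges, yet univariate interpolation needs
-- distinct nodes. So each random polynomial is a sum over `H` hash points, and configurations are
-- stratified by a point that separates their `K` edges; the `H` strata only multiply the number of
-- linear equations, and `D` absorbs that. The parameter `z` turns the first right vertices of the
-- paths into distinct field elements, so that exchanging one path changes a single coordinate of
-- the grid. The target `b` is averaged over: a pair (u, w) is an edge for the `b` formed by its
-- values, so some `b` has at least q^(A + B - s) edges. Since (u, w, b, z) has `m` coordinates,
-- `h = m + 1` free paths pay for the union bound. In the upper bound, a ≥ (k - 1)/(k + 1) makes n
-- at most (n^(1+a))^((k+1)/(2k)); this settles graphs with O(n) edges, and in all others the
-- degrees exceed the layer constants. The search starts on the smaller side, so that t + 1 of the k
-- growth factors are left degrees.

-- Finite sums and counting.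

module FiniteSums where

  open import Defs
  open import Data.Nat
  open import Data.Nat.Properties
  open import Data.Fin using (Fin; zero; suc; _↑ˡ_; _↑ʳ_)
  import Data.Fin.Properties as Fin
  open import Data.Bool using (Bool; true; false; if_then_else_; _∧_)
  open import Data.Product using (Σ; _×_; _,_)
  open import Function using (_∘_)
  open import Relation.Nullary
  open import Relation.Nullary.Decidable using (dec-true)
  open import Relation.Binary.PropositionalEquality
  open import Data.Nat.Solver using (module +-*-Solver)

  ι : Bool → ℕ
  ι b = if b then 1 else 0

  ι≤1 : ∀ b → ι b ≤ 1
  ι≤1 false = z≤n
  ι≤1 true = ≤-refl

  ι-∧ : ∀ a b → ι (a ∧ b) ≡ ι a * ι b
  ι-∧ false b = refl
  ι-∧ true b = sym (+-identityʳ (ι b))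

  ι-pos : ∀ b → 1 ≤ ι b → b ≡ true
  ι-pos true _ = refl

  ι-true : ∀ {b} → b ≡ true → ι b ≡ 1
  ι-true refl = refl

  sum-cong : ∀ n {f g : Fin n → ℕ} → (∀ i → f i ≡ g i) → sumFin n f ≡ sumFin n g
  sum-cong zero e = refl
  sum-cong (suc n) e = cong₂ _+_ (e zero) (sum-cong n (e ∘ suc))

  sum-mono : ∀ n {f g : Fin n → ℕ} → (∀ i → f i ≤ g i) → sumFin n f ≤ sumFin n g
  sum-mono zero e = z≤n
  sum-mono (suc n) e = +-mono-≤ (e zero) (sum-mono n (e ∘ suc))

  +-interchange : ∀ a b c d → (a + b) + (c + d) ≡ (a + c) + (b + d)
  +-interchange = solve 4 (λ a b c d → (a :+ b) :+ (c :+ d) := (a :+ c) :+ (b :+ d)) refl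
    where open +-*-Solver

  sum-+ : ∀ n (f g : Fin n → ℕ) → sumFin n (λ i → f i + g i) ≡ sumFin n f + sumFin n g
  sum-+ zero f g = refl
  sum-+ (suc n) f g = trans (cong (f zero + g zero +_) (sum-+ n (f ∘ suc) (g ∘ suc)))
    (+-interchange (f zero) (g zero) _ _)

  sum-*ˡ : ∀ n c (f : Fin n → ℕ) → sumFin n (λ i → c * f i) ≡ c * sumFin n f
  sum-*ˡ zero c f = sym (*-zeroʳ c)
  sum-*ˡ (suc n) c f = trans (cong (c * f zero +_) (sum-*ˡ n c (f ∘ suc)))
    (sym (*-distribˡ-+ c (f zero) _))

  sum-*ʳ : ∀ n c (f : Fin n → ℕ) → sumFin n (λ i → f i * c) ≡ sumFin n f * c
  sum-*ʳ n c f = trans (sum-cong n (λ i → *-comm (f i) c)) (trans (sum-*ˡ n c f) (*-comm c _))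

  sum-const : ∀ n c → sumFin n (λ _ → c) ≡ n * c
  sum-const zero c = refl
  sum-const (suc n) c = cong (c +_) (sum-const n c)

  sum-0 : ∀ n → sumFin n (λ _ → 0) ≡ 0
  sum-0 n = trans (sum-const n 0) (*-zeroʳ n)

  sum-swap : ∀ m n (f : Fin m → Fin n → ℕ) →
    sumFin m (λ i → sumFin n (f i)) ≡ sumFin n (λ j → sumFin m (λ i → f i j))
  sum-swap zero n f = sym (sum-0 n)
  sum-swap (suc m) n f = trans (cong (sumFin n (f zero) +_) (sum-swap m n (f ∘ suc)))
    (sym (sum-+ n (f zero) _))

  term≤sum : ∀ n (f : Fin n → ℕ) i → f i ≤ sumFin n f
  term≤sum (suc n) f zero = m≤m+n _ _
  term≤sum (suc n) f (suc i) = ≤-trans (term≤sum n (f ∘ suc) i) (m≤n+m _ (f zero))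

  sum-<-witness : ∀ n (f g : Fin n → ℕ) → sumFin n f < sumFin n g → Σ (Fin n) λ i → f i < g i
  sum-<-witness (suc n) f g lt with f zero <? g zero
  ... | yes p = zero , p
  ... | no ¬p with sum-<-witness n (f ∘ suc) (g ∘ suc)
                   (+-cancelˡ-< (g zero) _ _ (≤-<-trans (+-monoˡ-≤ _ (≮⇒≥ ¬p)) lt))
  ... | i , q = suc i , q

  sum-≤-const : ∀ n {f : Fin n → ℕ} {c} → (∀ i → f i ≤ c) → sumFin n f ≤ n * c
  sum-≤-const n {f} {c} h = ≤-trans (sum-mono n h) (≤-reflexive (sum-const n c))

  sum-pos-witness : ∀ n (f : Fin n → ℕ) → 1 ≤ sumFin n f → Σ (Fin n) λ i → 1 ≤ f i
  sum-pos-witness n f h = sum-<-witness n (λ _ → 0) f (subst (_< sumFin n f) (sym (sum-0 n)) h)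

  _==_ : ∀ {n} → Fin n → Fin n → Bool
  i == j = does (i Fin.≟ j)

  ==-refl : ∀ {n} (i : Fin n) → (i == i) ≡ true
  ==-refl i = dec-true (i Fin.≟ i) refl

  ==-sound : ∀ {n} {i j : Fin n} → (i == j) ≡ true → i ≡ j
  ==-sound {i = i} {j} e with i Fin.≟ j
  ... | yes p = p

  sum-delta : ∀ n (j : Fin n) (f : Fin n → ℕ) → sumFin n (λ i → ι (j == i) * f i) ≡ f j
  sum-delta (suc n) zero f = trans (cong₂ _+_ (+-identityʳ (f zero)) (sum-0 n)) (+-identityʳ _)
  sum-delta (suc n) (suc j) f = sum-delta n j (f ∘ suc)

  sum-delta-1 : ∀ n (j : Fin n) → sumFin n (λ i → ι (j == i)) ≡ 1
  sum-delta-1 n j = trans (sum-cong n (λ i → sym (*-identityʳ _))) (sum-delta n j (λ _ → 1))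

  cnt : ∀ {n} → (Fin n → Bool) → ℕ
  cnt {n} P = sumFin n (λ i → ι (P i))

  cnt≤n : ∀ {n} (P : Fin n → Bool) → cnt P ≤ n
  cnt≤n {n} P = ≤-trans (sum-≤-const n (λ i → ι≤1 (P i))) (≤-reflexive (*-identityʳ n))

  cnt-mono : ∀ {n} {P Q : Fin n → Bool} → (∀ i → P i ≡ true → Q i ≡ true) → cnt P ≤ cnt Q
  cnt-mono {n} {P} {Q} h = sum-mono n go
    where
    go : ∀ i → ι (P i) ≤ ι (Q i)
    go i with P i in e
    ... | false = z≤n
    ... | true rewrite h i e = ≤-refl

  cnt-cong : ∀ {n} {P Q : Fin n → Bool} → (∀ i → P i ≡ Q i) → cnt P ≡ cnt Q
  cnt-cong {n} h = sum-cong n (λ i → cong ι (h i))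

  cnt-witness : ∀ {n} (P : Fin n → Bool) → 1 ≤ cnt P → Σ (Fin n) λ i → P i ≡ true
  cnt-witness {n} P h with sum-pos-witness n _ h
  ... | i , q = i , ι-pos (P i) q

  cnt-enum : ∀ {n} (P : Fin n → Bool) N → N ≤ cnt P →
    Σ (Fin N → Fin n) λ x → (∀ {i j} → x i ≡ x j → i ≡ j) × (∀ i → P (x i) ≡ true)
  cnt-enum P zero h = (λ ()) , (λ { {()} }) , λ ()
  cnt-enum {zero} P (suc N) ()
  cnt-enum {suc n} P (suc N) h with P zero in e
  ... | false with cnt-enum (P ∘ suc) (suc N) h
  ...   | x , inj , ok = suc ∘ x , inj ∘ Fin.suc-injective , ok
  cnt-enum {suc n} P (suc N) (s≤s h) | true with cnt-enum (P ∘ suc) N h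
  ... | x , inj , ok = x′ , inj′ , ok′
    where
    x′ : Fin (suc N) → Fin (suc n)
    x′ zero = zero
    x′ (suc i) = suc (x i)
    inj′ : ∀ {i j} → x′ i ≡ x′ j → i ≡ j
    inj′ {zero} {zero} _ = refl
    inj′ {suc i} {suc j} eq = cong suc (inj (Fin.suc-injective eq))
    ok′ : ∀ i → P (x′ i) ≡ true
    ok′ zero = e
    ok′ (suc i) = ok i

  sum-++ : ∀ a b (f : Fin (a + b) → ℕ) → sumFin (a + b) f ≡ sumFin a (λ i → f (i ↑ˡ b)) + sumFin b (λ j → f (a ↑ʳ j))
  sum-++ zero b f = refl
  sum-++ (suc a) b f = trans (cong (f zero +_) (sum-++ a b (f ∘ suc))) (sym (+-assoc (f zero) _ _))

-- Polynomials, linear algebra and rational functions over a finite integral domain.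

module Polynomials where

  open import Level using (0ℓ)
  open import Algebra.Bundles using (CommutativeRing)
  open import Algebra.Structures using (IsCommutativeRing)
  import Algebra.Solver.Ring.NaturalCoefficients.Default as NatCoeff
  import Algebra.Properties.Ring as RingProps
  open import Data.Nat hiding (_⊔_; _≟_)
  open import Data.Nat.Properties hiding (_≟_; suc-injective)
  open import Data.Fin using (Fin; zero; suc; splitAt)
  open import Data.Fin.Properties using (_≟_; suc-injective)
  open import Data.Vec hiding (_⊛_; splitAt)
  open import Data.Vec.Properties using (take++drop≡id; ∷-injective; lookup-splitAt; lookup-map; lookup∘tabulate)
  open import Data.Vec.Relation.Unary.All as All using (All; []; _∷_)
  import Data.Vec.Relation.Unary.All.Properties as All
  open import Data.Product using (Σ; _×_; _,_; proj₁; proj₂)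
  open import Data.Sum using (_⊎_; inj₁; inj₂; [_,_]′)
  open import Data.Empty using (⊥-elim)
  open import Data.Unit using (⊤; tt)
  open import Function using (_∘_)
  open import Relation.Nullary
  open import Relation.Binary.PropositionalEquality

  -- Only an integral domain is asked for: root counting, elimination and interpolation below never
  -- invert an element, they cross-multiply and cancel nonzero factors.
  record FinDomain (q : ℕ) : Set where
    infixl 6 _⊕_
    infixl 7 _⊗_
    infix 8 ⊖_
    field
      _⊕_ _⊗_ : Fin q → Fin q → Fin q
      ⊖_ : Fin q → Fin q
      0F 1F : Fin q
      isCommutativeRing : IsCommutativeRing _≡_ _⊕_ _⊗_ ⊖_ 0F 1F
      1≢0 : ¬ (1F ≡ 0F)
      no-zero-div : ∀ x y → x ⊗ y ≡ 0F → x ≡ 0F ⊎ y ≡ 0F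

  -- Number of monomials in T variables with all exponents at most E.
  pN : ℕ → ℕ → ℕ
  pN zero E = 1
  pN (suc T) E = suc E * pN T E

  -- Denominator exponent after Newton interpolation at `n` nodes: each divided difference costs one
  -- division (`suc E`), and rebuilding the coefficients from those of the quotient multiplies by a
  -- node once more (`E +`).
  solveDeg : ℕ → ℕ → ℕ
  solveDeg zero E = E
  solveDeg (suc n) E = E + solveDeg n (suc E)

  solveDeg≥ : ∀ n {E E₀} → E₀ ≤ E → E₀ ≤ solveDeg n E
  solveDeg≥ zero le = le
  solveDeg≥ (suc n) {E} le = ≤-trans le (m≤m+n E _)

  module DomainTheory {q : ℕ} (𝔻 : FinDomain q) where
    open FinDomain 𝔻

    F : Set
    F = Fin q

    R : CommutativeRing 0ℓ 0ℓ
    R = record { isCommutativeRing = isCommutativeRing }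

    module R = CommutativeRing R
    module RP = RingProps R.ring
    open NatCoeff R.commutativeSemiring using (solve; _:+_; _:*_; _:=_)

    ⊕-inverse-unique : ∀ x y → x ⊕ y ≡ 0F → x ≡ ⊖ y
    ⊕-inverse-unique x y e = RP.+-inverseˡ-unique x y e

    x⊖y≡0 : ∀ x y → x ⊕ ⊖ y ≡ 0F → x ≡ y
    x⊖y≡0 x y e = trans (⊕-inverse-unique x (⊖ y) e) (RP.-‿involutive y)

    split-diff : ∀ x t → x ≡ t ⊕ (x ⊕ ⊖ t)
    split-diff x t = sym (trans (R.+-comm t _) (trans (R.+-assoc x (⊖ t) t)
      (trans (cong (x ⊕_) (R.-‿inverseˡ t)) (R.+-identityʳ x))))

    eval : ∀ {n} → Vec F n → F → F
    eval [] x = 0F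
    eval (a ∷ as) x = a ⊕ x ⊗ eval as x

    lookup-tail : ∀ {n} (v : Vec F (suc n)) i → lookup v (suc i) ≡ lookup (tail v) i
    lookup-tail (_ ∷ _) i = refl

    -- The quotient by X − t; its coefficients are the values at t of the proper suffixes.
    quot : ∀ {n} → Vec F (suc n) → F → Vec F n
    quot (a ∷ []) t = []
    quot (a ∷ as@(_ ∷ _)) t = eval as t ∷ quot as t

    eval-quot : ∀ {n} (α : Vec F (suc n)) t d → eval α (t ⊕ d) ≡ eval α t ⊕ d ⊗ eval (quot α t) (t ⊕ d)
    eval-quot (a ∷ []) t d = begin
      a ⊕ (t ⊕ d) ⊗ 0F          ≡⟨ cong (a ⊕_) (R.zeroʳ _) ⟩
      a ⊕ 0F                    ≡⟨ cong (a ⊕_) (sym (R.zeroʳ t)) ⟩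
      a ⊕ t ⊗ 0F                ≡⟨ sym (R.+-identityʳ _) ⟩
      a ⊕ t ⊗ 0F ⊕ 0F           ≡⟨ cong (a ⊕ t ⊗ 0F ⊕_) (sym (R.zeroʳ d)) ⟩
      a ⊕ t ⊗ 0F ⊕ d ⊗ 0F       ∎
      where open ≡-Reasoning
    eval-quot (a ∷ as@(_ ∷ _)) t d rewrite eval-quot as t d =
      solve 5 (λ a t d e b → (a :+ (t :+ d) :* (e :+ d :* b)) := (a :+ t :* e :+ d :* (e :+ (t :+ d) :* b)))
        refl a t d (eval as t) (eval (quot as t) (t ⊕ d))

    eval-quot′ : ∀ {n} (α : Vec F (suc n)) t x → eval α x ≡ eval α t ⊕ (x ⊕ ⊖ t) ⊗ eval (quot α t) x
    eval-quot′ α t x = subst (λ z → eval α z ≡ eval α t ⊕ (x ⊕ ⊖ t) ⊗ eval (quot α t) z)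
      (sym (split-diff x t)) (eval-quot α t (x ⊕ ⊖ t))

    zeros : ∀ {n} → Vec F n
    zeros = replicate _ 0F

    quot-zeros : ∀ {n} (α : Vec F (suc n)) t → eval α t ≡ 0F → quot α t ≡ zeros → α ≡ zeros
    quot-zeros (a ∷ []) t e _ = cong (_∷ []) (trans (sym (trans (cong (a ⊕_) (R.zeroʳ t)) (R.+-identityʳ a))) e)
    quot-zeros (a ∷ as@(_ ∷ _)) t e z with ∷-injective z
    ... | z₁ , z₂ = cong₂ _∷_
      (trans (sym (trans (cong (a ⊕_) (trans (cong (t ⊗_) z₁) (R.zeroʳ t))) (R.+-identityʳ a))) e)
      (quot-zeros as t z₁ z₂)

    -- One root splits off a linear factor. This factor is nonzero at the other points, so they are
    -- roots of the quotient, which vanishes by induction; `quot-zeros` carries that back.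
    roots⇒zeros : ∀ n (α : Vec F n) (x : Fin n → F) → (∀ {i j} → x i ≡ x j → i ≡ j) →
      (∀ i → eval α (x i) ≡ 0F) → α ≡ zeros
    roots⇒zeros zero [] x inj ev = refl
    roots⇒zeros (suc n) α x inj ev = quot-zeros α (x zero) (ev zero)
      (roots⇒zeros n (quot α (x zero)) (x ∘ suc) (λ e → suc-injective (inj e)) root)
      where
      root : ∀ i → eval (quot α (x zero)) (x (suc i)) ≡ 0F
      root i with no-zero-div (x (suc i) ⊕ ⊖ x zero) (eval (quot α (x zero)) (x (suc i)))
        (trans (sym (R.+-identityˡ _))
          (trans (cong (_⊕ (x (suc i) ⊕ ⊖ x zero) ⊗ eval (quot α (x zero)) (x (suc i))) (sym (ev zero)))
            (trans (sym (eval-quot′ α (x zero) (x (suc i)))) (ev (suc i)))))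
      ... | inj₂ z = z
      ... | inj₁ z with inj (x⊖y≡0 _ _ z)
      ...   | ()

    dot : ∀ {n} → Vec F n → Vec F n → F
    dot [] [] = 0F
    dot (x ∷ xs) (y ∷ ys) = x ⊗ y ⊕ dot xs ys

    dot-++ : ∀ {m n} (a : Vec F m) (b : Vec F n) c d → dot (a ++ b) (c ++ d) ≡ dot a c ⊕ dot b d
    dot-++ [] b [] d = sym (R.+-identityˡ _)
    dot-++ (x ∷ a) b (y ∷ c) d = trans (cong (x ⊗ y ⊕_) (dot-++ a b c d)) (sym (R.+-assoc _ _ _))

    dot-scaleʳ : ∀ {n} x (a b : Vec F n) → dot a (map (x ⊗_) b) ≡ x ⊗ dot a b
    dot-scaleʳ x [] [] = sym (R.zeroʳ x)
    dot-scaleʳ x (a ∷ as) (b ∷ bs) rewrite dot-scaleʳ x as bs =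
      solve 4 (λ x a b c → (a :* (x :* b) :+ x :* c) := (x :* (a :* b :+ c))) refl x a b (dot as bs)

    dot-scaleˡ : ∀ {n} x (a b : Vec F n) → dot (map (x ⊗_) a) b ≡ x ⊗ dot a b
    dot-scaleˡ x [] [] = sym (R.zeroʳ x)
    dot-scaleˡ x (a ∷ as) (b ∷ bs) rewrite dot-scaleˡ x as bs =
      solve 4 (λ x a b c → (x :* a :* b :+ x :* c) := (x :* (a :* b :+ c))) refl x a b (dot as bs)

    dot-+ˡ : ∀ {n} (a b c : Vec F n) → dot (zipWith _⊕_ a b) c ≡ dot a c ⊕ dot b c
    dot-+ˡ [] [] [] = sym (R.+-identityˡ _)
    dot-+ˡ (a ∷ as) (b ∷ bs) (c ∷ cs) rewrite dot-+ˡ as bs cs =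
      solve 5 (λ a b c d e → ((a :+ b) :* c :+ (d :+ e)) := (a :* c :+ d :+ (b :* c :+ e))) refl
        a b c (dot as cs) (dot bs cs)

    dot-zerosˡ : ∀ {n} (a : Vec F n) → dot zeros a ≡ 0F
    dot-zerosˡ [] = refl
    dot-zerosˡ (a ∷ as) = trans (cong₂ _⊕_ (R.zeroˡ a) (dot-zerosˡ as)) (R.+-identityʳ _)

    pows : ∀ {N} n → F → Vec F N → Vec F (n * N)
    pows zero x m = []
    pows (suc n) x m = m ++ map (x ⊗_) (pows n x m)

    mons : ∀ {T} → Vec F T → (E : ℕ) → Vec F (pN T E)
    mons [] E = 1F ∷ []
    mons (x ∷ v) E = pows (suc E) x (mons v E)

    -- The coefficients of the powers of the first variable, each evaluated at the monomials `m` of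
    -- the other variables; `pows` lists the monomials in matching blocks.
    chunkDots : ∀ {N} n → Vec F (n * N) → Vec F N → Vec F n
    chunkDots zero p m = []
    chunkDots {N} (suc n) p m = dot (take N p) m ∷ chunkDots n (drop N p) m

    dot-pows : ∀ {N} n (p : Vec F (n * N)) x (m : Vec F N) → dot p (pows n x m) ≡ eval (chunkDots n p m) x
    dot-pows zero [] x m = refl
    dot-pows {N} (suc n) p x m = begin
      dot p (m ++ map (x ⊗_) (pows n x m))
        ≡⟨ cong (λ z → dot z (m ++ map (x ⊗_) (pows n x m))) (sym (take++drop≡id N p)) ⟩
      dot (take N p ++ drop N p) (m ++ map (x ⊗_) (pows n x m))
        ≡⟨ dot-++ (take N p) (drop N p) m _ ⟩
      dot (take N p) m ⊕ dot (drop N p) (map (x ⊗_) (pows n x m))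
        ≡⟨ cong (dot (take N p) m ⊕_) (dot-scaleʳ x (drop N p) (pows n x m)) ⟩
      dot (take N p) m ⊕ x ⊗ dot (drop N p) (pows n x m)
        ≡⟨ cong (λ z → dot (take N p) m ⊕ x ⊗ z) (dot-pows n (drop N p) x m) ⟩
      dot (take N p) m ⊕ x ⊗ eval (chunkDots n (drop N p) m) x ∎
      where open ≡-Reasoning

    zeros-++ : ∀ m n → zeros {m} ++ zeros {n} ≡ zeros {m + n}
    zeros-++ zero n = refl
    zeros-++ (suc m) n = cong (0F ∷_) (zeros-++ m n)

    -- No nonzero polynomial with all exponents at most D vanishes on Q.
    Indep : ∀ {n} → ℕ → (Vec F n → Set) → Set
    Indep {n} D Q = (p : Vec F (pN n D)) → (∀ v → Q v → dot p (mons v D) ≡ 0F) → p ≡ zeros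

    Indep-mono : ∀ {n D} {Q Q′ : Vec F n → Set} → (∀ v → Q v → Q′ v) → Indep D Q → Indep D Q′
    Indep-mono sub ind p h = ind p (λ v qv → h v (sub v qv))

    Indep-nil : ∀ {D} {Q : Vec F 0 → Set} → Q [] → Indep D Q
    Indep-nil q₀ (c ∷ []) h = cong (_∷ []) (trans (sym (trans (R.+-identityʳ _) (R.*-identityʳ c))) (h [] q₀))

    chunks-vanish : ∀ {T D} {Q : Vec F T → Set} n (p : Vec F (n * pN T D)) → Indep D Q →
      (∀ w → Q w → chunkDots n p (mons w D) ≡ zeros) → p ≡ zeros
    chunks-vanish zero [] ind h = refl
    chunks-vanish {T} {D} (suc n) p ind h = begin
      p                                     ≡⟨ sym (take++drop≡id N p) ⟩
      take N p ++ drop N p                  ≡⟨ cong₂ _++_ e₁ e₂ ⟩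
      zeros {N} ++ zeros {n * N}            ≡⟨ zeros-++ N (n * N) ⟩
      zeros ∎
      where
      open ≡-Reasoning
      N = pN T D
      e₁ = ind (take N p) (λ w qw → proj₁ (∷-injective (h w qw)))
      e₂ = chunks-vanish n (drop N p) ind (λ w qw → proj₂ (∷-injective (h w qw)))

    -- Over a fixed `w` the relation becomes a univariate polynomial with `suc D` coefficients and
    -- `suc D` distinct roots. So each coefficient, itself a polynomial in `w`, vanishes throughout
    -- `Q′`.
    Indep-cons : ∀ {T D} {Q : Vec F (suc T) → Set} {Q′ : Vec F T → Set} → Indep D Q′ →
      (∀ w → Q′ w → Σ (Fin (suc D) → F) λ x → (∀ {i j} → x i ≡ x j → i ≡ j) × (∀ i → Q (x i ∷ w))) →
      Indep D Q
    Indep-cons {T} {D} ind ext p h = chunks-vanish (suc D) p ind vanish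
      where
      vanish : ∀ w → _ → chunkDots (suc D) p (mons w D) ≡ zeros
      vanish w qw with ext w qw
      ... | x , inj , qx = roots⇒zeros (suc D) _ x inj λ i →
        trans (sym (dot-pows (suc D) p (x i) (mons w D))) (h (x i ∷ w) (qx i))

    -- Polynomials are predicates on functions: Horner form in the first variable, with coefficients
    -- from a class `C` of functions of the others. Degrees are bounded in each variable separately,
    -- which matches `mons` and makes the number of monomials a power.
    data Horner {T} (C : (Vec F T → F) → Set) : ℕ → (Vec F (suc T) → F) → Set where
      hz : ∀ {f g} → C g → (∀ x v → f (x ∷ v) ≡ g v) → Horner C 0 f
      hs : ∀ {e f f′ g} → C g → Horner C e f′ → (∀ x v → f (x ∷ v) ≡ g v ⊕ x ⊗ f′ (x ∷ v)) → Horner C (suc e) f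

    Pol : (T E : ℕ) → (Vec F T → F) → Set
    Pol zero E f = ⊤
    Pol (suc T) E f = Horner (Pol T E) E f

    Horner-cong : ∀ {T C e} {f f′ : Vec F (suc T) → F} → (∀ v → f v ≡ f′ v) → Horner C e f → Horner C e f′
    Horner-cong eq (hz c h) = hz c (λ x v → trans (sym (eq _)) (h x v))
    Horner-cong eq (hs c k h) = hs c k (λ x v → trans (sym (eq _)) (h x v))

    Pol-cong : ∀ {T E} {f f′ : Vec F T → F} → (∀ v → f v ≡ f′ v) → Pol T E f → Pol T E f′
    Pol-cong {zero} eq p = tt
    Pol-cong {suc T} eq p = Horner-cong eq p

    Horner-map : ∀ {T C C′ e} {f : Vec F (suc T) → F} → (∀ {g} → C g → C′ g) → Horner C e f → Horner C′ e f
    Horner-map i (hz c h) = hz (i c) h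
    Horner-map i (hs c k h) = hs (i c) (Horner-map i k) h

    Horner-zero : ∀ {T} {C : (Vec F T → F) → Set} → C (λ _ → 0F) → ∀ e → Horner C e (λ _ → 0F)
    Horner-zero z zero = hz z (λ x v → refl)
    Horner-zero z (suc e) = hs z (Horner-zero z e) (λ x v → sym (trans (R.+-identityˡ _) (R.zeroʳ x)))

    Horner-lift : ∀ {T C e e′} {f : Vec F (suc T) → F} → C (λ _ → 0F) → e ≤ e′ → Horner C e f → Horner C e′ f
    Horner-lift {e′ = zero} z z≤n k = k
    Horner-lift {e′ = suc e′} z z≤n (hz c h) = hs c (Horner-zero z e′)
      (λ x v → trans (h x v) (sym (trans (cong (_ ⊕_) (R.zeroʳ x)) (R.+-identityʳ _))))
    Horner-lift z (s≤s le) (hs c k h) = hs c (Horner-lift z le k) h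

    Horner-+ : ∀ {T C e} {f f′ : Vec F (suc T) → F} → (∀ {g g′} → C g → C g′ → C (λ v → g v ⊕ g′ v)) →
      Horner C e f → Horner C e f′ → Horner C e (λ v → f v ⊕ f′ v)
    Horner-+ cl (hz c h) (hz c′ h′) = hz (cl c c′) (λ x v → cong₂ _⊕_ (h x v) (h′ x v))
    Horner-+ cl (hs c k h) (hs c′ k′ h′) = hs (cl c c′) (Horner-+ cl k k′)
      (λ x v → trans (cong₂ _⊕_ (h x v) (h′ x v))
        (solve 5 (λ a b x c d → (a :+ x :* b :+ (c :+ x :* d)) := (a :+ c :+ x :* (b :+ d))) refl _ _ x _ _))

    Horner-scale : ∀ {T} {C C′ C″ : (Vec F T → F) → Set} {e g f} →
      (∀ {g g′} → C g → C′ g′ → C″ (λ v → g v ⊗ g′ v)) →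
      C g → Horner C′ e f → Horner C″ e (λ v → g (tail v) ⊗ f v)
    Horner-scale cl c (hz c′ h) = hz (cl c c′) (λ x v → cong (_ ⊗_) (h x v))
    Horner-scale cl c (hs c′ k h) = hs (cl c c′) (Horner-scale cl c k)
      (λ x v → trans (cong (_ ⊗_) (h x v))
        (solve 4 (λ g a x b → (g :* (a :+ x :* b)) := (g :* a :+ x :* (g :* b))) refl _ _ x _))

    Horner-* : ∀ {T} {C C′ C″ : (Vec F T → F) → Set} {e e′ f f′} →
      C″ (λ _ → 0F) → (∀ {g g′} → C″ g → C″ g′ → C″ (λ v → g v ⊕ g′ v)) →
      (∀ {g g′} → C g → C′ g′ → C″ (λ v → g v ⊗ g′ v)) →
      Horner C e f → Horner C′ e′ f′ → Horner C″ (e + e′) (λ v → f v ⊗ f′ v)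
    Horner-* z add mul (hz c h) k′ = Horner-cong (λ { (x ∷ v) → cong (_⊗ _) (sym (h x v)) }) (Horner-scale mul c k′)
    Horner-* {e = suc e} {e′} {f} {f′} z add mul (hs {f′ = f₁} {g = g} c k h) k′ =
      Horner-cong eq (Horner-+ add (Horner-lift z (≤-trans (m≤n+m e′ e) (n≤1+n _)) (Horner-scale mul c k′))
        (hs {f′ = λ v → f₁ v ⊗ f′ v} z (Horner-* z add mul k k′) (λ x v → refl)))
      where
      eq : ∀ v → g (tail v) ⊗ f′ v ⊕ (0F ⊕ head v ⊗ (f₁ (head v ∷ tail v) ⊗ f′ (head v ∷ tail v))) ≡ f v ⊗ f′ v
      eq (x ∷ v) = trans (cong (g v ⊗ f′ (x ∷ v) ⊕_) (R.+-identityˡ _)) (trans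
        (solve 4 (λ g f x a → (g :* f :+ x :* (a :* f)) := ((g :+ x :* a) :* f)) refl (g v) (f′ (x ∷ v)) x (f₁ (x ∷ v)))
        (cong (_⊗ f′ (x ∷ v)) (sym (h x v))))

    Pol-const : ∀ {T E} c → Pol T E (λ _ → c)
    Pol-const {zero} c = tt
    Pol-const {suc T} {E} c = Horner-lift (Pol-const 0F) z≤n (hz {g = λ _ → c} (Pol-const c) (λ x v → refl))

    Pol-mono : ∀ {T E E′ f} → E ≤ E′ → Pol T E f → Pol T E′ f
    Pol-mono {zero} le p = tt
    Pol-mono {suc T} le p = Horner-lift (Pol-const 0F) le (Horner-map (Pol-mono le) p)

    Pol-+ : ∀ {T E f f′} → Pol T E f → Pol T E f′ → Pol T E (λ v → f v ⊕ f′ v)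
    Pol-+ {zero} p p′ = tt
    Pol-+ {suc T} p p′ = Horner-+ Pol-+ p p′

    Pol-* : ∀ {T E E′ f f′} → Pol T E f → Pol T E′ f′ → Pol T (E + E′) (λ v → f v ⊗ f′ v)
    Pol-* {zero} p p′ = tt
    Pol-* {suc T} p p′ = Horner-* (Pol-const 0F) Pol-+ Pol-* p p′

    Pol-lookup : ∀ {T} (i : Fin T) → Pol T 1 (λ v → lookup v i)
    Pol-lookup {suc T} zero = hs (Pol-const 0F) (hz {f = λ _ → 1F} (Pol-const 1F) (λ _ _ → refl))
      (λ x v → sym (trans (R.+-identityˡ _) (R.*-identityʳ x)))
    Pol-lookup {suc T} (suc i) = Horner-lift (Pol-const 0F) z≤n (hz (Pol-lookup i) (λ x v → refl))

    Horner-span : ∀ {T E C e} {f : Vec F (suc T) → F} →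
      (∀ {g} → C g → Σ (Vec F (pN T E)) λ c → ∀ v → g v ≡ dot c (mons v E)) → Horner C e f →
      Σ (Vec F (suc e * pN T E)) λ c → ∀ x v → f (x ∷ v) ≡ dot c (pows (suc e) x (mons v E))
    Horner-span span (hz k h) with span k
    ... | c , eq = c ++ [] , λ x v → trans (h x v) (trans (eq v)
      (sym (trans (dot-++ c [] (mons v _) []) (R.+-identityʳ _))))
    Horner-span {E = E} {e = suc e} span (hs k r h) with span k | Horner-span span r
    ... | c , eq | c′ , eq′ = c ++ c′ , λ x v → trans (h x v)
      (trans (cong₂ (λ a b → a ⊕ x ⊗ b) (eq v) (eq′ x v))
        (sym (trans (dot-++ c c′ (mons v E) _) (cong (_ ⊕_) (dot-scaleʳ x c′ (pows (suc e) x (mons v E)))))))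

    Pol-span : ∀ {T E f} → Pol T E f → Σ (Vec F (pN T E)) λ c → ∀ v → f v ≡ dot c (mons v E)
    Pol-span {zero} {E} {f} p = f [] ∷ [] , λ { [] → sym (trans (R.+-identityʳ _) (R.*-identityʳ (f []))) }
    Pol-span {suc T} p with Horner-span Pol-span p
    ... | c , eq = c , λ { (x ∷ v) → eq x v }

    dot-insert : ∀ {n} (e : Vec F (suc n)) i p a →
      dot e (insertAt p i a) ≡ lookup e i ⊗ a ⊕ dot (removeAt e i) p
    dot-insert (x ∷ e) zero p a = refl
    dot-insert (x ∷ y ∷ e) (suc i) (b ∷ p) a rewrite dot-insert (y ∷ e) i p a =
      solve 5 (λ x b l a d → (x :* b :+ (l :* a :+ d)) := (l :* a :+ (x :* b :+ d))) refl
        x b (lookup (y ∷ e) i) a (dot (removeAt (y ∷ e) i) p)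

    find-nonzero : ∀ {n} (e : Vec F n) → e ≡ zeros ⊎ Σ (Fin n) λ i → ¬ (lookup e i ≡ 0F)
    find-nonzero [] = inj₁ refl
    find-nonzero (x ∷ e) with x ≟ 0F
    ... | no ¬p = inj₂ (zero , ¬p)
    ... | yes refl with find-nonzero e
    ...   | inj₁ z = inj₁ (cong (0F ∷_) z)
    ...   | inj₂ (i , h) = inj₂ (suc i , h)

    insert-zeros : ∀ {n} (p : Vec F n) i a → insertAt p i a ≡ zeros → p ≡ zeros
    insert-zeros p zero a e = proj₂ (∷-injective e)
    insert-zeros (b ∷ p) (suc i) a e with ∷-injective e
    ... | e₁ , e₂ = cong₂ _∷_ e₁ (insert-zeros p i a e₂)

    scale-zeros : ∀ {n} c (p : Vec F n) → ¬ (c ≡ 0F) → map (c ⊗_) p ≡ zeros → p ≡ zeros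
    scale-zeros c [] c≢0 e = refl
    scale-zeros c (b ∷ p) c≢0 e with ∷-injective e
    ... | e₁ , e₂ with no-zero-div c b e₁
    ...   | inj₁ z = ⊥-elim (c≢0 z)
    ...   | inj₂ z = cong₂ _∷_ z (scale-zeros c p c≢0 e₂)

    -- Gaussian elimination without division. With pivot c = e_i, every other equation e′ becomes c
    -- e′ - e′_i e with position i removed; a solution p′ lifts to c p′ with -(r · p′) inserted at
    -- i.
    kernel : ∀ {n} N (eqs : Vec (Vec F n) N) → N < n →
      Σ (Vec F n) λ p → ¬ (p ≡ zeros) × All (λ e → dot e p ≡ 0F) eqs
    kernel {suc n} zero [] _ = 1F ∷ zeros , (λ e → 1≢0 (proj₁ (∷-injective e))) , []
    kernel {suc n} (suc N) (e ∷ eqs) (s≤s lt) with find-nonzero e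
    ... | inj₁ z with kernel N eqs (m≤n⇒m≤1+n lt)
    ...   | p , nz , sol = p , nz , trans (cong (λ u → dot u p) z) (dot-zerosˡ p) ∷ sol
    kernel {suc n} (suc N) (e ∷ eqs) (s≤s lt) | inj₂ (i , c≢0)
      with kernel N (map (λ e′ → zipWith _⊕_ (map (lookup e i ⊗_) (removeAt e′ i))
                                             (map (⊖ lookup e′ i ⊗_) (removeAt e i))) eqs) lt
    ... | p′ , nz , sol = p , nz′ , sol₀ ∷ All.map (λ {e′} → sol₁ {e′}) (All.map⁻ sol)
      where
      c = lookup e i
      r = removeAt e i
      p = insertAt (map (c ⊗_) p′) i (⊖ dot r p′)
      nz′ : ¬ (p ≡ zeros)
      nz′ z = nz (scale-zeros c p′ c≢0 (insert-zeros _ i _ z))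
      sol₀ : dot e p ≡ 0F
      sol₀ = begin
        dot e p                                    ≡⟨ dot-insert e i _ _ ⟩
        c ⊗ ⊖ dot r p′ ⊕ dot r (map (c ⊗_) p′)     ≡⟨ cong₂ _⊕_ (sym (RP.-‿distribʳ-* c _)) (dot-scaleʳ c r p′) ⟩
        ⊖ (c ⊗ dot r p′) ⊕ c ⊗ dot r p′            ≡⟨ R.-‿inverseˡ _ ⟩
        0F                                         ∎
        where open ≡-Reasoning
      sol₁ : ∀ {e′} → dot (zipWith _⊕_ (map (c ⊗_) (removeAt e′ i)) (map (⊖ lookup e′ i ⊗_) r)) p′ ≡ 0F →
        dot e′ p ≡ 0F
      sol₁ {e′} h = begin
        dot e′ p                                                  ≡⟨ dot-insert e′ i _ _ ⟩
        c′ ⊗ ⊖ dot r p′ ⊕ dot r′ (map (c ⊗_) p′)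
          ≡⟨ cong₂ _⊕_ (trans (sym (RP.-‿distribʳ-* c′ _)) (RP.-‿distribˡ-* c′ _)) (dot-scaleʳ c r′ p′) ⟩
        ⊖ c′ ⊗ dot r p′ ⊕ c ⊗ dot r′ p′                           ≡⟨ R.+-comm _ _ ⟩
        c ⊗ dot r′ p′ ⊕ ⊖ c′ ⊗ dot r p′
          ≡⟨ sym (trans (dot-+ˡ (map (c ⊗_) r′) (map (⊖ c′ ⊗_) r) p′) (cong₂ _⊕_ (dot-scaleˡ c r′ p′) (dot-scaleˡ (⊖ c′) r p′))) ⟩
        dot (zipWith _⊕_ (map (c ⊗_) r′) (map (⊖ c′ ⊗_) r)) p′    ≡⟨ h ⟩
        0F ∎
        where
        open ≡-Reasoning
        c′ = lookup e′ i
        r′ = removeAt e′ i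

    columns : ∀ {n N} → Vec (Vec F N) n → Vec (Vec F n) N
    columns [] = replicate _ []
    columns (r ∷ rs) = zipWith _∷_ r (columns rs)

    -- The combination of the rows with coefficients `p` is the zero vector, because its entries are
    -- the products of `p` with the columns; so its product with `m` vanishes too.
    columns-kernel : ∀ {n N} (rows : Vec (Vec F N) n) (p : Vec F n) (m : Vec F N) →
      All (λ e → dot e p ≡ 0F) (columns rows) → dot p (map (λ r → dot r m) rows) ≡ 0F
    columns-kernel rows p m h = trans (sym (dot-comb rows p m))
      (trans (cong (λ u → dot u m) (allzero (columns rows) (comb-columns rows p) h)) (dot-zerosˡ m))
      where
      comb : ∀ {n N} → Vec (Vec F N) n → Vec F n → Vec F N
      comb [] [] = zeros
      comb (r ∷ rs) (a ∷ p) = zipWith _⊕_ (map (a ⊗_) r) (comb rs p)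
      dot-comb : ∀ {n N} (rows : Vec (Vec F N) n) p m → dot (comb rows p) m ≡ dot p (map (λ r → dot r m) rows)
      dot-comb [] [] m = dot-zerosˡ m
      dot-comb (r ∷ rs) (a ∷ p) m = trans (dot-+ˡ (map (a ⊗_) r) (comb rs p) m)
        (cong₂ _⊕_ (dot-scaleˡ a r m) (dot-comb rs p m))
      data Rel {n} (p : Vec F n) : ∀ {N} → Vec F N → Vec (Vec F n) N → Set where
        [] : Rel p [] []
        _∷_ : ∀ {N x e} {xs : Vec F N} {es} → x ≡ dot e p → Rel p xs es → Rel p (x ∷ xs) (e ∷ es)
      rel-zero : ∀ N → Rel [] (zeros {N}) (replicate N [])
      rel-zero zero = []
      rel-zero (suc N) = refl ∷ rel-zero N
      rel-step : ∀ {n N} a (p : Vec F n) (r : Vec F N) xs es → Rel p xs es →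
        Rel (a ∷ p) (zipWith _⊕_ (map (a ⊗_) r) xs) (zipWith _∷_ r es)
      rel-step a p [] [] [] [] = []
      rel-step a p (b ∷ r) (x ∷ xs) (e ∷ es) (eq ∷ k) = cong₂ _⊕_ (R.*-comm a b) eq ∷ rel-step a p r xs es k
      comb-columns : ∀ {n N} (rows : Vec (Vec F N) n) p → Rel p (comb rows p) (columns rows)
      comb-columns [] [] = rel-zero _
      comb-columns (r ∷ rs) (a ∷ p) = rel-step a p r _ _ (comb-columns rs p)
      allzero : ∀ {n N} {p : Vec F n} {xs : Vec F N} es → Rel p xs es → All (λ e → dot e p ≡ 0F) es → xs ≡ zeros
      allzero [] [] [] = refl
      allzero (e ∷ es) (eq ∷ k) (h ∷ h′) = cong₂ _∷_ (trans eq h) (allzero es k h′)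

    pw : F → ℕ → F
    pw x zero = 1F
    pw x (suc n) = x ⊗ pw x n

    pw-+ : ∀ x m n → pw x (m + n) ≡ pw x m ⊗ pw x n
    pw-+ x zero n = sym (R.*-identityˡ _)
    pw-+ x (suc m) n = trans (cong (x ⊗_) (pw-+ x m n)) (sym (R.*-assoc x _ _))

    pw-nonzero : ∀ x n → ¬ (x ≡ 0F) → ¬ (pw x n ≡ 0F)
    pw-nonzero x zero h e = 1≢0 e
    pw-nonzero x (suc n) h e with no-zero-div x (pw x n) e
    ... | inj₁ z = h z
    ... | inj₂ z = pw-nonzero x n h z

    Pol-pw : ∀ {T c δ} → Pol T c δ → ∀ n → Pol T (n * c) (λ v → pw (δ v) n)
    Pol-pw p zero = Pol-const 1F
    Pol-pw p (suc n) = Pol-* p (Pol-pw p n)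

    module Rational {S : Set} {T c : ℕ} (gens : S → Vec F T) (δ : Vec F T → F) (δ-pol : Pol T c δ) where

      Δ : S → F
      Δ s = δ (gens s)

      -- φ is a polynomial in the generators divided by Δ ^ E.
      record Rat (E : ℕ) (φ : S → F) : Set where
        constructor rational
        field
          numerator : Vec F T → F
          numerator-pol : Pol T (E * suc c) numerator
          equation : ∀ s → pw (Δ s) E ⊗ φ s ≡ numerator (gens s)

      Rat-cong : ∀ {E φ φ′} → (∀ s → φ s ≡ φ′ s) → Rat E φ → Rat E φ′
      Rat-cong {E} eq (rational f p h) = rational f p λ s → trans (cong (pw (Δ s) E ⊗_) (sym (eq s))) (h s)

      -- Padding with δ^d gives degree d c + d = d (c + 1), so that the single number `E` records
      -- both the power of Δ and the degree of the numerator.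
      Rat-pol : ∀ {d f} → Pol T d f → Rat d (f ∘ gens)
      Rat-pol {d} {f} p = rational (λ v → pw (δ v) d ⊗ f v)
        (Pol-mono (≤-reflexive (trans (+-comm (d * c) d) (sym (*-suc d c)))) (Pol-* (Pol-pw δ-pol d) p)) λ s → refl

      Rat-raise : ∀ e {E φ} → Rat E φ → Rat (e + E) φ
      Rat-raise e {E} {φ} (rational f p h) = rational (λ v → pw (δ v) e ⊗ f v)
        (Pol-mono (≤-trans (+-monoˡ-≤ _ (*-monoʳ-≤ e (n≤1+n c))) (≤-reflexive (sym (*-distribʳ-+ (suc c) e E))))
          (Pol-* (Pol-pw δ-pol e) p))
        λ s → trans (cong (_⊗ φ s) (pw-+ (Δ s) e E)) (trans (R.*-assoc _ _ _) (cong (pw (Δ s) e ⊗_) (h s)))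

      Rat-mono : ∀ {E E′ φ} → E ≤ E′ → Rat E φ → Rat E′ φ
      Rat-mono {E} {E′} {φ} le r = subst (λ z → Rat z φ) (m∸n+n≡m le) (Rat-raise (E′ ∸ E) r)

      Rat-const : ∀ {E} k → Rat E (λ _ → k)
      Rat-const k = Rat-mono z≤n (Rat-pol (Pol-const k))

      Rat-+ : ∀ {E φ φ′} → Rat E φ → Rat E φ′ → Rat E (λ s → φ s ⊕ φ′ s)
      Rat-+ {E} {φ} {φ′} (rational f p h) (rational f′ p′ h′) = rational _ (Pol-+ p p′) λ s → trans (R.distribˡ (pw (Δ s) E) (φ s) (φ′ s)) (cong₂ _⊕_ (h s) (h′ s))

      Rat-* : ∀ {E E′ φ φ′} → Rat E φ → Rat E′ φ′ → Rat (E + E′) (λ s → φ s ⊗ φ′ s)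
      Rat-* {E} {E′} {φ} {φ′} (rational f p h) (rational f′ p′ h′) = rational _
        (Pol-mono (≤-reflexive (sym (*-distribʳ-+ (suc c) E E′))) (Pol-* p p′))
        λ s → trans (cong (_⊗ (φ s ⊗ φ′ s)) (pw-+ (Δ s) E E′))
          (trans (solve 4 (λ a b x y → (a :* b :* (x :* y)) := (a :* x :* (b :* y))) refl _ _ (φ s) (φ′ s))
            (cong₂ _⊗_ (h s) (h′ s)))

      Rat-neg : ∀ {E φ} → Rat E φ → Rat E (λ s → ⊖ φ s)
      Rat-neg {E} {φ} r = Rat-cong (λ s → trans (sym (RP.-‿distribˡ-* 1F (φ s))) (cong ⊖_ (R.*-identityˡ _)))
        (Rat-* {0} (Rat-const (⊖ 1F)) r)

      -- On `S` the reciprocal of `d` is `co` divided by Δ, so the division costs one more power of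
      -- Δ and c more in the degree.
      Rat-div : ∀ {E φ} (d : S → F) {co : Vec F T → F} → Pol T c co → (∀ s → d s ⊗ co (gens s) ≡ Δ s) →
        Rat E (λ s → d s ⊗ φ s) → Rat (suc E) φ
      Rat-div {E} {φ} d {co} pco eq (rational f p h) = rational (λ v → co v ⊗ f v) (Pol-mono (n≤1+n _) (Pol-* pco p)) λ s →
        trans (cong (λ z → z ⊗ pw (Δ s) E ⊗ φ s) (sym (eq s)))
          (trans (solve 4 (λ d k x y → (d :* k :* x :* y) := (k :* (x :* (d :* y)))) refl (d s) (co (gens s)) (pw (Δ s) E) (φ s))
            (cong (co (gens s) ⊗_) (h s)))

      Rat-eval : ∀ {E E′} n (a : S → Vec F n) (x : S → F) → (∀ i → Rat E (λ s → lookup (a s) i)) → Rat E′ x →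
        Rat (n * E′ + E) (λ s → eval (a s) (x s))
      Rat-eval zero a x ra rx = Rat-cong (λ s → sym (eval-nil (a s) (x s))) (Rat-const 0F)
        where
        eval-nil : ∀ (v : Vec F 0) y → eval v y ≡ 0F
        eval-nil [] y = refl
      Rat-eval {E} {E′} (suc n) a x ra rx = Rat-cong (λ s → eval-cons (a s) (x s))
        (Rat-+ (Rat-mono (m≤n+m E (suc n * E′)) (ra zero))
          (Rat-mono (≤-reflexive (sym (+-assoc E′ _ E)))
            (Rat-* rx (Rat-eval n (tail ∘ a) x (λ i → Rat-cong (λ s → lookup-tail (a s) i) (ra (suc i))) rx))))
        where
        eval-cons : ∀ {n} (v : Vec F (suc n)) y → lookup v zero ⊕ y ⊗ eval (tail v) y ≡ eval v y
        eval-cons (_ ∷ _) y = refl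

      -- Entry τ of `quot` is the value at t of the suffix of α that starts at τ + 1. A coefficient
      -- is the value of the suffix starting at it minus t times the value of the next one.
      coeffs-from-quot : ∀ {E E₁} n (α : S → Vec F (suc n)) (t : S → F) → Rat E t →
        Rat E₁ (λ s → eval (α s) (t s)) → (∀ i → Rat E₁ (λ s → lookup (quot (α s) (t s)) i)) →
        ∀ τ → Rat (E + E₁) (λ s → lookup (α s) τ)
      coeffs-from-quot {E} zero α t rt rv rq zero = Rat-raise E (Rat-cong (λ s → single (α s) (t s)) rv)
        where
        single : ∀ (v : Vec F 1) y → eval v y ≡ lookup v zero
        single (a ∷ []) y = trans (cong (a ⊕_) (R.zeroʳ y)) (R.+-identityʳ a)
      coeffs-from-quot {E} (suc n) α t rt rv rq zero =
        Rat-cong (λ s → top (α s) (t s)) (Rat-+ (Rat-raise E rv) (Rat-neg (Rat-* rt (rq zero))))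
        where
        top : ∀ {n} (v : Vec F (2 + n)) y → eval v y ⊕ ⊖ (y ⊗ lookup (quot v y) zero) ≡ lookup v zero
        top (a ∷ as@(_ ∷ _)) y = trans (R.+-assoc a _ _)
          (trans (cong (a ⊕_) (R.-‿inverseʳ (y ⊗ eval as y))) (R.+-identityʳ a))
      coeffs-from-quot (suc n) α t rt rv rq (suc τ) = Rat-cong (λ s → sym (lookup-tail (α s) τ))
        (coeffs-from-quot n (tail ∘ α) t rt (Rat-cong (λ s → quot₀ (α s) (t s)) (rq zero))
          (λ i → Rat-cong (λ s → quot₁ (α s) (t s) i) (rq (suc i))) τ)
        where
        quot₀ : ∀ {n} (v : Vec F (2 + n)) y → lookup (quot v y) zero ≡ eval (tail v) y
        quot₀ (_ ∷ _ ∷ _) y = refl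
        quot₁ : ∀ {n} (v : Vec F (2 + n)) y i → lookup (quot v y) (suc i) ≡ lookup (quot (tail v) y) i
        quot₁ (_ ∷ _ ∷ _) y i = refl

      -- Newton interpolation: the coefficients are rational in the nodes and the values.
      interpolate : ∀ n {E} (α : S → Vec F n) (θ : Fin n → S → F) → (∀ i → Rat E (θ i)) →
        (∀ i → Rat E (λ s → eval (α s) (θ i s))) →
        (∀ i j → ¬ (i ≡ j) → ∀ {E′ φ} → Rat E′ (λ s → (θ i s ⊕ ⊖ θ j s) ⊗ φ s) → Rat (suc E′) φ) →
        ∀ τ → Rat (solveDeg n E) (λ s → lookup (α s) τ)
      interpolate zero α θ rθ rv div ()
      interpolate (suc n) {E} α θ rθ rv div = coeffs-from-quot n α (θ zero) (rθ zero)
        (Rat-mono (solveDeg≥ n (n≤1+n E)) (rv zero))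
        (interpolate n (λ s → quot (α s) (θ zero s)) (θ ∘ suc) (λ i → Rat-raise 1 (rθ (suc i)))
          (λ i → div (suc i) zero (λ ()) (Rat-cong (λ s → diff (α s) (θ zero s) (θ (suc i) s))
            (Rat-+ (rv (suc i)) (Rat-neg (rv zero)))))
          (λ i j i≢j → div (suc i) (suc j) (λ e → i≢j (suc-injective e))))
        where
        diff : ∀ (v : Vec F (suc n)) t x → eval v x ⊕ ⊖ eval v t ≡ (x ⊕ ⊖ t) ⊗ eval (quot v t) x
        diff v t x = trans (cong (_⊕ ⊖ eval v t) (trans (eval-quot′ v t x) (R.+-comm _ _)))
          (trans (R.+-assoc ((x ⊕ ⊖ t) ⊗ eval (quot v t) x) _ _)
            (trans (cong ((x ⊕ ⊖ t) ⊗ eval (quot v t) x ⊕_) (R.-‿inverseʳ (eval v t))) (R.+-identityʳ _)))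

      Rat-pows : ∀ {N E E₁} n (x : S → F) (m : S → Vec F N) → Rat E x → (∀ i → Rat E₁ (λ s → lookup (m s) i)) →
        ∀ i → Rat (n * E + E₁) (λ s → lookup (pows n (x s) (m s)) i)
      Rat-pows zero x m rx rm ()
      Rat-pows {N} {E} {E₁} (suc n) x m rx rm i with splitAt N i in eq
      ... | inj₁ j = Rat-cong (λ s → sym (trans (lookup-splitAt N (m s) _ i) (cong [ _ , _ ]′ eq)))
        (Rat-mono (m≤n+m E₁ (suc n * E)) (rm j))
      ... | inj₂ j = Rat-cong (λ s → sym (trans (lookup-splitAt N (m s) _ i)
          (trans (cong [ _ , _ ]′ eq) (lookup-map j (x s ⊗_) (pows n (x s) (m s))))))
        (Rat-mono (≤-reflexive (sym (+-assoc E _ E₁))) (Rat-* rx (Rat-pows n x m rx rm j)))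

      Rat-mons : ∀ {E} n D (φ : S → Vec F n) → (∀ i → Rat E (λ s → lookup (φ s) i)) →
        ∀ i → Rat (n * (suc D * E)) (λ s → lookup (mons (φ s) D) i)
      Rat-mons zero D φ rφ zero = Rat-cong (λ s → one (φ s)) (Rat-const 1F)
        where
        one : ∀ (v : Vec F 0) → 1F ≡ lookup (mons v D) zero
        one [] = refl
      Rat-mons {E} (suc n) D φ rφ i = Rat-cong (λ s → cons (φ s)) (Rat-pows (suc D) (λ s → lookup (φ s) zero) (λ s → mons (tail (φ s)) D) (rφ zero)
        (Rat-mons n D (tail ∘ φ) (λ j → Rat-cong (λ s → lookup-tail (φ s) j) (rφ (suc j)))) i)
        where
        cons : ∀ (v : Vec F (suc n)) → lookup (pows (suc D) (lookup v zero) (mons (tail v) D)) i ≡ lookup (mons v D) i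
        cons (_ ∷ _) = refl

      represent : ∀ {N E} (ψ : S → Vec F N) → (∀ i → Rat E (λ s → lookup (ψ s) i)) →
        Σ (Vec (Vec F (pN T (E * suc c))) N) λ rows →
          ∀ s → map (pw (Δ s) E ⊗_) (ψ s) ≡ map (λ r → dot r (mons (gens s) (E * suc c))) rows
      represent {zero} ψ r = [] , λ s → nil (ψ s)
        where
        nil : ∀ {g : F → F} (v : Vec F 0) → map g v ≡ []
        nil [] = refl
      represent {suc N} ψ r with r zero | represent (tail ∘ ψ) (λ i → Rat-cong (λ s → lookup-tail (ψ s) i) (r (suc i)))
      ... | rational f p h | rows , eqs with Pol-span p
      ...   | c₀ , sp = c₀ ∷ rows , λ s → cons (ψ s) (trans (h s) (sp (gens s))) (eqs s)
        where
        cons : ∀ {g : F → F} {n} {w x} (v : Vec F (suc n)) → g (lookup v zero) ≡ x → map g (tail v) ≡ w → map g v ≡ x ∷ w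
        cons (_ ∷ _) e₁ e₂ = cong₂ _∷_ e₁ e₂

    -- Finitely many strata, each with T generators, cannot carry n > T functions that are
    -- algebraically independent up to a large enough degree.
    dependent : ∀ {S : Set} {n T c k E} D (φ : S → Vec F n) (P : Fin k → S → Set)
      (gens : Fin k → S → Vec F T) (δ : Fin k → Vec F T → F) (δ-pol : ∀ μ → Pol T c (δ μ)) →
      (∀ s → Σ (Fin k) λ μ → P μ s × ¬ (δ μ (gens μ s) ≡ 0F)) →
      (∀ μ i → Rational.Rat {S = Σ S (P μ)} (gens μ ∘ proj₁) (δ μ) (δ-pol μ) E (λ s → lookup (φ (proj₁ s)) i)) →
      k * pN T (n * (suc D * E) * suc c) < pN n D →
      Σ (Vec F (pN n D)) λ p → ¬ (p ≡ zeros) × (∀ s → dot p (mons (φ s) D) ≡ 0F)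
    dependent {S} {n} {T} {c} {k} {E} D φ P gens δ δ-pol stratum rat lt = p , proj₁ (proj₂ ker) , vanish
      where
      module Rt (μ : Fin k) = Rational {S = Σ S (P μ)} (gens μ ∘ proj₁) (δ μ) (δ-pol μ)
      E′ = n * (suc D * E)
      rep : ∀ μ → _
      rep μ = Rt.represent μ (λ s → mons (φ (proj₁ s)) D) (Rt.Rat-mons μ n D (φ ∘ proj₁) (rat μ))
      eqs : Fin k → Vec (Vec F (pN n D)) (pN T (E′ * suc c))
      eqs μ = columns (proj₁ (rep μ))
      ker = kernel _ (concat (tabulate eqs)) lt
      p = proj₁ ker
      sol : ∀ μ → All (λ e → dot e p ≡ 0F) (eqs μ)
      sol μ = subst (All _) (lookup∘tabulate eqs μ)
        (All.lookup⁺ (All.concat⁻ (tabulate eqs) (proj₂ (proj₂ ker))) μ)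
      vanish : ∀ s → dot p (mons (φ s) D) ≡ 0F
      vanish s with stratum s
      ... | μ , pμ , nz with no-zero-div (pw (Rt.Δ μ (s , pμ)) E′) (dot p (mons (φ s) D))
        (trans (sym (dot-scaleʳ _ p (mons (φ s) D))) (trans (cong (dot p) (proj₂ (rep μ) (s , pμ)))
          (columns-kernel (proj₁ (rep μ)) p _ (sol μ))))
      ...   | inj₁ z = ⊥-elim (pw-nonzero _ E′ nz z)
      ...   | inj₂ z = z

-- Exhaustive search, the union bound, and the Sauer-Shelah dichotomy.

module Shattering where

  open import Defs
  open FiniteSums
  open Polynomials
  open import Data.Nat hiding (_≟_)
  open import Data.Nat.Properties hiding (suc-injective; _≟_)
  open import Data.Fin using (Fin; zero; suc)
  import Data.Fin.Properties as Fin
  open import Data.Bool using (Bool; true; false; _≟_)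
  open import Data.Vec using (Vec; []; _∷_; zipWith)
  open import Data.Vec.Properties using (∷-injective)
  open import Data.Product using (Σ; _×_; _,_; proj₁; proj₂)
  open import Data.Sum using (_⊎_; inj₁; inj₂)
  open import Data.Empty using (⊥-elim)
  open import Function using (_∘_)
  open import Relation.Nullary
  open import Relation.Nullary.Decidable using (dec-true; dec-false; ¬?; _×-dec_; map′; _→-dec_; decidable-stable)
  open import Relation.Binary.PropositionalEquality

  does-true : ∀ {P : Set} (d : Dec P) → does d ≡ true → P
  does-true (yes p) _ = p

  does-false : ∀ {P : Set} (d : Dec P) → does d ≡ false → ¬ P
  does-false (no p) _ = p

  -- Finite search stands in for classical reasoning: badness of a coefficient vector quantifies
  -- over families of paths, and `cntV` counts Boolean predicates only.
  Searchable : Set → Set₁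
  Searchable A = ∀ {P : A → Set} → (∀ a → Dec (P a)) → Dec (Σ A P)

  search-Fin : ∀ n → Searchable (Fin n)
  search-Fin n = Fin.any?

  search-Vec : ∀ {A} → Searchable A → ∀ n → Searchable (Vec A n)
  search-Vec s zero d = map′ (λ p → [] , p) (λ { ([] , p) → p }) (d [])
  search-Vec s (suc n) d = map′ (λ { (x , v , p) → x ∷ v , p }) (λ { (x ∷ v , p) → x , v , p })
    (s (λ x → search-Vec s n (λ v → d (x ∷ v))))

  module _ {q : ℕ} where

    -- The first coordinate is summed innermost, so that the fibre over a tail `w` appears as one
    -- inner sum, which is what `shatter` compares with D.
    sumV : ∀ n → (Vec (Fin q) n → ℕ) → ℕ
    sumV zero f = f []
    sumV (suc n) f = sumV n (λ w → sumFin q (λ x → f (x ∷ w)))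

    cntV : ∀ {n} → (Vec (Fin q) n → Bool) → ℕ
    cntV {n} P = sumV n (ι ∘ P)

    sumV-mono : ∀ n {f g : Vec (Fin q) n → ℕ} → (∀ v → f v ≤ g v) → sumV n f ≤ sumV n g
    sumV-mono zero h = h []
    sumV-mono (suc n) h = sumV-mono n (λ w → sum-mono q (λ x → h (x ∷ w)))

    sumV-cong : ∀ n {f g : Vec (Fin q) n → ℕ} → (∀ v → f v ≡ g v) → sumV n f ≡ sumV n g
    sumV-cong zero h = h []
    sumV-cong (suc n) h = sumV-cong n (λ w → sum-cong q (λ x → h (x ∷ w)))

    sumV-+ : ∀ n (f g : Vec (Fin q) n → ℕ) → sumV n (λ v → f v + g v) ≡ sumV n f + sumV n g
    sumV-+ zero f g = refl
    sumV-+ (suc n) f g = trans (sumV-cong n (λ w → sum-+ q _ _)) (sumV-+ n _ _)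

    sumV-*ˡ : ∀ n c (f : Vec (Fin q) n → ℕ) → sumV n (λ v → c * f v) ≡ c * sumV n f
    sumV-*ˡ zero c f = refl
    sumV-*ˡ (suc n) c f = trans (sumV-cong n (λ w → sum-*ˡ q c _)) (sumV-*ˡ n c _)

    sumV-const : ∀ n c → sumV n (λ _ → c) ≡ q ^ n * c
    sumV-const zero c = sym (+-identityʳ c)
    sumV-const (suc n) c = trans (sumV-cong n (λ _ → sum-const q c)) (trans (sumV-const n (q * c))
      (trans (sym (*-assoc (q ^ n) q c)) (cong (_* c) (*-comm (q ^ n) q))))

    sumV-sumFin : ∀ n m (f : Vec (Fin q) n → Fin m → ℕ) →
      sumV n (λ v → sumFin m (f v)) ≡ sumFin m (λ i → sumV n (λ v → f v i))
    sumV-sumFin zero m f = refl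
    sumV-sumFin (suc n) m f = trans (sumV-cong n (λ w → sum-swap q m (λ x i → f (x ∷ w) i)))
      (sumV-sumFin n m _)

    sumV-swap : ∀ n m (f : Vec (Fin q) n → Vec (Fin q) m → ℕ) →
      sumV n (λ v → sumV m (f v)) ≡ sumV m (λ w → sumV n (λ v → f v w))
    sumV-swap n zero f = refl
    sumV-swap n (suc m) f = trans (sumV-swap n m _)
      (sumV-cong m (λ w → sumV-sumFin n q (λ v x → f v (x ∷ w))))

    sumV-<-witness : ∀ n (f g : Vec (Fin q) n → ℕ) → sumV n f < sumV n g → Σ (Vec (Fin q) n) λ v → f v < g v
    sumV-<-witness zero f g lt = [] , lt
    sumV-<-witness (suc n) f g lt with sumV-<-witness n _ _ lt
    ... | w , lt′ with sum-<-witness q _ _ lt′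
    ...   | x , lt″ = x ∷ w , lt″

    term≤sumV : ∀ n (f : Vec (Fin q) n → ℕ) v → f v ≤ sumV n f
    term≤sumV zero f [] = ≤-refl
    term≤sumV (suc n) f (x ∷ w) = ≤-trans (term≤sum q (λ x → f (x ∷ w)) x) (term≤sumV n _ w)

    cntV-witness : ∀ {n} (P : Vec (Fin q) n → Bool) → 1 ≤ cntV P → Σ (Vec (Fin q) n) λ v → P v ≡ true
    cntV-witness {n} P h with sumV-<-witness n (λ _ → 0) _
      (subst (_< cntV P) (sym (trans (sumV-const n 0) (*-zeroʳ (q ^ n)))) h)
    ... | v , lt = v , ι-pos (P v) lt

    -- If every g were bad for some x, summing over x would give q^T q ≤ q^m C q^j. Keeping the
    -- factor q on the left of `bound` expresses the size C q^(j - 1) without a negative exponent at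
    -- j = 0.
    avoid-all : ∀ {T m C j} (Bad : Vec (Fin q) m → Vec (Fin q) T → Bool) →
      (∀ x → cntV (Bad x) * q ≤ C * q ^ j) → C * q ^ (m + j) < q ^ suc T →
      Σ (Vec (Fin q) T) λ g → ∀ x → Bad x g ≡ false
    avoid-all {T} {m} {C} {j} Bad bound small
      with search-Vec (search-Fin q) T
        (λ g → ¬? (search-Vec (search-Fin q) m (λ x → Bad x g ≟ true)))
    ... | yes (g , h) = g , λ x → ¬-true (λ e → h (x , e))
      where
      ¬-true : ∀ {b} → ¬ (b ≡ true) → b ≡ false
      ¬-true {false} _ = refl
      ¬-true {true} h = ⊥-elim (h refl)
    ... | no h = ⊥-elim (<⇒≱ small (begin
      q * q ^ T                                       ≡⟨ *-comm q (q ^ T) ⟩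
      q ^ T * q                                       ≡⟨ cong (_* q) (sym (trans (sumV-const T 1) (*-identityʳ (q ^ T)))) ⟩
      sumV T (λ _ → 1) * q                            ≤⟨ *-monoˡ-≤ q (sumV-mono T covered) ⟩
      sumV T (λ g → sumV m (λ x → ι (Bad x g))) * q   ≡⟨ cong (_* q) (sumV-swap T m _) ⟩
      sumV m (λ x → cntV (Bad x)) * q                 ≡⟨ *-comm _ q ⟩
      q * sumV m (λ x → cntV (Bad x))                 ≡⟨ sym (sumV-*ˡ m q _) ⟩
      sumV m (λ x → q * cntV (Bad x))
        ≤⟨ sumV-mono m (λ x → ≤-trans (≤-reflexive (*-comm q _)) (bound x)) ⟩
      sumV m (λ x → C * q ^ j)                        ≡⟨ sumV-const m _ ⟩
      q ^ m * (C * q ^ j)                             ≡⟨ sym (*-assoc (q ^ m) C _) ⟩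
      q ^ m * C * q ^ j                               ≡⟨ cong (_* q ^ j) (*-comm (q ^ m) C) ⟩
      C * q ^ m * q ^ j                               ≡⟨ *-assoc C (q ^ m) _ ⟩
      C * (q ^ m * q ^ j)                             ≡⟨ cong (C *_) (sym (^-distribˡ-+-* q m j)) ⟩
      C * q ^ (m + j)                                 ∎))
      where
      open ≤-Reasoning
      covered : ∀ g → 1 ≤ sumV m (λ x → ι (Bad x g))
      covered g with search-Vec (search-Fin q) m (λ x → Bad x g ≟ true)
      ... | yes (x , e) = ≤-trans (≤-reflexive (sym (ι-true e))) (term≤sumV m _ x)
      ... | no ¬b = ⊥-elim (h (g , ¬b))

  data Sel : ℕ → ℕ → Set where
    done : Sel 0 0
    skip : ∀ {n j} → Sel n j → Sel (suc n) j
    keep : ∀ {n j} → Sel n j → Sel (suc n) (suc j)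

  skip-all : ∀ n → Sel n 0
  skip-all zero = done
  skip-all (suc n) = skip (skip-all n)

  sel : ∀ {A : Set} {n j} → Sel n j → Vec A n → Vec A j
  sel done [] = []
  sel (skip J) (x ∷ v) = sel J v
  sel (keep J) (x ∷ v) = x ∷ sel J v

  shatterConst : ℕ → ℕ → ℕ → ℕ
  shatterConst D n zero = 1
  shatterConst D zero (suc j) = 1
  shatterConst D (suc n) (suc j) = D * shatterConst D n (suc j) + shatterConst D n j

  module Counting {q : ℕ} (𝔻 : FinDomain q) where
    open FinDomain 𝔻
    open DomainTheory 𝔻

    -- A Sauer–Shelah dichotomy: a set much larger than q ^ (j − 1) has j coordinates that are
    -- algebraically independent on it up to degree D.
    shatter : ∀ D n j (B : Vec F n → Bool) →
      cntV B * q ≤ shatterConst D n j * q ^ j ⊎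
      Σ (Sel n j) λ J → Indep D (λ w → Σ (Vec F n) λ g → B g ≡ true × sel J g ≡ w)
    shatter D n zero B with cntV B in eq
    ... | zero = inj₁ z≤n
    ... | suc _ with cntV-witness B (subst (1 ≤_) (sym eq) (s≤s z≤n))
    ...   | g , bg = inj₂ (skip-all n , Indep-nil (g , bg , nil _))
      where
      nil : ∀ (v : Vec F 0) → v ≡ []
      nil [] = refl
    shatter D zero (suc j) B = inj₁ (≤-trans (*-monoˡ-≤ q (ι≤1 (B [])))
      (*-monoʳ-≤ 1 (q≤ q)))
      where
      q≤ : ∀ q → q ≤ q * q ^ j
      q≤ zero = z≤n
      q≤ (suc q) = ≤-trans (≤-reflexive (sym (*-identityʳ (suc q)))) (*-monoʳ-≤ (suc q) (m^n>0 (suc q) j))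
    shatter D (suc n) (suc j) B = combine (shatter D n (suc j) proj) (shatter D n j rich)
      where
      c : Vec F n → ℕ
      c w = cnt (λ x → B (x ∷ w))
      one : ∀ n {P : Set} (d : Dec P) → P → n ≤ n * ι (does d)
      one n d p = ≤-reflexive (sym (trans (cong (n *_) (ι-true (dec-true d p))) (*-identityʳ n)))
      -- Coordinates independent on `proj` stay independent on `B`. Over `rich` the fibres have more
      -- than D points, so the first coordinate can be added to independent ones. If neither set
      -- supplies coordinates, both are small, and so is `B` by `total`.
      proj rich : Vec F n → Bool
      proj w = does (1 ≤? c w)
      rich w = does (suc D ≤? c w)
      c≤ : ∀ w → c w ≤ D * ι (proj w) + q * ι (rich w)
      c≤ w with suc D ≤? c w
      ... | yes p = ≤-trans (cnt≤n (λ x → B (x ∷ w))) (≤-trans (one q (suc D ≤? c w) p) (m≤n+m _ (D * ι (proj w))))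
      ... | no ¬p with 1 ≤? c w
      ...   | yes p′ = ≤-trans (≮⇒≥ ¬p) (≤-trans (one D (1 ≤? c w) p′) (m≤m+n _ _))
      ...   | no ¬p′ = ≤-trans (≮⇒≥ ¬p′) z≤n
      total : cntV B ≤ D * cntV proj + q * cntV rich
      total = ≤-trans (sumV-mono n c≤) (≤-reflexive (trans (sumV-+ n _ _) (cong₂ _+_ (sumV-*ˡ n D _) (sumV-*ˡ n q _))))
      combine : _ → _ → _
      combine (inj₂ (J , ind)) _ = inj₂ (skip J , Indep-mono lift ind)
        where
        lift : ∀ w → Σ (Vec F n) (λ g → proj g ≡ true × sel J g ≡ w) → Σ (Vec F (suc n)) λ g → B g ≡ true × sel (skip J) g ≡ w
        lift w (g , pg , e) with cnt-witness (λ x → B (x ∷ g)) (does-true (1 ≤? c g) pg)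
        ... | x , bx = x ∷ g , bx , e
      combine (inj₁ _) (inj₂ (J , ind)) = inj₂ (keep J , Indep-cons ind ext)
        where
        ext : ∀ w → Σ (Vec F n) (λ g → rich g ≡ true × sel J g ≡ w) → Σ (Fin (suc D) → F) λ x →
          (∀ {i j} → x i ≡ x j → i ≡ j) ×
          (∀ i → Σ (Vec F (suc n)) λ g → B g ≡ true × sel (keep J) g ≡ x i ∷ w)
        ext w (g , rg , e) with cnt-enum (λ x → B (x ∷ g)) (suc D) (does-true (suc D ≤? c g) rg)
        ... | x , inj , ok = x , inj , λ i → x i ∷ g , ok i , cong (x i ∷_) e
      combine (inj₁ b₁) (inj₁ b₂) = inj₁ (begin
        cntV B * q                                        ≤⟨ *-monoˡ-≤ q total ⟩
        (D * cntV proj + q * cntV rich) * q               ≡⟨ *-distribʳ-+ q (D * cntV proj) (q * cntV rich) ⟩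
        D * cntV proj * q + q * cntV rich * q             ≡⟨ cong₂ _+_ (*-assoc D _ q) (*-assoc q _ q) ⟩
        D * (cntV proj * q) + q * (cntV rich * q)         ≤⟨ +-mono-≤ (*-monoʳ-≤ D b₁) (*-monoʳ-≤ q b₂) ⟩
        D * (C₁ * q ^ suc j) + q * (C₂ * q ^ j)           ≡⟨ cong₂ _+_ (sym (*-assoc D C₁ _)) (swap q C₂ (q ^ j)) ⟩
        D * C₁ * q ^ suc j + C₂ * q ^ suc j               ≡⟨ sym (*-distribʳ-+ (q ^ suc j) (D * C₁) C₂) ⟩
        (D * C₁ + C₂) * q ^ suc j                         ∎)
        where
        open ≤-Reasoning
        C₁ = shatterConst D n (suc j)
        C₂ = shatterConst D n j
        swap : ∀ a b c → a * (b * c) ≡ b * (a * c)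
        swap a b c = trans (sym (*-assoc a b c)) (trans (cong (_* c) (*-comm a b)) (*-assoc b a c))

    diff : ∀ {n} → Vec F n → Vec F n → Vec F n
    diff = zipWith (λ a b → a ⊕ ⊖ b)

    eval-diff : ∀ {n} (a b : Vec F n) x → eval (diff a b) x ≡ eval a x ⊕ ⊖ eval b x
    eval-diff [] [] x = sym (R.-‿inverseʳ 0F)
    eval-diff (a ∷ as) (b ∷ bs) x rewrite eval-diff as bs x = begin
      (a ⊕ ⊖ b) ⊕ x ⊗ (eval as x ⊕ ⊖ eval bs x)                 ≡⟨ cong (a ⊕ ⊖ b ⊕_) (R.distribˡ x _ _) ⟩
      (a ⊕ ⊖ b) ⊕ (x ⊗ eval as x ⊕ x ⊗ ⊖ eval bs x)             ≡⟨ cong (λ z → a ⊕ ⊖ b ⊕ (x ⊗ eval as x ⊕ z)) (sym (RP.-‿distribʳ-* x _)) ⟩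
      (a ⊕ ⊖ b) ⊕ (x ⊗ eval as x ⊕ ⊖ (x ⊗ eval bs x))           ≡⟨ interchange a (⊖ b) _ _ ⟩
      (a ⊕ x ⊗ eval as x) ⊕ (⊖ b ⊕ ⊖ (x ⊗ eval bs x))           ≡⟨ cong (a ⊕ x ⊗ eval as x ⊕_) (RP.-‿+-comm b _) ⟩
      (a ⊕ x ⊗ eval as x) ⊕ ⊖ (b ⊕ x ⊗ eval bs x)               ∎
      where
      open ≡-Reasoning
      interchange : ∀ a b c d → (a ⊕ b) ⊕ (c ⊕ d) ≡ (a ⊕ c) ⊕ (b ⊕ d)
      interchange a b c d = trans (R.+-assoc a b _) (trans (cong (a ⊕_) (trans (sym (R.+-assoc b c d))
        (trans (cong (_⊕ d) (R.+-comm b c)) (R.+-assoc c b d)))) (sym (R.+-assoc a c _)))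

    diff-zeros : ∀ {n} (a b : Vec F n) → diff a b ≡ zeros → a ≡ b
    diff-zeros [] [] e = refl
    diff-zeros (a ∷ as) (b ∷ bs) e with ∷-injective e
    ... | e₁ , e₂ = cong₂ _∷_ (x⊖y≡0 a b e₁) (diff-zeros as bs e₂)

    -- Two distinct vectors, read as polynomials with M coefficients, agree at no more than M of the
    -- points; so the K·K pairs spoil at most K·K·M of the N points.
    separate : ∀ {K M N} (v : Fin K → Vec F M) → (∀ i j → v i ≡ v j → i ≡ j) →
      (x : Fin N → F) → (∀ {i j} → x i ≡ x j → i ≡ j) → K * (K * M) < N →
      Σ (Fin N) λ μ → ∀ i j → eval (v i) (x μ) ≡ eval (v j) (x μ) → i ≡ j
    separate {K} {M} {N} v v-inj x x-inj lt
      with Fin.any? (λ μ → Fin.all? (λ i → Fin.all? (λ j → (eval (v i) (x μ) Fin.≟ eval (v j) (x μ)) →-dec (i Fin.≟ j))))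
    ... | yes r = r
    ... | no none = ⊥-elim (<⇒≱ lt (begin
      N                                                                  ≡⟨ sym (trans (sum-const N 1) (*-identityʳ N)) ⟩
      sumFin N (λ _ → 1)                                                 ≤⟨ sum-mono N covered ⟩
      sumFin N (λ μ → sumFin K (λ i → sumFin K (λ j → ι (bad i j μ))))   ≡⟨ sum-swap N K _ ⟩
      sumFin K (λ i → sumFin N (λ μ → sumFin K (λ j → ι (bad i j μ))))   ≡⟨ sum-cong K (λ i → sum-swap N K _) ⟩
      sumFin K (λ i → sumFin K (λ j → cnt (bad i j)))                    ≤⟨ sum-≤-const K (λ i → sum-≤-const K (λ j → few i j)) ⟩
      K * (K * M)                                                        ∎))
      where
      open ≤-Reasoning
      Bad? : ∀ i j μ → Dec (eval (v i) (x μ) ≡ eval (v j) (x μ) × ¬ (i ≡ j))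
      Bad? i j μ = (eval (v i) (x μ) Fin.≟ eval (v j) (x μ)) ×-dec ¬? (i Fin.≟ j)
      bad : Fin K → Fin K → Fin N → Bool
      bad i j μ = does (Bad? i j μ)
      covered : ∀ μ → 1 ≤ sumFin K (λ i → sumFin K (λ j → ι (bad i j μ)))
      covered μ with Fin.any? (λ i → Fin.any? (λ j → Bad? i j μ))
      ... | yes (i , j , b) = ≤-trans (≤-reflexive (sym (ι-true (dec-true (Bad? i j μ) b))))
        (≤-trans (term≤sum K (λ j → ι (bad i j μ)) j) (term≤sum K _ i))
      ... | no ¬b = ⊥-elim (none (μ , λ i j e → decidable-stable (i Fin.≟ j) (λ i≢j → ¬b (i , j , e , i≢j))))
      few : ∀ i j → cnt (bad i j) ≤ M
      few i j = go (i Fin.≟ j) (M ≤? cnt (bad i j))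
        where
        go : Dec (i ≡ j) → Dec (M ≤ cnt (bad i j)) → cnt (bad i j) ≤ M
        go (yes e) _ = ≤-trans (≤-reflexive (trans (cnt-cong (λ μ → dec-false (Bad? i j μ) (λ b → proj₂ b e))) (sum-0 N))) z≤n
        go (no i≢j) (no h) = <⇒≤ (≰⇒> h)
        go (no i≢j) (yes h) with cnt-enum (bad i j) M h
        ... | y , y-inj , ok = ⊥-elim (i≢j (v-inj i j (diff-zeros (v i) (v j)
          (roots⇒zeros M (diff (v i) (v j)) (x ∘ y) (λ e → y-inj (x-inj e)) root))))
          where
          root : ∀ k → eval (diff (v i) (v j)) (x (y k)) ≡ 0F
          root k = trans (eval-diff (v i) (v j) (x (y k)))
            (trans (cong (_⊕ ⊖ eval (v j) (x (y k))) (proj₁ (does-true (Bad? i j (y k)) (ok k)))) (R.-‿inverseʳ _))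

-- Hashed random polynomials and the dimension count that bounds bad coefficient vectors.

module RandomCoefficients where

  open Polynomials
  open Shattering
  open import Data.Nat hiding (_≟_)
  open import Data.Nat.Properties hiding (suc-injective; _≟_)
  open import Data.Fin using (Fin; zero; suc; combine; remQuot; splitAt)
  open import Data.Fin.Properties using (suc-injective; remQuot-combine; combine-remQuot; _≟_)
  open import Data.Bool using (Bool; true; false; if_then_else_)
  open import Data.Vec using (Vec; []; _∷_; _++_; lookup; tail; tabulate)
  open import Data.Vec.Properties using (lookup∘tabulate; lookup-splitAt; tabulate-cong; tabulate∘lookup)
  open import Data.Product using (Σ; _×_; _,_; proj₁; proj₂)
  open import Data.Sum using (_⊎_; inj₁; inj₂; [_,_]′)
  open import Data.Empty using (⊥-elim)
  open import Function using (_∘_)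
  open import Relation.Nullary
  open import Relation.Nullary.Decidable using (dec-true; dec-false)
  open import Relation.Binary.PropositionalEquality

  selIx : ∀ {n j} → Sel n j → Fin j → Fin n
  selIx (skip J) i = suc (selIx J i)
  selIx (keep J) zero = zero
  selIx (keep J) (suc i) = suc (selIx J i)

  lookup-sel : ∀ {A : Set} {n j} (J : Sel n j) (v : Vec A n) i → lookup (sel J v) i ≡ lookup v (selIx J i)
  lookup-sel (skip J) (x ∷ v) i = lookup-sel J v i
  lookup-sel (keep J) (x ∷ v) zero = refl
  lookup-sel (keep J) (x ∷ v) (suc i) = lookup-sel J v i

  module BigOps {q : ℕ} (𝔻 : FinDomain q) where
    open FinDomain 𝔻
    open DomainTheory 𝔻

    sumF prodF : ∀ n → (Fin n → F) → F
    sumF zero f = 0F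
    sumF (suc n) f = f zero ⊕ sumF n (f ∘ suc)
    prodF zero f = 1F
    prodF (suc n) f = f zero ⊗ prodF n (f ∘ suc)

    sumExcept prodExcept : ∀ n → (Fin n → F) → Fin n → F
    sumExcept (suc n) f zero = sumF n (f ∘ suc)
    sumExcept (suc n) f (suc i) = f zero ⊕ sumExcept n (f ∘ suc) i
    prodExcept (suc n) f zero = prodF n (f ∘ suc)
    prodExcept (suc n) f (suc i) = f zero ⊗ prodExcept n (f ∘ suc) i

    sum-except : ∀ n f i → sumF n f ≡ f i ⊕ sumExcept n f i
    sum-except (suc n) f zero = refl
    sum-except (suc n) f (suc i) = trans (cong (f zero ⊕_) (sum-except n (f ∘ suc) i))
      (trans (sym (R.+-assoc _ _ _)) (trans (cong (_⊕ sumExcept n (f ∘ suc) i) (R.+-comm _ _)) (R.+-assoc _ _ _)))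

    prod-except : ∀ n f i → prodF n f ≡ f i ⊗ prodExcept n f i
    prod-except (suc n) f zero = refl
    prod-except (suc n) f (suc i) = trans (cong (f zero ⊗_) (prod-except n (f ∘ suc) i))
      (trans (sym (R.*-assoc _ _ _)) (trans (cong (_⊗ prodExcept n (f ∘ suc) i) (R.*-comm _ _)) (R.*-assoc _ _ _)))

    prod-nonzero : ∀ n f → (∀ i → ¬ (f i ≡ 0F)) → ¬ (prodF n f ≡ 0F)
    prod-nonzero zero f h e = 1≢0 e
    prod-nonzero (suc n) f h e with no-zero-div (f zero) _ e
    ... | inj₁ z = h zero z
    ... | inj₂ z = prod-nonzero n (f ∘ suc) (h ∘ suc) z

    Pol-prod : ∀ {T d} n {f : Fin n → Vec F T → F} → (∀ i → Pol T d (f i)) → Pol T (n * d) (λ v → prodF n (λ i → f i v))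
    Pol-prod zero h = Pol-const 1F
    Pol-prod (suc n) h = Pol-* (h zero) (Pol-prod n (h ∘ suc))

    Pol-prodExcept : ∀ {T d} n {f : Fin n → Vec F T → F} → (∀ i → Pol T d (f i)) → ∀ i →
      Pol T (n * d) (λ v → prodExcept n (λ i → f i v) i)
    Pol-prodExcept {d = d} (suc n) h zero = Pol-mono (m≤n+m _ d) (Pol-prod n (h ∘ suc))
    Pol-prodExcept (suc n) h (suc i) = Pol-* (h zero) (Pol-prodExcept n (h ∘ suc) i)

    -- The ends of the paths are fixed and every other vertex coordinate is an entry of y, so these
    -- functions become polynomials of degree at most 1 in the generators.
    Coord : ∀ {P} → (Vec F P → F) → Set
    Coord {P} f = Σ F (λ k → ∀ y → f y ≡ k) ⊎ Σ (Fin P) (λ i → ∀ y → f y ≡ lookup y i)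

    Pol-eval-const : ∀ {T M d} (e : Vec F T → Vec F M) → (∀ c → Pol T d (λ v → lookup (e v) c)) → ∀ x →
      Pol T d (λ v → eval (e v) x)
    Pol-eval-const {M = zero} e h x = Pol-cong (λ v → nil (e v)) (Pol-const 0F)
      where
      nil : ∀ (u : Vec F 0) → 0F ≡ eval u x
      nil [] = refl
    Pol-eval-const {M = suc M} e h x = Pol-cong (λ v → cons (e v))
      (Pol-+ (h zero) (Pol-* {E = 0} (Pol-const x) (Pol-eval-const (tail ∘ e) (λ c → Pol-cong (λ v → tl (e v) c) (h (suc c))) x)))
      where
      cons : ∀ (u : Vec F (suc M)) → lookup u zero ⊕ x ⊗ eval (tail u) x ≡ eval u x
      cons (_ ∷ _) = refl
      tl : ∀ (u : Vec F (suc M)) c → lookup u (suc c) ≡ lookup (tail u) c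
      tl (_ ∷ _) c = refl

    module _ {S : Set} {T c : ℕ} (gens : S → Vec F T) (δ : Vec F T → F) (δ-pol : Pol T c δ) where
      open Rational gens δ δ-pol

      Rat-sum : ∀ {E} n {f : Fin n → S → F} → (∀ i → Rat E (f i)) → Rat E (λ s → sumF n (λ i → f i s))
      Rat-sum zero h = Rat-const 0F
      Rat-sum (suc n) h = Rat-+ (h zero) (Rat-sum n (h ∘ suc))

      Rat-sumExcept : ∀ {E} n {f : Fin n → S → F} i → (∀ j → ¬ (j ≡ i) → Rat E (f j)) →
        Rat E (λ s → sumExcept n (λ i → f i s) i)
      Rat-sumExcept (suc n) zero h = Rat-sum n (λ j → h (suc j) (λ ()))
      Rat-sumExcept (suc n) (suc i) h = Rat-+ (h zero (λ ()))
        (Rat-sumExcept n i (λ j ne → h (suc j) (λ e → ne (suc-injective e))))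

    -- The choice made at one position leaves the values at the others unchanged, so `Indep-cons`
    -- can add the positions one at a time, with `suc D` values available for each.
    grid-independent : ∀ {A : Set} {n D} (base : A → Vec F n) h (val : A → Fin h → Fin (suc D) → F) →
      (∀ a m {i j} → val a m i ≡ val a m j → i ≡ j) →
      Indep D (λ w → Σ A λ a → base a ≡ w) →
      Indep D (λ w → Σ A λ a → Σ (Fin h → Fin (suc D)) λ l → tabulate (λ m → val a m (l m)) ++ base a ≡ w)
    grid-independent base zero val inj ind = Indep-mono (λ { w (a , e) → a , (λ ()) , e }) ind
    grid-independent {D = D} base (suc h) val inj ind =
      Indep-cons (grid-independent base h (λ a → val a ∘ suc) (λ a m → inj a (suc m)) ind) ext
      where
      ext : ∀ w → _ → _
      ext w (a , l , e) = val a zero , inj a zero , λ i → a , extend i , cong (val a zero i ∷_) e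
        where
        extend : Fin (suc D) → Fin (suc h) → Fin (suc D)
        extend i zero = i
        extend i (suc m) = l m

  module RandomPolynomials {q : ℕ} (𝔻 : FinDomain q) (s H K : ℕ) (x : Fin H → Fin q) where
    open FinDomain 𝔻
    open DomainTheory 𝔻
    open BigOps 𝔻
    open Counting 𝔻 using (shatter; separate)

    T : ℕ
    T = s * (H * K)

    index : Fin s → Fin H → Fin K → Fin T
    index i μ τ = combine i (combine μ τ)

    block : Vec F T → Fin s → Fin H → Vec F K
    block g i μ = tabulate (λ τ → lookup g (index i μ τ))

    -- The i-th of the s polynomials with coefficients g: a sum over the hash points x μ of
    -- univariate polynomials of degree < K in the hash of e at x μ.
    value : ∀ {M} → Vec F T → Fin s → Vec F M → F
    value g i e = sumF H (λ μ → eval (block g i μ) (eval e (x μ)))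

    choose : ∀ {A : Set} → Fin H → Fin H → A → A → A
    choose μ ν a b = if does (ν ≟ μ) then a else b

    genAt : Fin H → Vec F T → Vec F (s * K) → Fin s → Fin H → Fin K → F
    genAt μ g y i ν τ = choose μ ν (lookup y (combine i τ)) (lookup g (index i ν τ))

    -- The points have s * K coordinates, exactly as many as there are coefficients in the block at μ
    -- that they determine; gens trades the one for the other.
    gens : Fin H → Vec F T → Vec F (s * K) → Vec F T
    gens μ g y = tabulate λ ix → let (i , r) = remQuot {s} (H * K) ix ; (ν , τ) = remQuot {H} K r in genAt μ g y i ν τ

    lookup-gens : ∀ μ g y i ν τ → lookup (gens μ g y) (index i ν τ) ≡ genAt μ g y i ν τ
    lookup-gens μ g y i ν τ = trans (lookup∘tabulate _ (index i ν τ)) (trans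
      (cong (λ p → genAt μ g y (proj₁ p) (proj₁ (remQuot {H} K (proj₂ p))) (proj₂ (remQuot {H} K (proj₂ p))))
        (remQuot-combine {n = s} {k = H * K} i (combine ν τ)))
      (cong (λ p → genAt μ g y i (proj₁ p) (proj₂ p)) (remQuot-combine {n = H} {k = K} ν τ)))

    choose-same : ∀ {A : Set} μ {a b : A} → choose μ μ a b ≡ a
    choose-same μ {a} {b} = cong (if_then a else b) (dec-true (μ ≟ μ) refl)

    choose-other : ∀ {A : Set} {μ ν} {a b : A} → ¬ (ν ≡ μ) → choose μ ν a b ≡ b
    choose-other {μ = μ} {ν} {a} {b} ne = cong (if_then a else b) (dec-false (ν ≟ μ) ne)

    point : Fin H → Vec F T → Vec F (s * K)
    point μ v = tabulate λ ι → let (i , τ) = remQuot {s} K ι in lookup v (index i μ τ)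

    point-gens : ∀ μ g y → point μ (gens μ g y) ≡ y
    point-gens μ g y = trans (tabulate-cong eq) (tabulate∘lookup y)
      where
      eq : ∀ ι → (let (i , τ) = remQuot {s} K ι in lookup (gens μ g y) (index i μ τ)) ≡ lookup y ι
      eq ι = let (i , τ) = remQuot {s} K ι in
        trans (lookup-gens μ g y i μ τ) (trans (choose-same μ) (cong (lookup y) (combine-remQuot {s} K ι)))

    module Nodes {M : ℕ} (e : Fin K → Vec F (s * K) → Vec F M)
      (e-coord : ∀ j c → Coord (λ y → lookup (e j y) c)) (b : Fin s → F) where

      record Config : Set where
        field
          g : Vec F T
          y : Vec F (s * K)
          distinct : ∀ i j → e i y ≡ e j y → i ≡ j
          incident : ∀ i j → value g i (e j y) ≡ b i
      open Config public

      coord-pol : ∀ μ {f : Vec F (s * K) → F} → Coord f → Pol T 1 (f ∘ point μ)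
      coord-pol μ (inj₁ (k , eq)) = Pol-cong (λ v → sym (eq _)) (Pol-const k)
      coord-pol μ (inj₂ (ι , eq)) = Pol-cong (λ v → sym (trans (eq _) (lookup∘tabulate _ ι))) (Pol-lookup _)

      hash : Fin H → Fin K → Vec F (s * K) → F
      hash μ j y = eval (e j y) (x μ)

      hash-pol : ∀ μ ν j → Pol T 1 (hash ν j ∘ point μ)
      hash-pol μ ν j = Pol-eval-const (e j ∘ point μ) (λ c → coord-pol μ (e-coord j c)) (x ν)

      -- With the diagonal factors set to 1, the product over all ordered pairs is, up to sign, the
      -- discriminant of the nodes; it is nonzero when the hash at μ separates the edges.
      factor : Fin H → Fin K → Fin K → Vec F T → F
      factor μ i j v = if does (i ≟ j) then 1F else (hash μ i (point μ v) ⊕ ⊖ hash μ j (point μ v))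

      factor-diag : ∀ μ {i j} v → i ≡ j → factor μ i j v ≡ 1F
      factor-diag μ {i} {j} v p = cong (if_then 1F else (hash μ i (point μ v) ⊕ ⊖ hash μ j (point μ v))) (dec-true (i ≟ j) p)

      factor-off : ∀ μ {i j} z → ¬ (i ≡ j) → factor μ i j (gens μ (g z) (y z)) ≡ hash μ i (y z) ⊕ ⊖ hash μ j (y z)
      factor-off μ {i} {j} z ne = trans
        (cong (if_then 1F else (hash μ i (point μ v) ⊕ ⊖ hash μ j (point μ v))) (dec-false (i ≟ j) ne))
        (cong (λ u → hash μ i u ⊕ ⊖ hash μ j u) (point-gens μ (g z) (y z)))
        where v = gens μ (g z) (y z)

      factor-pol : ∀ μ i j → Pol T 1 (factor μ i j)
      factor-pol μ i j with does (i ≟ j)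
      ... | true = Pol-const 1F
      ... | false = Pol-+ (hash-pol μ μ i) (Pol-cong (λ v → trans (sym (RP.-‿distribˡ-* 1F _)) (cong ⊖_ (R.*-identityˡ _)))
        (Pol-* {E = 0} (Pol-const (⊖ 1F)) (hash-pol μ μ j)))

      δ : Fin H → Vec F T → F
      δ μ v = prodF K (λ i → prodF K (λ j → factor μ i j v))

      -- δ has degree at most K·K. The extra K makes room for `cofactor`, whose two products are
      -- bounded separately by K (the rest of a row) and K·K (the other rows).
      c : ℕ
      c = K * 1 + K * (K * 1)

      δ-pol : ∀ μ → Pol T c (δ μ)
      δ-pol μ = Pol-mono (m≤n+m _ (K * 1)) (Pol-prod K (λ i → Pol-prod K (factor-pol μ i)))

      cofactor : Fin H → Fin K → Fin K → Vec F T → F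
      cofactor μ i j v = prodExcept K (λ j → factor μ i j v) j ⊗ prodExcept K (λ i → prodF K (λ j → factor μ i j v)) i

      record Good (μ : Fin H) (z : Config) : Set where
        constructor good
        field separated : ∀ i j → hash μ i (y z) ≡ hash μ j (y z) → i ≡ j
      open Good

      -- `E₀` is what `Rat-eval` yields for K coefficients and an argument of exponent 1 each; `E₁`
      -- is what interpolation at K nodes makes of it.
      E₀ E₁ : ℕ
      E₀ = K * 1 + 1
      E₁ = solveDeg K E₀

      module Stratum (μ : Fin H) where
        Z = Σ Config (Good μ)

        gen : Z → Vec F T
        gen (z , _) = gens μ (g z) (y z)

        open Rational gen (δ μ) (δ-pol μ)

        rat-point : ∀ {d} {f : Vec F (s * K) → F} → Pol T d (f ∘ point μ) → Rat d (λ z → f (y (proj₁ z)))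
        rat-point {f = f} p = Rat-cong (λ z → cong f (point-gens μ (g (proj₁ z)) (y (proj₁ z)))) (Rat-pol p)

        rat-other : ∀ i ν τ → ¬ (ν ≡ μ) → Rat 1 (λ z → lookup (g (proj₁ z)) (index i ν τ))
        rat-other i ν τ ne = Rat-cong (λ z → trans (lookup-gens μ (g (proj₁ z)) (y (proj₁ z)) i ν τ) (choose-other ne))
          (Rat-pol (Pol-lookup (index i ν τ)))

        rat-term : ∀ i ν j → ¬ (ν ≡ μ) → Rat E₀ (λ z → eval (block (g (proj₁ z)) i ν) (hash ν j (y (proj₁ z))))
        rat-term i ν j ne = Rat-eval K (λ z → block (g (proj₁ z)) i ν) _
          (λ τ → Rat-cong (λ z → sym (lookup∘tabulate _ τ)) (rat-other i ν τ ne)) (rat-point (hash-pol μ ν j))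

        -- Incidence expresses the summand at μ as b minus the summands at the other hash points,
        -- whose coefficients are still among the generators.
        rat-value : ∀ i j → Rat E₀ (λ z → eval (block (g (proj₁ z)) i μ) (hash μ j (y (proj₁ z))))
        rat-value i j = Rat-cong rearranged (Rat-+ (Rat-const (b i)) (Rat-neg
            (Rat-sumExcept gen (δ μ) (δ-pol μ) H {f = λ ν z → eval (block (g (proj₁ z)) i ν) (hash ν j (y (proj₁ z)))} μ
              (λ ν ne → rat-term i ν j ne))))
          where
          rearranged : ∀ z → b i ⊕ ⊖ sumExcept H (λ ν → eval (block (g (proj₁ z)) i ν) (hash ν j (y (proj₁ z)))) μ
            ≡ eval (block (g (proj₁ z)) i μ) (hash μ j (y (proj₁ z)))
          rearranged (z , _) = trans (cong (_⊕ ⊖ rest) (trans (sym (incident z i j)) (sum-except H term μ)))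
            (trans (R.+-assoc _ _ _) (trans (cong (term μ ⊕_) (R.-‿inverseʳ rest)) (R.+-identityʳ _)))
            where
            term : Fin H → F
            term ν = eval (block (g z) i ν) (hash ν j (y z))
            rest = sumExcept H term μ

        division : ∀ i j → ¬ (i ≡ j) → ∀ {E φ} →
          Rat E (λ z → (hash μ i (y (proj₁ z)) ⊕ ⊖ hash μ j (y (proj₁ z))) ⊗ φ z) → Rat (suc E) φ
        division i j ne = Rat-div (λ z → hash μ i (y (proj₁ z)) ⊕ ⊖ hash μ j (y (proj₁ z))) {cofactor μ i j}
          (Pol-* (Pol-prodExcept K (factor-pol μ i) j) (Pol-prodExcept K (λ i → Pol-prod K (factor-pol μ i)) i)) eq
          where
          eq : ∀ z → (hash μ i (y (proj₁ z)) ⊕ ⊖ hash μ j (y (proj₁ z))) ⊗ cofactor μ i j (gen z) ≡ δ μ (gen z)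
          eq z = sym (begin
            δ μ (gen z)                       ≡⟨ prod-except K (λ i → prodF K (λ j → factor μ i j (gen z))) i ⟩
            prodF K (λ j → factor μ i j (gen z)) ⊗ others
              ≡⟨ cong (_⊗ others) (prod-except K (λ j → factor μ i j (gen z)) j) ⟩
            factor μ i j (gen z) ⊗ row ⊗ others     ≡⟨ R.*-assoc _ _ _ ⟩
            factor μ i j (gen z) ⊗ (row ⊗ others)   ≡⟨ cong (_⊗ (row ⊗ others)) (factor-off μ (proj₁ z) ne) ⟩
            _ ∎)
            where
            open ≡-Reasoning
            others = prodExcept K (λ i → prodF K (λ j → factor μ i j (gen z))) i
            row = prodExcept K (λ j → factor μ i j (gen z)) j

        rat-same : ∀ i τ → Rat E₁ (λ z → lookup (g (proj₁ z)) (index i μ τ))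
        rat-same i τ = Rat-cong (λ z → lookup∘tabulate _ τ)
          (interpolate K (λ z → block (g (proj₁ z)) i μ) (λ j z → hash μ j (y (proj₁ z)))
            (λ j → Rat-mono (m≤n+m 1 (K * 1)) (rat-point (hash-pol μ μ j))) (rat-value i) division τ)

        rat-coeff : ∀ ix → Rat E₁ (λ z → lookup (g (proj₁ z)) ix)
        rat-coeff ix with remQuot {s} (H * K) ix in eq₁
        ... | i , r with remQuot {H} K r in eq₂
        ...   | ν , τ = Rat-cong (λ z → cong (lookup (g (proj₁ z))) ix≡) (go (ν ≟ μ))
          where
          ix≡ : index i ν τ ≡ ix
          ix≡ = trans (cong (combine i) (trans (cong (λ p → combine (proj₁ p) (proj₂ p)) (sym eq₂)) (combine-remQuot {H} K r)))
            (trans (cong (λ p → combine (proj₁ p) (proj₂ p)) (sym eq₁)) (combine-remQuot {s} (H * K) ix))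
          go : Dec (ν ≡ μ) → Rat E₁ (λ z → lookup (g (proj₁ z)) (index i ν τ))
          go (yes refl) = rat-same i τ
          go (no ne) = Rat-mono 1≤E₁ (rat-other i ν τ ne)
            where
            1≤E₁ : 1 ≤ E₁
            1≤E₁ = solveDeg≥ K (m≤n+m 1 (K * 1))

      nonzero : ∀ μ z → Good μ z → ¬ (δ μ (gens μ (g z) (y z)) ≡ 0F)
      nonzero μ z gd = prod-nonzero K _ λ i → prod-nonzero K _ λ j → go i j (i ≟ j)
        where
        go : ∀ i j → Dec (i ≡ j) → ¬ (factor μ i j (gens μ (g z) (y z)) ≡ 0F)
        go i j (yes p) e = 1≢0 (trans (sym (factor-diag μ (gens μ (g z) (y z)) p)) e)
        go i j (no ne) e = ne (separated gd i j (x⊖y≡0 _ _ (trans (sym (factor-off μ z ne)) e)))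

      module Bound (h j D : ℕ) (h+j : h + j ≡ suc T) (x-inj : ∀ {μ ν} → x μ ≡ x ν → μ ≡ ν) (H-large : K * (K * M) < H)
        (D-large : H * pN T (suc T * (suc D * E₁) * suc c) < pN (suc T) D)
        {B : ℕ} (w : Fin h → Vec F (s * K) → Vec F B) (w-coord : ∀ m i → Coord (λ y → lookup (w m y) i)) (u : F) where

        stratum : ∀ z → Σ (Fin H) λ μ → Good μ z × ¬ (δ μ (gens μ (g z) (y z)) ≡ 0F)
        stratum z with separate (λ j → e j (y z)) (distinct z) x x-inj H-large
        ... | μ , sep = μ , good sep , nonzero μ z (good sep)

        φ : Sel T j → Config → Vec F (h + j)
        φ J z = tabulate (λ m → eval (w m (y z)) u) ++ sel J (g z)

        rat-φ : ∀ J μ i → Rational.Rat {S = Σ Config (Good μ)} (λ z → gens μ (g (proj₁ z)) (y (proj₁ z))) (δ μ) (δ-pol μ) E₁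
          (λ z → lookup (φ J (proj₁ z)) i)
        rat-φ J μ i with splitAt h i in eq
        ... | inj₁ m = Rat-cong (λ z → sym (trans (lookup-splitAt h (tabulate (λ m → eval (w m (y (proj₁ z))) u)) (sel J (g (proj₁ z))) i)
              (trans (cong [ _ , _ ]′ eq) (lookup∘tabulate (λ m → eval (w m (y (proj₁ z))) u) m))))
            (Rat-mono (solveDeg≥ K (m≤n+m 1 (K * 1)))
              (Stratum.rat-point μ (Pol-eval-const (w m ∘ point μ) (λ i → coord-pol μ (w-coord m i)) u)))
          where open Rational (λ z → gens μ (g (proj₁ z)) (y (proj₁ z))) (δ μ) (δ-pol μ)
        ... | inj₂ k = Rat-cong (λ z → sym (trans (lookup-splitAt h (tabulate (λ m → eval (w m (y (proj₁ z))) u)) (sel J (g (proj₁ z))) i)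
              (trans (cong [ _ , _ ]′ eq) (lookup-sel J (g (proj₁ z)) k))))
            (Stratum.rat-coeff μ (selIx J k))
          where open Rational (λ z → gens μ (g (proj₁ z)) (y (proj₁ z))) (δ μ) (δ-pol μ)

        -- T + 1 functions on a T-dimensional family are dependent, so the bad coefficient
        -- vectors cannot have T + 1 − h independent coordinates next to the h free ones of the grid.
        bad-bound : (Bad : Vec F T → Bool) →
          (∀ g → Bad g ≡ true → Σ (Fin h → Fin (suc D) → F) λ val → (∀ m {i j} → val m i ≡ val m j → i ≡ j) ×
            (∀ (l : Fin h → Fin (suc D)) → Σ (Vec F (s * K)) λ y →
              (∀ i j → e i y ≡ e j y → i ≡ j) × (∀ i j → value g i (e j y) ≡ b i) ×
              (∀ m → eval (w m y) u ≡ val m (l m)))) →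
          cntV Bad * q ≤ shatterConst D T j * q ^ j
        bad-bound Bad witness with shatter D T j Bad
        ... | inj₁ bound = bound
        ... | inj₂ (J , ind) = ⊥-elim (nz (grid-independent base h val inj
                (Indep-mono (λ { w (g , bg , eq) → (g , bg) , eq }) ind) p on-grid))
          where
          A = Σ (Vec F T) λ g → Bad g ≡ true
          base : A → Vec F j
          base (g , _) = sel J g
          val : A → Fin h → Fin (suc D) → F
          val (g , bg) = proj₁ (witness g bg)
          inj : ∀ a m {i j} → val a m i ≡ val a m j → i ≡ j
          inj (g , bg) = proj₁ (proj₂ (witness g bg))
          n = h + j
          dep = dependent {E = E₁} D (φ J) Good (λ μ z → gens μ (g z) (y z)) δ δ-pol stratum (rat-φ J)
            (subst (λ n → H * pN T (n * (suc D * E₁) * suc c) < pN n D) (sym h+j) D-large)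
          p = proj₁ dep
          nz = proj₁ (proj₂ dep)
          on-grid : ∀ v → Σ A (λ a → Σ (Fin h → Fin (suc D)) λ l → tabulate (λ m → val a m (l m)) ++ base a ≡ v) →
            dot p (mons v D) ≡ 0F
          on-grid v ((g , bg) , l , eq) with proj₂ (proj₂ (witness g bg)) l
          ... | y , dist , inc , vals = subst (λ v → dot p (mons v D) ≡ 0F)
            (trans (cong (_++ sel J g) (tabulate-cong vals)) eq)
            (proj₂ (proj₂ dep) record { g = g ; y = y ; distinct = dist ; incident = inc })

-- Families of paths of length 2t + 1 as configurations of coefficients and points.

module PathFamilies where

  open Polynomials
  open Shattering
  open RandomCoefficients
  open import Data.Nat hiding (_≟_)
  open import Data.Nat.Properties hiding (suc-injective; _≟_)
  open import Data.Fin using (Fin; zero; suc; combine; remQuot; splitAt; cast; _↑ˡ_; _↑ʳ_; inject≤)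
  open import Data.Fin.Properties using (remQuot-combine; combine-remQuot; _≟_; all?; cast-involutive; inject≤-injective; combine-injective)
  open import Data.Bool using (Bool; true; false)
  open import Data.Vec using (Vec; []; _∷_; _++_; lookup; tabulate)
  open import Data.Vec.Properties using (lookup∘tabulate; lookup-splitAt; lookup-++ˡ; lookup-++ʳ; tabulate-cong; tabulate∘lookup; ≡-dec)
  open import Data.Product using (Σ; _×_; _,_; proj₁; proj₂)
  open import Data.Sum using (inj₁; inj₂; [_,_]′)
  open import Function using (_∘_)
  open import Relation.Nullary
  open import Relation.Nullary.Decidable using (map′; _×-dec_; _→-dec_)
  open import Relation.Binary.PropositionalEquality

  snoc : ∀ {X : Set} {t} → (Fin t → X) → X → Fin (suc t) → X
  snoc {t = zero} f x zero = x
  snoc {t = suc t} f x zero = f zero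
  snoc {t = suc t} f x (suc a) = snoc (f ∘ suc) x a

  snoc-cong : ∀ {X : Set} {t} {f f′ : Fin t → X} {x} → (∀ a → f a ≡ f′ a) → ∀ a → snoc f x a ≡ snoc f′ x a
  snoc-cong {t = zero} e zero = refl
  snoc-cong {t = suc t} e zero = e zero
  snoc-cong {t = suc t} e (suc a) = snoc-cong (e ∘ suc) a

  firstPart : ∀ {X : Set} a {b} → Vec X (a + b) → Vec X a
  firstPart a {b} v = tabulate (λ c → lookup v (c ↑ˡ b))

  lastPart : ∀ {X : Set} a {b} → Vec X (a + b) → Vec X b
  lastPart a v = tabulate (λ c → lookup v (a ↑ʳ c))

  firstPart-++ : ∀ {X : Set} {a b} (v : Vec X a) (w : Vec X b) → firstPart a (v ++ w) ≡ v
  firstPart-++ v w = trans (tabulate-cong (lookup-++ˡ v w)) (tabulate∘lookup v)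

  lastPart-++ : ∀ {X : Set} {a b} (v : Vec X a) (w : Vec X b) → lastPart a (v ++ w) ≡ w
  lastPart-++ v w = trans (tabulate-cong (lookup-++ʳ v w)) (tabulate∘lookup w)

  small-union : ∀ {q} C m j T → suc m + j ≡ suc T → C < q → C * q ^ (m + j) < q ^ suc T
  small-union {q} C m j T eq C<q = subst (λ n → C * q ^ (m + j) < q ^ n) eq
    (*-monoˡ-< (q ^ (m + j)) {{>-nonZero (m^n>0 q {{>-nonZero (≤-<-trans z≤n C<q)}} (m + j))}} C<q)

  module Paths {q : ℕ} (𝔻 : FinDomain q) (t A B s D : ℕ) where
    open FinDomain 𝔻
    open DomainTheory 𝔻 hiding (R; module R; module RP)
    open BigOps 𝔻
    open Counting 𝔻

    -- m parameters (u, w, b, z) enter the union bound, and each of the h = m + 1 free paths of a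
    -- configuration costs the bad set a factor q.
    M m h ke K H N₀ : ℕ
    M = A + B
    m = A + (B + (s + 1))
    h = suc m
    ke = t + suc t
    K = ke * h
    H = suc (K * (K * M))
    N₀ = h * suc D

    Path : Set
    Path = Fin t → Vec F M

    leftV : Vec F A → Path → Fin (suc t) → Vec F A
    leftV u P zero = u
    leftV u P (suc a) = firstPart A (P a)

    rightV : Vec F B → Path → Fin (suc t) → Vec F B
    rightV w P = snoc (λ a → lastPart A (P a)) w

    -- The path u = u₀, w₁, u₁, w₂, …, u_t, w_{t+1} = w with blocks P a = (u_{a+1}, w_{a+1}) has
    -- the t edges P a and the t + 1 edges (u_a, w_{a+1}).
    edge : Vec F A → Vec F B → Path → Fin ke → Vec F M
    edge u w P ε = [ P , (λ a → leftV u P a ++ rightV w P a) ]′ (splitAt t ε)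

    CoordV : ∀ {n k} → (Vec F n → Vec F k) → Set
    CoordV f = ∀ c → Coord (λ y → lookup (f y) c)

    Coord-cong : ∀ {n} {f f′ : Vec F n → F} → (∀ y → f y ≡ f′ y) → Coord f → Coord f′
    Coord-cong eq (inj₁ (k , h)) = inj₁ (k , λ y → trans (sym (eq y)) (h y))
    Coord-cong eq (inj₂ (i , h)) = inj₂ (i , λ y → trans (sym (eq y)) (h y))

    CoordV-const : ∀ {n k} (v : Vec F k) → CoordV {n} (λ _ → v)
    CoordV-const v c = inj₁ (lookup v c , λ y → refl)

    CoordV-first : ∀ {n a b} (f : Vec F n → Vec F (a + b)) → CoordV f → CoordV (firstPart a ∘ f)
    CoordV-first {b = b} f cf c = Coord-cong (λ y → sym (lookup∘tabulate _ c)) (cf (c ↑ˡ b))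

    CoordV-last : ∀ {n a b} (f : Vec F n → Vec F (a + b)) → CoordV f → CoordV (lastPart a ∘ f)
    CoordV-last {a = a} f cf c = Coord-cong (λ y → sym (lookup∘tabulate _ c)) (cf (a ↑ʳ c))

    CoordV-++ : ∀ {n a b} (f : Vec F n → Vec F a) (f′ : Vec F n → Vec F b) → CoordV f → CoordV f′ → CoordV (λ y → f y ++ f′ y)
    CoordV-++ {a = a} f f′ cf cf′ c with splitAt a c in eq
    ... | inj₁ c′ = Coord-cong (λ y → sym (trans (lookup-splitAt a (f y) (f′ y) c) (cong [ lookup (f y) , lookup (f′ y) ]′ eq))) (cf c′)
    ... | inj₂ c′ = Coord-cong (λ y → sym (trans (lookup-splitAt a (f y) (f′ y) c) (cong [ lookup (f y) , lookup (f′ y) ]′ eq))) (cf′ c′)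

    CoordV-snoc : ∀ {n k t} (f : Vec F n → Fin t → Vec F k) (w : Vec F k) → (∀ a → CoordV (λ y → f y a)) →
      ∀ a → CoordV (λ y → snoc (f y) w a)
    CoordV-snoc {t = zero} f w cf zero = CoordV-const w
    CoordV-snoc {t = suc t} f w cf zero = cf zero
    CoordV-snoc {t = suc t} f w cf (suc a) = CoordV-snoc (λ y → f y ∘ suc) w (cf ∘ suc) a

    CoordV-edge : ∀ {n} u w (f : Vec F n → Path) → (∀ a → CoordV (λ y → f y a)) → ∀ ε → CoordV (λ y → edge u w (f y) ε)
    CoordV-edge u w f cf ε with splitAt t ε
    ... | inj₁ a = cf a
    ... | inj₂ a = CoordV-++ (λ y → leftV u (f y) a) (λ y → rightV w (f y) a) (left a)
        (CoordV-snoc (λ y a → lastPart A (f y a)) w (λ a → CoordV-last (λ y → f y a) (cf a)) a)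
      where
      left : ∀ a → CoordV (λ y → leftV u (f y) a)
      left zero = CoordV-const u
      left (suc a) = CoordV-first (λ y → f y a) (cf a)

    module Coefficients (dim : s * K ≡ h * (t * M)) (H≤q : H ≤ q) where

      x : Fin H → F
      x μ = inject≤ μ H≤q

      open RandomPolynomials 𝔻 s H K x public

      pos : Fin h → Fin t → Fin M → Fin (s * K)
      pos n a c = cast (sym dim) (combine n (combine a c))

      blocks : Vec F (s * K) → Fin h → Path
      blocks y n a = tabulate (λ c → lookup y (pos n a c))

      encode : (Fin h → Path) → Vec F (s * K)
      encode P = tabulate λ i → let (n , r) = remQuot {h} (t * M) (cast dim i) ; (a , c) = remQuot {t} M r in lookup (P n a) c

      blocks-encode : ∀ P n a → blocks (encode P) n a ≡ P n a
      blocks-encode P n a = trans (tabulate-cong λ c → trans (lookup∘tabulate _ (pos n a c))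
        (trans (cong (λ i → at (remQuot {h} (t * M) i)) (cast-involutive dim (sym dim) (combine n (combine a c))))
          (trans (cong at (remQuot-combine {n = h} {k = t * M} n (combine a c)))
            (cong (λ p → lookup (P n (proj₁ p)) (proj₂ p)) (remQuot-combine {n = t} {k = M} a c)))))
        (tabulate∘lookup (P n a))
        where
        at : Fin h × Fin (t * M) → F
        at p = let (a , c) = remQuot {t} M (proj₂ p) in lookup (P (proj₁ p) a) c

      edge-cong : ∀ u w {P P′ : Path} → (∀ a → P a ≡ P′ a) → ∀ ε → edge u w P ε ≡ edge u w P′ ε
      edge-cong u w {P} {P′} eq ε with splitAt t ε
      ... | inj₁ a = eq a
      ... | inj₂ a = cong₂ _++_ (left a) (snoc-cong (λ a → cong (lastPart A) (eq a)) a)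
        where
        left : ∀ a → leftV u P a ≡ leftV u P′ a
        left zero = refl
        left (suc a) = cong (firstPart A) (eq a)

      Family : Set
      Family = Vec (Vec (Vec F M) t) N₀

      path : Family → Fin N₀ → Path
      path Y n = lookup (lookup Y n)

      -- Just what the dimension count consumes: edges of all paths pairwise distinct, since edges
      -- are the interpolation nodes, and first right vertices with distinct hashes at `z`, since
      -- these hashes are the coordinates of the grid.
      record IsBad (u : Vec F A) (w : Vec F B) (b : Vec F s) (z : F) (g : Vec F T) (Y : Family) : Set where
        constructor isBad
        field
          lies : ∀ n ε i → value g i (edge u w (path Y n) ε) ≡ lookup b i
          edges-distinct : ∀ n ε n′ ε′ → edge u w (path Y n) ε ≡ edge u w (path Y n′) ε′ → n ≡ n′ × ε ≡ ε′
          hashes-distinct : ∀ n n′ → eval (rightV w (path Y n) zero) z ≡ eval (rightV w (path Y n′) zero) z → n ≡ n′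

      isBad? : ∀ u w b z g Y → Dec (IsBad u w b z g Y)
      isBad? u w b z g Y = map′
        (λ { (p , r , o) → isBad p r o }) (λ { (isBad p r o) → p , r , o })
        (all? (λ n → all? λ ε → all? λ i → value g i (edge u w (path Y n) ε) ≟ lookup b i)
          ×-dec (all? λ n → all? λ ε → all? λ n′ → all? λ ε′ →
                  ≡-dec _≟_ (edge u w (path Y n) ε) (edge u w (path Y n′) ε′) →-dec ((n ≟ n′) ×-dec (ε ≟ ε′)))
          ×-dec (all? λ n → all? λ n′ →
                  (eval (rightV w (path Y n) zero) z ≟ eval (rightV w (path Y n′) zero) z) →-dec (n ≟ n′)))

      bad? : ∀ u w b z g → Dec (Σ Family (IsBad u w b z g))
      bad? u w b z g = search-Vec (search-Vec (search-Vec (search-Fin q) M) t) N₀ (isBad? u w b z g)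

      nodes : Vec F A → Vec F B → Fin K → Vec F (s * K) → Vec F M
      nodes u w j y = let (ε , n) = remQuot {ke} h j in edge u w (blocks y n) ε

      CoordV-blocks : ∀ n a → CoordV (λ y → blocks y n a)
      CoordV-blocks n a c = inj₂ (pos n a c , λ y → lookup∘tabulate _ c)

      nodes-coord : ∀ u w j → CoordV (nodes u w j)
      nodes-coord u w j = let (ε , n) = remQuot {ke} h j in CoordV-edge u w (λ y → blocks y n) (CoordV-blocks n) ε

      starts : Vec F B → Fin h → Vec F (s * K) → Vec F B
      starts w n y = rightV w (blocks y n) zero

      starts-coord : ∀ w n → CoordV (starts w n)
      starts-coord w n = CoordV-snoc (λ y a → lastPart A (blocks y n a)) w (λ a → CoordV-last (λ y → blocks y n a) (CoordV-blocks n a)) zero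

      c E₁ : ℕ
      c = K * 1 + K * (K * 1)
      E₁ = solveDeg K (K * 1 + 1)

      -- The N₀ = h (D + 1) paths are cut into h groups of D + 1. A choice `l` takes one path from
      -- each group, and `val n i` is the hash of path i of group n, so the chosen hashes run over a
      -- full grid while g stays fixed.
      few-bad : ∀ j → h + j ≡ suc T → H * pN T (suc T * (suc D * E₁) * suc c) < pN (suc T) D → ∀ u w b z →
        cntV (λ g → does (bad? u w b z g)) * q ≤ shatterConst D T j * q ^ j
      few-bad j h+j D-large u w b z = bad-bound _ witness
        where
        open Nodes (nodes u w) (nodes-coord u w) (lookup b) using (module Bound)
        open Bound h j D h+j (λ {μ} {ν} e → inject≤-injective H≤q H≤q μ ν e) ≤-refl D-large (starts w) (starts-coord w) z
        witness : ∀ g → does (bad? u w b z g) ≡ true → Σ (Fin h → Fin (suc D) → F) λ val →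
          (∀ m {i j} → val m i ≡ val m j → i ≡ j) ×
          (∀ (l : Fin h → Fin (suc D)) → Σ (Vec F (s * K)) λ y →
            (∀ i j → nodes u w i y ≡ nodes u w j y → i ≡ j) × (∀ i j → value g i (nodes u w j y) ≡ lookup b i) ×
            (∀ m → eval (starts w m y) z ≡ val m (l m)))
        witness g bg with does-true (bad? u w b z g) bg
        ... | Y , isBad lies dist hd = val , (λ n {i} {j} e → proj₂ (combine-injective n i n j (hd (combine n i) (combine n j) e))) , rest
          where
          val : Fin h → Fin (suc D) → F
          val n i = eval (rightV w (path Y (combine n i)) zero) z
          rest : ∀ l → _
          rest l = y , distinct , (λ i j → trans (cong (value g i) (node≡ j)) (lies _ _ i)) ,
            λ n → cong (λ v → eval v z) (snoc-cong (λ a → cong (lastPart A) (blocks-encode P n a)) zero)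
            where
            P : Fin h → Path
            P n = path Y (combine n (l n))
            y = encode P
            node≡ : ∀ j → nodes u w j y ≡ edge u w (P (proj₂ (remQuot {ke} h j))) (proj₁ (remQuot {ke} h j))
            node≡ j = edge-cong u w (blocks-encode P (proj₂ (remQuot {ke} h j))) (proj₁ (remQuot {ke} h j))
            distinct : ∀ i j → nodes u w i y ≡ nodes u w j y → i ≡ j
            distinct i j e with dist _ _ _ _ (trans (sym (node≡ i)) (trans e (node≡ j)))
            ... | n≡ , ε≡ = trans (sym (combine-remQuot {ke} h i)) (trans
              (cong₂ combine ε≡ (proj₁ (combine-injective _ _ _ _ n≡))) (combine-remQuot {ke} h j))

      partU : Vec F m → Vec F A
      partU v = firstPart A v
      partW : Vec F m → Vec F B
      partW v = firstPart B (lastPart A v)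
      partB : Vec F m → Vec F s
      partB v = firstPart s (lastPart B (lastPart A v))
      partZ : Vec F m → F
      partZ v = lookup (lastPart s (lastPart B (lastPart A v))) zero

      parts : ∀ u w b z → Σ (Vec F m) λ v → partU v ≡ u × partW v ≡ w × partB v ≡ b × partZ v ≡ z
      parts u w b z = v , firstPart-++ u _ , trans (cong (firstPart B) l₁) (firstPart-++ w _) ,
        trans (cong (firstPart s) l₂) (firstPart-++ b _) ,
        cong (λ r → lookup r zero) (trans (cong (lastPart s) l₂) (lastPart-++ b _))
        where
        v = u ++ (w ++ (b ++ (z ∷ [])))
        l₁ : lastPart A v ≡ w ++ (b ++ (z ∷ []))
        l₁ = lastPart-++ u _
        l₂ : lastPart B (lastPart A v) ≡ b ++ (z ∷ [])
        l₂ = trans (cong (lastPart B) l₁) (lastPart-++ w _)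

      IsBad-resp : ∀ {u u′ w w′ b b′ z z′ g Y} → u ≡ u′ → w ≡ w′ → b ≡ b′ → z ≡ z′ → IsBad u′ w′ b′ z′ g Y → IsBad u w b z g Y
      IsBad-resp refl refl refl refl bad = bad

      good-coefficients : ∀ j → h + j ≡ suc T → H * pN T (suc T * (suc D * E₁) * suc c) < pN (suc T) D →
        shatterConst D T j < q → Σ (Vec F T) λ g → ∀ u w b z Y → ¬ IsBad u w b z g Y
      good-coefficients j h+j D-large C<q = proj₁ found , none
        where
        Bad : Vec F m → Vec F T → Bool
        Bad v g = does (bad? (partU v) (partW v) (partB v) (partZ v) g)
        found : Σ (Vec F T) λ g → ∀ v → Bad v g ≡ false
        found = avoid-all {T = T} {m} {shatterConst D T j} {j} Bad
          (λ v → few-bad j h+j D-large (partU v) (partW v) (partB v) (partZ v)) (small-union (shatterConst D T j) m j T h+j C<q)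
        none : ∀ u w b z Y → ¬ IsBad u w b z (proj₁ found) Y
        none u w b z Y bad = let (v , eu , ew , eb , ez) = parts u w b z in
          does-false (bad? (partU v) (partW v) (partB v) (partZ v) (proj₁ found)) (proj₂ found v) (Y , IsBad-resp eu ew eb ez bad)

-- Positions along the paths of θ and the two sides of a bipartite graph.

module ThetaPaths where

  open import Defs
  open import Data.Nat
  open import Data.Nat.Properties
  open import Data.Fin using (Fin; fromℕ<)
  open import Data.Fin.Properties using (fromℕ<-injective)
  open import Data.Bool using (Bool; true; false; not)
  open import Data.Product using (_×_; _,_; proj₁; proj₂)
  open import Data.Sum using (_⊎_; inj₁; inj₂)
  open import Data.Empty using (⊥-elim)
  open import Relation.Nullary
  open import Relation.Binary.PropositionalEquality

  -- Unlike `2 *_` this unfolds to two successors, so that even and odd positions on a path are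
  -- reached by plain recursion.
  dbl : ℕ → ℕ
  dbl zero = zero
  dbl (suc a) = suc (suc (dbl a))

  dbl≡2* : ∀ a → dbl a ≡ 2 * a
  dbl≡2* zero = refl
  dbl≡2* (suc a) = cong suc (trans (cong suc (dbl≡2* a)) (sym (+-suc a (a + 0))))

  dbl-injective : ∀ a b → dbl a ≡ dbl b → a ≡ b
  dbl-injective zero zero e = refl
  dbl-injective (suc a) (suc b) e = cong suc (dbl-injective a b (suc-injective (suc-injective e)))

  dbl-mono : ∀ {a b} → a ≤ b → dbl a ≤ dbl b
  dbl-mono z≤n = z≤n
  dbl-mono (s≤s h) = s≤s (s≤s (dbl-mono h))

  dbl≢sucdbl : ∀ a b → ¬ (dbl a ≡ suc (dbl b))
  dbl≢sucdbl (suc a) (suc b) e = dbl≢sucdbl a b (suc-injective (suc-injective e))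

  pathVertex-end : ∀ k ℓ i → 1 ≤ k → pathVertex k ℓ i k ≡ inj₁ true
  pathVertex-end (suc k) ℓ i _ with k <? k
  ... | yes p = ⊥-elim (<-irrefl refl p)
  ... | no _ = refl

  data PathView (k ℓ : ℕ) (i : Fin ℓ) : ℕ → Set where
    first : pathVertex k ℓ i 0 ≡ inj₁ false → PathView k ℓ i 0
    inner : ∀ {s} (p : s < k ∸ 1) → pathVertex k ℓ i (suc s) ≡ inj₂ (i , fromℕ< p) → PathView k ℓ i (suc s)
    last : pathVertex k ℓ i k ≡ inj₁ true → PathView k ℓ i k

  pathView : ∀ k ℓ i τ → 1 ≤ k → τ ≤ k → PathView k ℓ i τ
  pathView k ℓ i zero _ _ = first refl
  pathView (suc k) ℓ i (suc s) 1≤k (s≤s le) with m≤n⇒m<n∨m≡n le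
  ... | inj₂ refl = last (pathVertex-end (suc k) ℓ i 1≤k)
  ... | inj₁ lt = inner lt eq
    where
    eq : pathVertex (suc k) ℓ i (suc s) ≡ inj₂ (i , fromℕ< lt)
    eq with s <? k
    ... | yes p = refl
    ... | no ¬p = ⊥-elim (¬p lt)

  pathVertex-injective : ∀ k ℓ i i′ τ τ′ → 1 ≤ k → τ ≤ k → τ′ ≤ k →
    pathVertex k ℓ i τ ≡ pathVertex k ℓ i′ τ′ → τ ≡ τ′ × (i ≡ i′ ⊎ τ ≡ 0 ⊎ τ ≡ k)
  pathVertex-injective k ℓ i i′ τ τ′ 1≤k le le′ e = agree (pathView k ℓ i τ 1≤k le) (pathView k ℓ i′ τ′ 1≤k le′) e
    where
    agree : ∀ {τ τ′} → PathView k ℓ i τ → PathView k ℓ i′ τ′ → pathVertex k ℓ i τ ≡ pathVertex k ℓ i′ τ′ →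
      τ ≡ τ′ × (i ≡ i′ ⊎ τ ≡ 0 ⊎ τ ≡ k)
    agree (first _) (first _) e = refl , inj₂ (inj₁ refl)
    agree (last _) (last _) e = refl , inj₂ (inj₂ refl)
    agree (inner p h) (inner p′ h′) e with trans (sym h) (trans e h′)
    ... | eq = cong suc (fromℕ<-injective _ _ p p′ (cong proj₂ (inj₂-inj eq))) , inj₁ (cong proj₁ (inj₂-inj eq))
      where
      inj₂-inj : ∀ {A B : Set} {x y : B} → _≡_ {A = A ⊎ B} (inj₂ x) (inj₂ y) → x ≡ y
      inj₂-inj refl = refl
    agree (first h) (inner _ h′) e with trans (sym h) (trans e h′)
    ... | ()
    agree (first h) (last h′) e with trans (sym h) (trans e h′)
    ... | ()
    agree (inner _ h) (first h′) e with trans (sym h) (trans e h′)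
    ... | ()
    agree (inner _ h) (last h′) e with trans (sym h) (trans e h′)
    ... | ()
    agree (last h) (first h′) e with trans (sym h) (trans e h′)
    ... | ()
    agree (last h) (inner _ h′) e with trans (sym h) (trans e h′)
    ... | ()

  BAdj-sym : ∀ {m n} (G : BipGraph m n) x y → BAdj G x y → BAdj G y x
  BAdj-sym G (inj₁ _) (inj₂ _) h = h
  BAdj-sym G (inj₂ _) (inj₁ _) h = h

  side : ∀ {m n} → BVertex m n → Bool
  side (inj₁ _) = true
  side (inj₂ _) = false

  BAdj-side : ∀ {m n} (G : BipGraph m n) x y → BAdj G x y → side y ≡ not (side x)
  BAdj-side G (inj₁ _) (inj₂ _) h = refl
  BAdj-side G (inj₂ _) (inj₁ _) h = refl

-- The algebraic graph: absence of θ and number of edges.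

module RandomGraph where

  open import Defs
  open FiniteSums
  open Polynomials
  open Shattering
  open RandomCoefficients
  open PathFamilies
  open ThetaPaths
  open import Data.Nat hiding (_≟_)
  open import Data.Nat.Properties hiding (suc-injective; _≟_)
  open import Data.Fin using (Fin; zero; suc; combine; remQuot; splitAt; toℕ; _↑ˡ_; join)
  open import Data.Fin.Properties using (combine-remQuot; remQuot-combine; _≟_; all?; splitAt-↑ˡ; toℕ-injective; toℕ<n; join-splitAt)
  open import Data.Bool using (Bool; true; false; not) renaming (T to IsTrue)
  open import Data.Bool.Properties using (not-involutive)
  open import Data.Maybe.Properties using (just-injective)
  open import Data.Maybe using (Maybe; just; nothing; fromMaybe)
  open import Data.Vec using (Vec; []; _∷_; _++_; lookup; tabulate)
  open import Data.Vec.Properties using (lookup∘tabulate; ++-injective; ∷-injective)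
  open import Data.Product using (Σ; _×_; _,_; proj₁; proj₂)
  open import Data.Sum using (_⊎_; inj₁; inj₂; [_,_]′)
  open import Data.Empty using (⊥; ⊥-elim)
  open import Function using (_∘_)
  open import Relation.Nullary
  open import Relation.Nullary.Decidable using (dec-true)
  open import Relation.Binary.PropositionalEquality

  sum-combine : ∀ a b (f : Fin (a * b) → ℕ) → sumFin (a * b) f ≡ sumFin a (λ i → sumFin b (λ j → f (combine i j)))
  sum-combine zero b f = refl
  sum-combine (suc a) b f = trans (sum-++ b (a * b) f) (cong (sumFin b (λ j → f (j ↑ˡ (a * b))) +_) (sum-combine a b _))

  digits : ∀ {q} n → Fin (q ^ n) → Vec (Fin q) n
  digits zero _ = []
  digits {q} (suc n) i = let (a , r) = remQuot {q} (q ^ n) i in a ∷ digits n r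

  digits-injective : ∀ {q} n i j → digits {q} n i ≡ digits n j → i ≡ j
  digits-injective zero zero zero e = refl
  digits-injective {q} (suc n) i j e with ∷-injective e
  ... | e₁ , e₂ = trans (sym (combine-remQuot {q} (q ^ n) i))
    (trans (cong₂ combine e₁ (digits-injective n _ _ e₂)) (combine-remQuot {q} (q ^ n) j))

  sum-digits : ∀ {q} n (f : Vec (Fin q) n → ℕ) → sumFin (q ^ n) (f ∘ digits n) ≡ sumV n f
  sum-digits zero f = +-identityʳ (f [])
  sum-digits {q} (suc n) f = trans (sum-combine q (q ^ n) (f ∘ digits (suc n))) (trans
    (sum-cong q (λ a → trans (sum-cong (q ^ n) (λ r → cong (λ p → f (proj₁ p ∷ digits n (proj₂ p))) (remQuot-combine {q} {q ^ n} a r)))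
      (sum-digits n (λ v → f (a ∷ v)))))
    (sym (sumV-sumFin n q (λ v a → f (a ∷ v)))))

  sumV-≥-witness : ∀ {q} n c (f : Vec (Fin q) n → ℕ) → 0 < q → q ^ n * c ≤ sumV n f → Σ (Vec (Fin q) n) λ v → c ≤ f v
  sumV-≥-witness {q} n c f 0<q h with sumV-<-witness n (λ _ → c) (λ v → 1 + f v)
    (subst₂ _<_ (sym (sumV-const n c)) (sym (trans (sumV-+ n (λ _ → 1) f) (cong (_+ sumV n f) (trans (sumV-const n 1) (*-identityʳ (q ^ n))))))
      (≤-<-trans h (m<n+m (sumV n f) (m^n>0 q {{>-nonZero 0<q}} n))))
  ... | v , lt = v , s≤s⁻¹ lt

  module AlgebraicGraph {q : ℕ} (𝔻 : FinDomain q) (t₁ A B s D : ℕ) where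
    t : ℕ
    t = suc t₁
    open Paths 𝔻 t A B s D using (N₀; H; K; h; M; ke; Path; leftV; rightV; edge; module Coefficients)
    open DomainTheory 𝔻 using (F; eval; zeros)
    open Counting 𝔻 using (separate)

    k : ℕ
    k = suc (dbl t)

    module Build (dim : s * K ≡ h * (t * M)) (H≤q : H ≤ q) (N-small : N₀ * (N₀ * B) < q) where
     open Coefficients dim H≤q hiding (pos)

     module Given (g : Vec F T) (none : ∀ u w b z Y → ¬ IsBad u w b z g Y)
      (m′ n′ : ℕ) (b : Vec F s) where

      adj? : ∀ (u : Vec F A) (w : Vec F B) → Dec (∀ i → value {A + B} g i (u ++ w) ≡ lookup b i)
      adj? u w = all? λ i → value {A + B} g i (u ++ w) ≟ lookup b i

      adj : Vec F A → Vec F B → Bool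
      adj u w = does (adj? u w)

      -- Indices beyond q^n are padding: isolated vertices that bring the two sides to the
      -- prescribed sizes.
      decode : ∀ n m → Fin (q ^ n + m) → Maybe (Vec F n)
      decode n m i = [ just ∘ digits n , (λ _ → nothing) ]′ (splitAt (q ^ n) i)

      decode-injective : ∀ n m i j {v} → decode n m i ≡ just v → decode n m j ≡ just v → i ≡ j
      decode-injective n m i j e e′ with splitAt (q ^ n) i in eq | splitAt (q ^ n) j in eq′
      decode-injective n m i j refl e′ | inj₁ a | inj₁ c = trans (sym (join-splitAt (q ^ n) m i))
        (trans (cong (join (q ^ n) m) (trans eq (trans (cong inj₁ (sym (digits-injective n c a (just-injective e′)))) (sym eq′))))
          (join-splitAt (q ^ n) m j))

      link : Maybe (Vec F A) → Maybe (Vec F B) → Bool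
      link (just u) (just w) = adj u w
      link _ _ = false

      G : BipGraph (q ^ A + m′) (q ^ B + n′)
      G i j = link (decode A m′ i) (decode B n′ j)

      V : Set
      V = BVertex (q ^ A + m′) (q ^ B + n′)

      uOf : V → Vec F A
      uOf (inj₁ i) = fromMaybe zeros (decode A m′ i)
      uOf (inj₂ _) = zeros

      wOf : V → Vec F B
      wOf (inj₁ _) = zeros
      wOf (inj₂ j) = fromMaybe zeros (decode B n′ j)

      -- `uOf` sends padding and right vertices to `zeros`, so it is injective only on the vertices
      -- certified here.
      data Left : V → Set where
        left : ∀ i {u} → decode A m′ i ≡ just u → Left (inj₁ i)
      data Right : V → Set where
        right : ∀ j {w} → decode B n′ j ≡ just w → Right (inj₂ j)

      uOf-injective : ∀ {x y} → Left x → Left y → uOf x ≡ uOf y → x ≡ y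
      uOf-injective (left i e) (left j e′) h = cong inj₁ (decode-injective A m′ i j e
        (trans e′ (cong just (trans (sym (cong (fromMaybe zeros) e′)) (trans (sym h) (cong (fromMaybe zeros) e))))))

      wOf-injective : ∀ {x y} → Right x → Right y → wOf x ≡ wOf y → x ≡ y
      wOf-injective (right i e) (right j e′) h = cong inj₂ (decode-injective B n′ i j e
        (trans e′ (cong just (trans (sym (cong (fromMaybe zeros) e′)) (trans (sym h) (cong (fromMaybe zeros) e))))))

      link-sound : ∀ x y → side x ≡ true → BAdj G x y →
        Left x × Right y × (∀ i → value g i (uOf x ++ wOf y) ≡ lookup b i)
      link-sound (inj₁ i) (inj₂ j) _ h = go (decode A m′ i) (decode B n′ j) refl refl h
        where
        go : ∀ mu mw → decode A m′ i ≡ mu → decode B n′ j ≡ mw → IsTrue (link mu mw) →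
          Left (inj₁ i) × Right (inj₂ j) × (∀ i′ → value g i′ (fromMaybe zeros (decode A m′ i) ++ fromMaybe zeros (decode B n′ j)) ≡ lookup b i′)
        go (just u) (just w) e e′ h = left i e , right j e′ , λ i′ →
          trans (cong₂ (λ a c → value {A + B} g i′ (fromMaybe (zeros {A}) a ++ fromMaybe (zeros {B}) c)) e e′)
            (does-true (adj? u w) (T⇒true h) i′)
          where
          T⇒true : ∀ {c} → IsTrue c → c ≡ true
          T⇒true {true} _ = refl

      -- Starting on the left, the walks are on the left at even positions and on the right at odd
      -- ones. Block a of a path joins positions 2a + 2 and 2a + 1, and the θ-like disjointness of
      -- positions becomes distinctness of edges.
      no-walks : (W : Fin N₀ → ℕ → V) (u w : V) → (∀ n → W n 0 ≡ u) → (∀ n → W n k ≡ w) → side u ≡ true →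
        (∀ n τ → τ < k → BAdj G (W n τ) (W n (suc τ))) →
        (∀ n n′ τ τ′ → τ ≤ k → τ′ ≤ k → W n τ ≡ W n′ τ′ → τ ≡ τ′ × (n ≡ n′ ⊎ τ ≡ 0 ⊎ τ ≡ k)) → ⊥
      no-walks W u w W0 Wk su step inj = none (uOf u) (wOf w) b z Y (isBad lies distinct hashes)
        where
        dbl<k : ∀ {a} → a ≤ t → dbl a < k
        dbl<k le = s≤s (dbl-mono le)
        side-even : ∀ n a → a ≤ t → side (W n (dbl a)) ≡ true
        side-even n zero _ = trans (cong side (W0 n)) su
        side-even n (suc a) le = trans (BAdj-side G _ _ (step n (suc (dbl a)) (m≤n⇒m≤1+n (dbl-mono le))))
          (trans (cong not (BAdj-side G _ _ (step n (dbl a) (dbl<k (≤-trans (n≤1+n a) le)))))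
            (trans (not-involutive _) (side-even n a (≤-trans (n≤1+n a) le))))
        forth : ∀ n a → a ≤ t → _
        forth n a le = link-sound (W n (dbl a)) (W n (suc (dbl a))) (side-even n a le) (step n (dbl a) (dbl<k le))
        back : ∀ n a → a < t → ∀ i → value g i (uOf (W n (dbl (suc a))) ++ wOf (W n (suc (dbl a)))) ≡ lookup b i
        back n a lt = proj₂ (proj₂ (link-sound (W n (dbl (suc a))) (W n (suc (dbl a))) (side-even n (suc a) lt)
          (BAdj-sym G (W n (suc (dbl a))) (W n (dbl (suc a))) (step n (suc (dbl a)) (m≤n⇒m≤1+n (dbl-mono lt))))))
        P : Fin N₀ → Path
        P n a = uOf (W n (dbl (suc (toℕ a)))) ++ wOf (W n (suc (dbl (toℕ a))))
        Y : Family
        Y = tabulate (λ n → tabulate (P n))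
        path≡ : ∀ n a → path Y n a ≡ P n a
        path≡ n a = trans (cong (λ v → lookup v a) (lookup∘tabulate (λ n → tabulate (P n)) n)) (lookup∘tabulate (P n) a)
        left≡ : ∀ n a → leftV (uOf u) (P n) a ≡ uOf (W n (dbl (toℕ a)))
        left≡ n zero = cong uOf (sym (W0 n))
        left≡ n (suc a) = firstPart-++ _ (wOf (W n (suc (dbl (toℕ a)))))
        snoc≡ : ∀ {X : Set} {t} {f : Fin t → X} {x} (h : ℕ → X) → (∀ a → f a ≡ h (toℕ a)) → x ≡ h t → ∀ a → snoc f x a ≡ h (toℕ a)
        snoc≡ {t = zero} h e e′ zero = e′
        snoc≡ {t = suc t} h e e′ zero = e zero
        snoc≡ {t = suc t} h e e′ (suc a) = snoc≡ (h ∘ suc) (e ∘ suc) e′ a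
        right≡ : ∀ n a → rightV (wOf w) (P n) a ≡ wOf (W n (suc (dbl (toℕ a))))
        right≡ n = snoc≡ (λ a → wOf (W n (suc (dbl a)))) (λ a → lastPart-++ (uOf (W n (dbl (suc (toℕ a))))) _) (cong wOf (sym (Wk n)))
        lpos rpos : Fin ke → ℕ
        lpos ε = [ suc ∘ toℕ , toℕ ]′ (splitAt t ε)
        rpos ε = [ toℕ , toℕ ]′ (splitAt t ε)
        pos≤ : ∀ ε → lpos ε ≤ t × rpos ε ≤ t
        pos≤ ε with splitAt t ε
        ... | inj₁ a = toℕ<n a , <⇒≤ (toℕ<n a)
        ... | inj₂ a = s≤s⁻¹ (toℕ<n a) , s≤s⁻¹ (toℕ<n a)
        edgeP : ∀ n ε → edge (uOf u) (wOf w) (P n) ε ≡ uOf (W n (dbl (lpos ε))) ++ wOf (W n (suc (dbl (rpos ε))))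
        edgeP n ε with splitAt t ε
        ... | inj₁ a = refl
        ... | inj₂ a = cong₂ _++_ (left≡ n a) (right≡ n a)
        edge≡ : ∀ n ε → edge (uOf u) (wOf w) (path Y n) ε ≡ uOf (W n (dbl (lpos ε))) ++ wOf (W n (suc (dbl (rpos ε))))
        edge≡ n ε = trans (edge-cong (uOf u) (wOf w) (path≡ n) ε) (edgeP n ε)
        on-edge : ∀ n ε i → value g i (uOf (W n (dbl (lpos ε))) ++ wOf (W n (suc (dbl (rpos ε))))) ≡ lookup b i
        on-edge n ε i with splitAt t ε
        ... | inj₁ a = back n (toℕ a) (toℕ<n a) i
        ... | inj₂ a = proj₂ (proj₂ (forth n (toℕ a) (s≤s⁻¹ (toℕ<n a)))) i
        lies : ∀ n ε i → value g i (edge (uOf u) (wOf w) (path Y n) ε) ≡ lookup b i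
        lies n ε i = trans (cong (value g i) (edge≡ n ε)) (on-edge n ε i)
        pos-injective : ∀ ε ε′ → lpos ε ≡ lpos ε′ → rpos ε ≡ rpos ε′ → ε ≡ ε′
        pos-injective ε ε′ e e′ = trans (sym (join-splitAt t (suc t) ε)) (trans (cong (join t (suc t)) split≡) (join-splitAt t (suc t) ε′))
          where
          split≡ : splitAt t ε ≡ splitAt t ε′
          split≡ with splitAt t ε | splitAt t ε′
          ... | inj₁ a | inj₁ c = cong inj₁ (toℕ-injective e′)
          ... | inj₂ a | inj₂ c = cong inj₂ (toℕ-injective e′)
          ... | inj₁ a | inj₂ c = ⊥-elim (1+n≢n (trans e (sym e′)))
          ... | inj₂ a | inj₁ c = ⊥-elim (1+n≢n (trans (sym e) e′))
        -- The only edge that different paths could share would join the common source to the common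
        -- target. It would be the whole path, which is impossible because t is a successor.
        interior : ∀ ε → lpos ε ≡ 0 → rpos ε ≡ t → ⊥
        interior ε e e′ with splitAt t ε
        interior ε e e′ | inj₂ zero = 0≢1+n e′
        distinct : ∀ n ε n′ ε′ → edge (uOf u) (wOf w) (path Y n) ε ≡ edge (uOf u) (wOf w) (path Y n′) ε′ → n ≡ n′ × ε ≡ ε′
        distinct n ε n′ ε′ e with ++-injective (uOf (W n (dbl (lpos ε)))) (uOf (W n′ (dbl (lpos ε′)))) (trans (sym (edge≡ n ε)) (trans e (edge≡ n′ ε′)))
        ... | eu , ew with
          inj n n′ _ _ (<⇒≤ (dbl<k (proj₁ (pos≤ ε)))) (<⇒≤ (dbl<k (proj₁ (pos≤ ε′))))
            (uOf-injective (proj₁ (forth n _ (proj₁ (pos≤ ε)))) (proj₁ (forth n′ _ (proj₁ (pos≤ ε′)))) eu)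
          | inj n n′ _ _ (dbl<k (proj₂ (pos≤ ε))) (dbl<k (proj₂ (pos≤ ε′)))
            (wOf-injective (proj₁ (proj₂ (forth n _ (proj₂ (pos≤ ε))))) (proj₁ (proj₂ (forth n′ _ (proj₂ (pos≤ ε′))))) ew)
        ... | l≡ , cl | r≡ , cr = n≡ cl cr , pos-injective ε ε′ (dbl-injective _ _ l≡) (dbl-injective _ _ (cong pred r≡))
          where
          n≡ : n ≡ n′ ⊎ dbl (lpos ε) ≡ 0 ⊎ dbl (lpos ε) ≡ k → n ≡ n′ ⊎ suc (dbl (rpos ε)) ≡ 0 ⊎ suc (dbl (rpos ε)) ≡ k → n ≡ n′
          n≡ (inj₁ p) _ = p
          n≡ (inj₂ (inj₁ _)) (inj₁ p) = p
          n≡ (inj₂ (inj₁ e₀)) (inj₂ (inj₂ eₖ)) = ⊥-elim (interior ε (dbl-injective _ 0 e₀) (dbl-injective _ _ (cong pred eₖ)))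
          n≡ (inj₂ (inj₂ eₖ)) _ = ⊥-elim (dbl≢sucdbl (lpos ε) t eₖ)
        -- Here the hash points are all the elements of the field, which is why q must exceed
        -- N₀·N₀·B.
        separated = separate (λ n → wOf (W n 1)) W1-injective (λ x → x) (λ e → e) N-small
          where
          W1-injective : ∀ n n′ → wOf (W n 1) ≡ wOf (W n′ 1) → n ≡ n′
          W1-injective n n′ e with inj n n′ 1 1 (s≤s z≤n) (s≤s z≤n)
            (wOf-injective (proj₁ (proj₂ (forth n 0 z≤n))) (proj₁ (proj₂ (forth n′ 0 z≤n))) e)
          ... | _ , inj₁ p = p
          ... | _ , inj₂ (inj₁ ())
          ... | _ , inj₂ (inj₂ ())
        z = proj₁ separated
        hashes : ∀ n n′ → eval (rightV (wOf w) (path Y n) zero) z ≡ eval (rightV (wOf w) (path Y n′) zero) z → n ≡ n′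
        hashes n n′ e = proj₂ separated n n′ (trans (sym (start n)) (trans e (start n′)))
          where
          start : ∀ n → eval (rightV (wOf w) (path Y n) zero) z ≡ eval (wOf (W n 1)) z
          start n = cong (λ v → eval v z) (trans (snoc-cong {t = t} {f′ = λ a → lastPart A (P n a)} {x = wOf w} (λ a → cong (lastPart A) (path≡ n a)) zero) (right≡ n zero))

      -- As k is odd, the two ends of θ lie on opposite sides. If the source is on the right, the
      -- walks read backwards start on the left.
      theta-free : ThetaFree k N₀ G
      theta-free (f , f-inj , f-adj) = go (side (f (inj₁ false))) refl
        where
        W : Fin N₀ → ℕ → V
        W n τ = f (pathVertex k N₀ n τ)
        W-step : ∀ n τ → τ < k → BAdj G (W n τ) (W n (suc τ))
        W-step n τ lt = f-adj _ _ (n , τ , lt , inj₁ (refl , refl))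
        W-inj : ∀ n n′ τ τ′ → τ ≤ k → τ′ ≤ k → W n τ ≡ W n′ τ′ → τ ≡ τ′ × (n ≡ n′ ⊎ τ ≡ 0 ⊎ τ ≡ k)
        W-inj n n′ τ τ′ le le′ e = pathVertex-injective k N₀ n n′ τ τ′ (s≤s z≤n) le le′ (f-inj e)
        W-end : ∀ n → W n k ≡ f (inj₁ true)
        W-end n = cong f (pathVertex-end k N₀ n (s≤s z≤n))
        side-odd : ∀ n a → suc (dbl a) ≤ k → side (W n (suc (dbl a))) ≡ not (side (f (inj₁ false)))
        side-odd n zero le = BAdj-side G _ _ (W-step n 0 le)
        side-odd n (suc a) le = trans (BAdj-side G _ _ (W-step n _ le)) (trans (cong not (BAdj-side G _ _ (W-step n _ (<⇒≤ le))))
          (trans (not-involutive _) (side-odd n a (<⇒≤ (<⇒≤ le)))))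
        go : ∀ c → side (f (inj₁ false)) ≡ c → ⊥
        go true e = no-walks W (f (inj₁ false)) (f (inj₁ true)) (λ n → refl) W-end e W-step W-inj
        go false e = no-walks (λ n τ → W n (k ∸ τ)) (f (inj₁ true)) (f (inj₁ false)) W-end
          (λ n → cong (W n) (n∸n≡0 k)) (trans (cong side (sym (W-end zero))) (trans (side-odd zero t ≤-refl) (cong not e)))
          (λ n τ lt → BAdj-sym G (W n (k ∸ suc τ)) (W n (k ∸ τ)) (subst (λ σ → BAdj G (W n (k ∸ suc τ)) (W n σ)) (sym (+-∸-assoc 1 (s≤s⁻¹ lt)))
            (W-step n (k ∸ suc τ) (s≤s (m∸n≤m (dbl t) τ)))))
          (λ n n′ τ τ′ le le′ e → reverse τ τ′ le le′ (W-inj n n′ (k ∸ τ) (k ∸ τ′) (m∸n≤m k τ) (m∸n≤m k τ′) e))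
          where
          reverse : ∀ {n n′ : Fin N₀} τ τ′ → τ ≤ k → τ′ ≤ k → k ∸ τ ≡ k ∸ τ′ × (n ≡ n′ ⊎ k ∸ τ ≡ 0 ⊎ k ∸ τ ≡ k) →
            τ ≡ τ′ × (n ≡ n′ ⊎ τ ≡ 0 ⊎ τ ≡ k)
          reverse τ τ′ le le′ (e , c) = ∸-cancelˡ-≡ le le′ e , cases c
            where
            cases : _ ⊎ k ∸ τ ≡ 0 ⊎ k ∸ τ ≡ k → _ ⊎ τ ≡ 0 ⊎ τ ≡ k
            cases (inj₁ p) = inj₁ p
            cases (inj₂ (inj₁ p)) = inj₂ (inj₂ (≤-antisym le (m∸n≡0⇒m≤n p)))
            cases (inj₂ (inj₂ p)) = inj₂ (inj₁ (∸-cancelˡ-≡ le z≤n p))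

      edgesV : ℕ
      edgesV = sumV A (λ u → sumV B (λ w → ι (adj u w)))

      many-edges : edgesV ≤ edges G
      many-edges = ≤-trans (≤-reflexive (trans (sym (sum-digits A _)) (sum-cong (q ^ A) (λ i → sym (sum-digits B _)))))
        (≤-trans (sum-mono (q ^ A) (λ i → ≤-trans (≤-reflexive (sum-cong (q ^ B) (λ j → cong ι (sym (link-digits i j)))))
            (first≤ (q ^ B) n′ (λ j → ι (G (i ↑ˡ m′) j)))))
          (first≤ (q ^ A) m′ (λ i → sumFin (q ^ B + n′) (λ j → ι (G i j)))))
        where
        first≤ : ∀ a b f → sumFin a (λ i → f (i ↑ˡ b)) ≤ sumFin (a + b) f
        first≤ a b f = ≤-trans (m≤m+n _ _) (≤-reflexive (sym (sum-++ a b f)))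
        decode-digits : ∀ n m i → decode n m (i ↑ˡ m) ≡ just (digits n i)
        decode-digits n m i = cong [ just ∘ digits n , (λ _ → nothing) ]′ (splitAt-↑ˡ (q ^ n) i m)
        link-digits : ∀ i j → G (i ↑ˡ m′) (j ↑ˡ n′) ≡ adj (digits A i) (digits B j)
        link-digits i j = cong₂ link (decode-digits A m′ i) (decode-digits B n′ j)

     -- Every pair (u, w) is adjacent for the target `b` made of its own values, so the edge counts
     -- over all q^s targets sum to at least q^(A + B), and some target reaches the mean.
     average : ∀ g (none : ∀ u w b z Y → ¬ IsBad u w b z g Y) m′ n′ e → A + B ≡ s + e → 0 < q →
       Σ (Vec F s) λ b → q ^ e ≤ Given.edgesV g none m′ n′ b
     average g none m′ n′ e dims 0<q = sumV-≥-witness s (q ^ e) (edgesV) 0<q (begin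
       q ^ s * q ^ e                                  ≡⟨ sym (^-distribˡ-+-* q s e) ⟩
       q ^ (s + e)                                    ≡⟨ cong (q ^_) (sym dims) ⟩
       q ^ (A + B)                                    ≡⟨ ^-distribˡ-+-* q A B ⟩
       q ^ A * q ^ B                                  ≡⟨ cong (q ^ A *_) (sym (*-identityʳ (q ^ B))) ⟩
       q ^ A * (q ^ B * 1)                            ≡⟨ sym (trans (sumV-cong A (λ u → sumV-const B 1)) (sumV-const A _)) ⟩
       sumV A (λ u → sumV B (λ w → 1))                ≤⟨ sumV-mono A (λ u → sumV-mono B (λ w → some-b u w)) ⟩
       sumV A (λ u → sumV B (λ w → sumV s (λ b → ι (adj b u w))))
         ≡⟨ sumV-cong A (λ u → sumV-swap B s (λ w b → ι (adj b u w))) ⟩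
       sumV A (λ u → sumV s (λ b → sumV B (λ w → ι (adj b u w))))
         ≡⟨ sumV-swap A s (λ u b → sumV B (λ w → ι (adj b u w))) ⟩
       sumV s edgesV ∎)
       where
       open ≤-Reasoning
       adj : Vec F s → Vec F A → Vec F B → Bool
       adj b = Given.adj g none m′ n′ b
       edgesV : Vec F s → ℕ
       edgesV b = Given.edgesV g none m′ n′ b
       some-b : ∀ u w → 1 ≤ sumV s (λ b → ι (adj b u w))
       some-b u w = ≤-trans (≤-reflexive (sym (ι-true (dec-true (Given.adj? g none m′ n′ b u w)
         (λ i → sym (lookup∘tabulate (λ i → value {A + B} g i (u ++ w)) i))))))
         (term≤sumV s (λ b → ι (adj b u w)) b)
         where
         b : Vec F s
         b = tabulate (λ i → value {A + B} g i (u ++ w))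

     lower-graph : ∀ j → h + j ≡ suc T → H * pN T (suc T * (suc D * E₁) * suc c) < pN (suc T) D →
       shatterConst D T j < q → ∀ e → A + B ≡ s + e → ∀ m′ n′ →
       Σ (BipGraph (q ^ A + m′) (q ^ B + n′)) λ G → ThetaFree k N₀ G × q ^ e ≤ edges G
     lower-graph j h+j D-large C<q e dims m′ n′ = realise (good-coefficients j h+j D-large C<q)
       where
       realise : Σ (Vec F T) (λ g → ∀ u w b z Y → ¬ IsBad u w b z g Y) →
         Σ (BipGraph (q ^ A + m′) (q ^ B + n′)) λ G → ThetaFree k N₀ G × q ^ e ≤ edges G
       realise (g , none) = let (b , many) = average g none m′ n′ e dims (≤-<-trans z≤n C<q) in
         Given.G g none m′ n′ b , Given.theta-free g none m′ n′ b , ≤-trans many (Given.many-edges g none m′ n′ b)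

-- Residues modulo a prime.

module PrimeField where

  open Polynomials using (FinDomain)
  open import Algebra.Structures using (IsCommutativeRing)
  open import Data.Nat
  open import Data.Nat.Properties
  open import Data.Nat.DivMod
  open import Data.Nat.Divisibility
  open import Data.Nat.Primality
  open import Data.Fin using (Fin; toℕ)
  open import Data.Fin.Properties using (toℕ-injective; toℕ-fromℕ<; toℕ<n)
  open import Data.Product using (_,_)
  open import Data.Sum using (_⊎_; inj₁; inj₂)
  open import Relation.Nullary
  open import Relation.Binary.PropositionalEquality hiding ([_])

  module _ (q : ℕ) (q-prime : Prime q) where

    private instance
      q≢0 : NonZero q
      q≢0 = prime⇒nonZero q-prime

      q>1 : NonTrivial q
      q>1 = prime⇒nonTrivial q-prime

    [_] : ℕ → Fin q
    [ m ] = m mod q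

    toℕ-[] : ∀ m → toℕ [ m ] ≡ m % q
    toℕ-[] m = toℕ-fromℕ< (m%n<n m q)

    []-cong : ∀ {m n} → m % q ≡ n % q → [ m ] ≡ [ n ]
    []-cong {m} {n} e = toℕ-injective (trans (toℕ-[] m) (trans e (sym (toℕ-[] n))))

    [toℕ] : ∀ a → [ toℕ a ] ≡ a
    [toℕ] a = toℕ-injective (trans (toℕ-[] (toℕ a)) (m<n⇒m%n≡m (toℕ<n a)))

    _⊕_ _⊗_ : Fin q → Fin q → Fin q
    a ⊕ b = [ toℕ a + toℕ b ]
    a ⊗ b = [ toℕ a * toℕ b ]

    ⊖_ : Fin q → Fin q
    ⊖ a = [ q ∸ toℕ a ]

    []-+ : ∀ m n → [ m ] ⊕ [ n ] ≡ [ m + n ]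
    []-+ m n = []-cong (trans (cong₂ (λ x y → (x + y) % q) (toℕ-[] m) (toℕ-[] n)) (sym (%-distribˡ-+ m n q)))

    []-* : ∀ m n → [ m ] ⊗ [ n ] ≡ [ m * n ]
    []-* m n = []-cong (trans (cong₂ (λ x y → (x * y) % q) (toℕ-[] m) (toℕ-[] n)) (sym (%-distribˡ-* m n q)))

    []-+ˡ : ∀ m b → [ m ] ⊕ b ≡ [ m + toℕ b ]
    []-+ˡ m b = trans (cong ([ m ] ⊕_) (sym ([toℕ] b))) ([]-+ m (toℕ b))

    []-+ʳ : ∀ a n → a ⊕ [ n ] ≡ [ toℕ a + n ]
    []-+ʳ a n = trans (cong (_⊕ [ n ]) (sym ([toℕ] a))) ([]-+ (toℕ a) n)

    []-*ˡ : ∀ m b → [ m ] ⊗ b ≡ [ m * toℕ b ]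
    []-*ˡ m b = trans (cong ([ m ] ⊗_) (sym ([toℕ] b))) ([]-* m (toℕ b))

    []-*ʳ : ∀ a n → a ⊗ [ n ] ≡ [ toℕ a * n ]
    []-*ʳ a n = trans (cong (_⊗ [ n ]) (sym ([toℕ] a))) ([]-* (toℕ a) n)

    ⊕-comm : ∀ a b → a ⊕ b ≡ b ⊕ a
    ⊕-comm a b = cong [_] (+-comm (toℕ a) (toℕ b))

    ⊗-comm : ∀ a b → a ⊗ b ≡ b ⊗ a
    ⊗-comm a b = cong [_] (*-comm (toℕ a) (toℕ b))

    ⊕-identityˡ : ∀ a → [ 0 ] ⊕ a ≡ a
    ⊕-identityˡ a = trans ([]-+ˡ 0 a) ([toℕ] a)

    ⊗-identityˡ : ∀ a → [ 1 ] ⊗ a ≡ a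
    ⊗-identityˡ a = trans ([]-*ˡ 1 a) (trans (cong [_] (*-identityˡ (toℕ a))) ([toℕ] a))

    ⊖-inverseˡ : ∀ a → (⊖ a) ⊕ a ≡ [ 0 ]
    ⊖-inverseˡ a = trans ([]-+ˡ (q ∸ toℕ a) a) ([]-cong (trans (cong (_% q) (m∸n+n≡m (<⇒≤ (toℕ<n a)))) (trans (n%n≡0 q) (sym (0%n≡0 q)))))
      where
      0%n≡0 : ∀ n .{{_ : NonZero n}} → 0 % n ≡ 0
      0%n≡0 n = m*n%n≡0 0 n

    isCommutativeRing : IsCommutativeRing _≡_ _⊕_ _⊗_ ⊖_ [ 0 ] [ 1 ]
    isCommutativeRing = record
      { isRing = record
        { +-isAbelianGroup = record
          { isGroup = record
            { isMonoid = record
              { isSemigroup = record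
                { isMagma = record { isEquivalence = isEquivalence ; ∙-cong = cong₂ _⊕_ }
                ; assoc = λ a b c → trans ([]-+ˡ _ c) (trans (cong [_] (+-assoc (toℕ a) (toℕ b) (toℕ c))) (sym ([]-+ʳ a _))) }
              ; identity = ⊕-identityˡ , λ a → trans (⊕-comm a _) (⊕-identityˡ a) }
            ; inverse = ⊖-inverseˡ , λ a → trans (⊕-comm a _) (⊖-inverseˡ a)
            ; ⁻¹-cong = cong ⊖_ }
          ; comm = ⊕-comm }
        ; *-cong = cong₂ _⊗_
        ; *-assoc = λ a b c → trans ([]-*ˡ _ c) (trans (cong [_] (*-assoc (toℕ a) (toℕ b) (toℕ c))) (sym ([]-*ʳ a _)))
        ; *-identity = ⊗-identityˡ , λ a → trans (⊗-comm a _) (⊗-identityˡ a)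
        ; distrib = distribˡ , λ a b c → trans (⊗-comm _ a) (trans (distribˡ a b c) (cong₂ _⊕_ (⊗-comm a b) (⊗-comm a c))) }
      ; *-comm = ⊗-comm }
      where
      distribˡ : ∀ a b c → a ⊗ (b ⊕ c) ≡ (a ⊗ b) ⊕ (a ⊗ c)
      distribˡ a b c = trans ([]-*ʳ a _) (trans (cong [_] (*-distribˡ-+ (toℕ a) (toℕ b) (toℕ c))) (sym ([]-+ _ _)))

    prime-domain : FinDomain q
    prime-domain = record
      { isCommutativeRing = isCommutativeRing
      ; 1≢0 = λ e → 1+n≢0 (trans (sym (m<n⇒m%n≡m (nonTrivial⇒n>1 q))) (trans (sym (toℕ-[] 1)) (trans (cong toℕ e) (trans (toℕ-[] 0) (m*n%n≡0 0 q)))))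
      ; no-zero-div = λ x y e → zero-div x y (euclidsLemma (toℕ x) (toℕ y) q-prime
          (m%n≡0⇒n∣m _ q (trans (sym (toℕ-[] _)) (trans (cong toℕ e) (trans (toℕ-[] 0) (m*n%n≡0 0 q)))))) }
      where
      divisible⇒0 : ∀ x → q ∣ toℕ x → x ≡ [ 0 ]
      divisible⇒0 x d = toℕ-injective (trans (sym (m<n⇒m%n≡m (toℕ<n x))) (trans (n∣m⇒m%n≡0 _ q d) (sym (trans (toℕ-[] 0) (m*n%n≡0 0 q)))))
      zero-div : ∀ x y → q ∣ toℕ x ⊎ q ∣ toℕ y → x ≡ [ 0 ] ⊎ y ≡ [ 0 ]
      zero-div x y (inj₁ d) = inj₁ (divisible⇒0 x d)
      zero-div x y (inj₂ d) = inj₂ (divisible⇒0 y d)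

-- A prime between x and 4x for powers of two x, by Chebyshev-type bounds on lcm(1, ..., n).

module PrimeGaps where

  open import Data.Nat
  open import Data.Nat.Properties
  open import Data.Nat.Divisibility
  open import Data.Nat.LCM
  open import Data.Nat.Primality
  open import Data.Nat.Solver using (module +-*-Solver)
  open import Data.Product using (Σ; _×_; _,_; proj₁; proj₂)
  open import Data.Sum using (inj₁; inj₂)
  open import Data.Empty using (⊥-elim)
  open import Relation.Nullary
  open import Relation.Nullary.Decidable using (_×-dec_)
  open import Relation.Binary.PropositionalEquality
  open +-*-Solver using (solve; _:+_; _:*_; _:=_; con)

  ^-distribʳ-* : ∀ n a b → (a * b) ^ n ≡ a ^ n * b ^ n
  ^-distribʳ-* zero a b = refl
  ^-distribʳ-* (suc n) a b = trans (cong (a * b *_) (^-distribʳ-* n a b))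
    (solve 4 (λ a b x y → a :* b :* (x :* y) := a :* x :* (b :* y)) refl a b (a ^ n) (b ^ n))

  -- tri a b is the binomial coefficient (a + b) choose a.
  tri : ℕ → ℕ → ℕ
  tri zero b = 1
  tri (suc a) zero = 1
  tri (suc a) (suc b) = tri a (suc b) + tri (suc a) b

  tri-factorial : ∀ a b → tri a b * (a ! * b !) ≡ (a + b) !
  tri-factorial zero b = trans (+-identityʳ _) (+-identityʳ _)
  tri-factorial (suc a) zero = trans (+-identityʳ _) (trans (*-identityʳ _) (cong _! (cong suc (sym (+-identityʳ a)))))
  tri-factorial (suc a) (suc b) = begin
    (x + y) * (suc a ! * suc b !)
      ≡⟨ solve 6 (λ x y a b p r → (x :+ y) :* ((a :* p) :* (b :* r)) := a :* (x :* (p :* (b :* r))) :+ b :* (y :* ((a :* p) :* r)))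
          refl x y (suc a) (suc b) (a !) (b !) ⟩
    suc a * (x * (a ! * suc b !)) + suc b * (y * (suc a ! * b !))
      ≡⟨ cong₂ (λ u v → suc a * u + suc b * v) (tri-factorial a (suc b)) (trans (tri-factorial (suc a) b) (cong _! (sym (+-suc a b)))) ⟩
    suc a * (a + suc b) ! + suc b * (a + suc b) !   ≡⟨ sym (*-distribʳ-+ ((a + suc b) !) (suc a) (suc b)) ⟩
    (suc a + suc b) ! ∎
    where
    open ≡-Reasoning
    x = tri a (suc b)
    y = tri (suc a) b

  cancel-! : ∀ a b x y → x * (a ! * b !) ≡ y * (a ! * b !) → x ≡ y
  cancel-! a b x y = *-cancelʳ-≡ x y (a ! * b !) {{a !* b !≢0}}

  absorbˡ : ∀ a b → suc (a + b) * tri a b ≡ suc a * tri (suc a) b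
  absorbˡ a b = cancel-! a b _ _ (begin
    suc (a + b) * tri a b * (a ! * b !)      ≡⟨ *-assoc (suc (a + b)) (tri a b) _ ⟩
    suc (a + b) * (tri a b * (a ! * b !))    ≡⟨ cong (suc (a + b) *_) (tri-factorial a b) ⟩
    (suc a + b) !                            ≡⟨ sym (tri-factorial (suc a) b) ⟩
    tri (suc a) b * (suc a * a ! * b !)
      ≡⟨ solve 4 (λ t s p r → t :* (s :* p :* r) := s :* t :* (p :* r)) refl (tri (suc a) b) (suc a) (a !) (b !) ⟩
    suc a * tri (suc a) b * (a ! * b !) ∎)
    where open ≡-Reasoning

  tri-sym : ∀ a b → tri a b ≡ tri b a
  tri-sym zero zero = refl
  tri-sym zero (suc b) = refl
  tri-sym (suc a) zero = refl
  tri-sym (suc a) (suc b) = trans (+-comm (tri a (suc b)) _) (cong₂ _+_ (tri-sym (suc a) b) (tri-sym a (suc b)))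

  absorbʳ : ∀ a b → suc (a + b) * tri a b ≡ suc b * tri a (suc b)
  absorbʳ a b = trans (cong₂ (λ u v → suc u * v) (+-comm a b) (tri-sym a b))
    (trans (absorbˡ b a) (cong (suc b *_) (tri-sym (suc b) a)))

  tri-pos : ∀ a b → 1 ≤ tri a b
  tri-pos zero b = ≤-refl
  tri-pos (suc a) zero = ≤-refl
  tri-pos (suc a) (suc b) = ≤-trans (tri-pos a (suc b)) (m≤m+n _ _)

  tri≤2^ : ∀ a b → tri a b ≤ 2 ^ (a + b)
  tri≤2^ zero b = m^n>0 2 b
  tri≤2^ (suc a) zero = m^n>0 2 (suc a + 0)
  tri≤2^ (suc a) (suc b) = ≤-trans (+-mono-≤ (tri≤2^ a (suc b)) (≤-trans (tri≤2^ (suc a) b) (≤-reflexive (cong (2 ^_) (sym (+-suc a b))))))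
    (≤-reflexive (cong (2 ^ (a + suc b) +_) (sym (+-identityʳ _))))

  leib : ℕ → ℕ → ℕ
  leib a b = suc (a + b) * tri a b

  -- Leibniz' harmonic triangle: 1/leib a b = 1/leib (a+1) b + 1/leib a (b+1), cleared of denominators.
  leib-identity : ∀ a b → leib a b * (leib (suc a) b + leib a (suc b)) ≡ leib (suc a) b * leib a (suc b)
  leib-identity a b = begin
    c * (suc (suc a + b) * X + suc (a + suc b) * Y)   ≡⟨ cong (λ n → c * (suc (suc (a + b)) * X + suc n * Y)) (+-suc a b) ⟩
    c * (N * X + N * Y)                               ≡⟨ solve 4 (λ c n x y → c :* (n :* x :+ n :* y) := n :* (x :* c :+ y :* c)) refl c N X Y ⟩
    N * (X * c + Y * c)                               ≡⟨ cong₂ (λ u v → N * (X * u + Y * v)) (absorbʳ a b) (absorbˡ a b) ⟩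
    N * (X * (suc b * Y) + Y * (suc a * X))
      ≡⟨ solve 4 (λ a b x y → (con 1 :+ (con 1 :+ (a :+ b))) :* (x :* ((con 1 :+ b) :* y) :+ y :* ((con 1 :+ a) :* x))
          := ((con 1 :+ (con 1 :+ (a :+ b))) :* x) :* ((con 1 :+ (con 1 :+ (a :+ b))) :* y)) refl a b X Y ⟩
    N * X * (N * Y)                                   ≡⟨ cong (λ n → N * X * (suc n * Y)) (sym (+-suc a b)) ⟩
    suc (suc a + b) * X * (suc (a + suc b) * Y)       ∎
    where
    open ≡-Reasoning
    c = leib a b
    N = suc (suc (a + b))
    X = tri (suc a) b
    Y = tri a (suc b)

  leib-pos : ∀ a b → NonZero (leib a b)
  leib-pos a b = m*n≢0 (suc (a + b)) (tri a b) {{_}} {{>-nonZero (tri-pos a b)}}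

  -- By the harmonic triangle, L / leib (a+1) b is the difference of L / leib a b and L / leib a
  -- (b+1), which are integers by induction on a; the triangle starts from leib 0 b = b + 1.
  leib∣ : ∀ a b {L} → (∀ j → 1 ≤ j → j ≤ suc (a + b) → j ∣ L) → leib a b ∣ L
  leib∣ zero b {L} h = subst (_∣ L) (sym (*-identityʳ (suc b))) (h (suc b) (s≤s z≤n) ≤-refl)
  leib∣ (suc a) b {L} h with leib∣ a b (λ j 1≤j le → h j 1≤j (m≤n⇒m≤1+n le))
    | leib∣ a (suc b) (λ j 1≤j le → h j 1≤j (≤-trans le (≤-reflexive (cong suc (+-suc a b)))))
  ... | divides γ eγ | divides β eβ = ∣m+n∣m⇒∣n (subst (x ∣_) (sym main) (m∣m*n γ)) (m∣m*n β)
    where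
    c = leib a b
    y = leib a (suc b)
    x = leib (suc a) b
    main : x * β + L ≡ x * γ
    main = *-cancelʳ-≡ _ _ (c * y) {{m*n≢0 c y {{leib-pos a b}} {{leib-pos a (suc b)}}}} (begin
      (x * β + L) * (c * y)              ≡⟨ solve 5 (λ x β L c y → (x :* β :+ L) :* (c :* y) := c :* (x :* (β :* y) :+ L :* y)) refl x β L c y ⟩
      c * (x * (β * y) + L * y)          ≡⟨ cong (λ u → c * (x * u + L * y)) (sym eβ) ⟩
      c * (x * L + L * y)                ≡⟨ solve 4 (λ c x L y → c :* (x :* L :+ L :* y) := L :* (c :* (x :+ y))) refl c x L y ⟩
      L * (c * (x + y))                  ≡⟨ cong (L *_) (leib-identity a b) ⟩
      L * (x * y)                        ≡⟨ cong (_* (x * y)) eγ ⟩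
      γ * c * (x * y)                    ≡⟨ solve 4 (λ γ c x y → γ :* c :* (x :* y) := x :* γ :* (c :* y)) refl γ c x y ⟩
      x * γ * (c * y) ∎)
      where open ≡-Reasoning

  L : ℕ → ℕ
  L zero = 1
  L (suc n) = lcm (L n) (suc n)

  ∣L : ∀ n j → 1 ≤ j → j ≤ n → j ∣ L n
  ∣L zero (suc j) _ ()
  ∣L (suc n) j 1≤j le with m≤n⇒m<n∨m≡n le
  ... | inj₁ lt = ∣-trans (∣L n j 1≤j (s≤s⁻¹ lt)) (m∣lcm[m,n] (L n) (suc n))
  ... | inj₂ refl = n∣lcm[m,n] (L n) (suc n)

  L-least : ∀ n {Z} → (∀ j → 1 ≤ j → j ≤ n → j ∣ Z) → L n ∣ Z
  L-least zero h = 1∣ _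
  L-least (suc n) h = lcm-least (L-least n (λ j 1≤j le → h j 1≤j (m≤n⇒m≤1+n le))) (h (suc n) (s≤s z≤n) ≤-refl)

  L-pos : ∀ n → 1 ≤ L n
  L-pos n = n≢0⇒n>0 λ e → Data.Nat.Properties.1+n≢0 {pred (n !)} (trans (suc-pred (n !) {{n !≢0}}) (0∣⇒≡0 (subst (_∣ n !) e (L-least n (λ j 1≤j le → j∣n! n j 1≤j le)))))
    where
    j∣n! : ∀ n j → 1 ≤ j → j ≤ n → j ∣ n !
    j∣n! zero (suc j) _ ()
    j∣n! (suc n) j 1≤j le with m≤n⇒m<n∨m≡n le
    ... | inj₁ lt = ∣-trans (j∣n! n j 1≤j (s≤s⁻¹ lt)) (n∣m*n (suc n))
    ... | inj₂ refl = m∣m*n (n !)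

  L-mono : ∀ {m n} → m ≤ n → L m ≤ L n
  L-mono {m} {n} le = ∣⇒≤ {{>-nonZero (L-pos n)}} (L-least m (λ j 1≤j le′ → ∣L n j 1≤j (≤-trans le′ le)))

  -- Multiplied by a! b! n! with n = a + b + 1, both sides are (2n)!. The right side displays n + 1
  -- + a as a divisor, which is what `L-double∣` needs for the numbers above n.
  trinomial : ∀ a b → leib a b * tri (suc (a + b)) (suc (a + b)) ≡
    (suc (suc (a + b)) + a) * (tri a (suc (a + b)) * tri b (suc (suc (a + b)) + a))
  trinomial a b = *-cancelʳ-≡ _ _ (a ! * (b ! * n !)) {{m*n≢0 (a !) (b ! * n !) {{a !≢0}} {{b !* n !≢0}}}} (begin
    n * tri a b * tri n n * (a ! * (b ! * n !))
      ≡⟨ solve 6 (λ n t u a b c → n :* t :* u :* (a :* (b :* c)) := u :* (n :* (t :* (a :* b)) :* c)) refl n (tri a b) (tri n n) (a !) (b !) (n !) ⟩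
    tri n n * (n * (tri a b * (a ! * b !)) * n !)        ≡⟨ cong (λ z → tri n n * (n * z * n !)) (tri-factorial a b) ⟩
    tri n n * (n ! * n !)                                ≡⟨ tri-factorial n n ⟩
    (n + n) !                                            ≡⟨ cong _! (solve 2 (λ a b → (con 1 :+ (a :+ b)) :+ (con 1 :+ (a :+ b)) := b :+ (con 1 :+ (con 1 :+ (a :+ b)) :+ a)) refl a b) ⟩
    (b + m) !                                            ≡⟨ sym (tri-factorial b m) ⟩
    tri b m * (b ! * (m * (n + a) !))                    ≡⟨ cong (λ z → tri b m * (b ! * (m * z))) (trans (cong _! (+-comm n a)) (sym (tri-factorial a n))) ⟩
    tri b m * (b ! * (m * (tri a n * (a ! * n !))))
      ≡⟨ solve 6 (λ t b m u a c → t :* (b :* (m :* (u :* (a :* c)))) := m :* (u :* t) :* (a :* (b :* c))) refl (tri b m) (b !) m (tri a n) (a !) (n !) ⟩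
    m * (tri a n * tri b m) * (a ! * (b ! * n !)) ∎)
    where
    open ≡-Reasoning
    n = suc (a + b)
    m = suc n + a

  -- A number j in (n, 2n] is n + 1 + a with a + b + 1 = n for some b. By `trinomial` it divides
  -- leib a b times the central binomial coefficient, and leib a b divides `L n`.
  L-double∣ : ∀ n → L (suc n + suc n) ∣ L (suc n) * tri (suc n) (suc n)
  L-double∣ n′ = L-least (n + n) divides-all
    where
    n = suc n′
    upper : ∀ a b → a + b ≡ n′ → suc n + a ∣ L n * tri n n
    upper a b refl with leib∣ a b {L n} (∣L n)
    ... | divides g e = divides (g * (tri a n * tri b m)) (begin
      L n * tri n n                       ≡⟨ cong (_* tri n n) e ⟩
      g * leib a b * tri n n              ≡⟨ *-assoc g (leib a b) _ ⟩
      g * (leib a b * tri n n)            ≡⟨ cong (g *_) (trinomial a b) ⟩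
      g * (m * (tri a n * tri b m))       ≡⟨ solve 3 (λ g m t → g :* (m :* t) := g :* t :* m) refl g m (tri a n * tri b m) ⟩
      g * (tri a n * tri b m) * m ∎)
      where
      open ≡-Reasoning
      m = suc n + a
    divides-all : ∀ j → 1 ≤ j → j ≤ n + n → j ∣ L n * tri n n
    divides-all j 1≤j le with j ≤? n
    ... | yes j≤n = ∣-trans (∣L n j 1≤j j≤n) (m∣m*n (tri n n))
    ... | no j≰n with m≤n⇒∃[o]m+o≡n (≰⇒> j≰n)
    ...   | a , refl = upper a (n′ ∸ a) (m+[n∸m]≡n (s≤s⁻¹ (+-cancelˡ-≤ n (suc a) n (≤-trans (≤-reflexive (+-suc n a)) le))))

  L-double : ∀ n → L (suc n + suc n) ≤ L (suc n) * 4 ^ suc n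
  L-double n = ≤-trans (∣⇒≤ {{m*n≢0 (L (suc n)) _ {{>-nonZero (L-pos (suc n))}} {{>-nonZero (tri-pos (suc n) (suc n))}}}} (L-double∣ n))
    (*-monoʳ-≤ (L (suc n)) (≤-trans (tri≤2^ (suc n) (suc n)) (≤-reflexive (begin-equality
      2 ^ (suc n + suc n)   ≡⟨ ^-distribˡ-+-* 2 (suc n) (suc n) ⟩
      2 ^ suc n * 2 ^ suc n ≡⟨ sym (^-distribʳ-* (suc n) 2 2) ⟩
      4 ^ suc n ∎))))
    where
    open ≤-Reasoning

  L-pow : ∀ i → L (2 ^ i) ≤ 4 ^ (2 ^ i)
  L-pow zero = s≤s z≤n
  L-pow (suc i) = begin
    L (2 ^ i + (2 ^ i + 0))       ≡⟨ cong L (trans (cong (2 ^ i +_) (+-identityʳ _)) (cong₂ _+_ (sym p≡) (sym p≡))) ⟩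
    L (suc p + suc p)             ≤⟨ L-double p ⟩
    L (suc p) * 4 ^ suc p         ≡⟨ cong (λ n → L n * 4 ^ n) p≡ ⟩
    L (2 ^ i) * 4 ^ (2 ^ i)       ≤⟨ *-monoˡ-≤ (4 ^ (2 ^ i)) (L-pow i) ⟩
    4 ^ (2 ^ i) * 4 ^ (2 ^ i)     ≡⟨ sym (^-distribˡ-+-* 4 (2 ^ i) (2 ^ i)) ⟩
    4 ^ (2 ^ i + 2 ^ i)           ≡⟨ cong (λ n → 4 ^ (2 ^ i + n)) (sym (+-identityʳ _)) ⟩
    4 ^ (2 ^ suc i) ∎
    where
    open ≤-Reasoning
    p = pred (2 ^ i)
    p≡ : suc p ≡ 2 ^ i
    p≡ = suc-pred (2 ^ i) {{>-nonZero (m^n>0 2 i)}}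

  -- Consecutive diagonal entries have ratio 2 (2k + 3) / (k + 1), which is at least 4.
  leib-diagonal : ∀ k → 4 ^ k ≤ leib k k
  leib-diagonal zero = ≤-refl
  leib-diagonal (suc k) = *-cancelˡ-≤ (suc k) (begin
    suc k * (4 * 4 ^ k)                   ≤⟨ *-monoʳ-≤ (suc k) (*-monoʳ-≤ 4 (leib-diagonal k)) ⟩
    suc k * (4 * D)                       ≡⟨ solve 2 (λ k d → (con 1 :+ k) :* (con 4 :* d) := (con 2 :* (con 1 :+ (k :+ (con 1 :+ k)))) :* d) refl k D ⟩
    2 * suc (k + suc k) * D               ≤⟨ *-monoˡ-≤ D (*-monoʳ-≤ 2 (n≤1+n (suc (k + suc k)))) ⟩
    2 * suc (suc k + suc k) * D           ≡⟨ solve 2 (λ n d → (con 2 :* n) :* d := n :* (d :+ d)) refl (suc (suc k + suc k)) D ⟩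
    suc (suc k + suc k) * (D + D)         ≡⟨ cong₂ (λ u v → suc (suc k + suc k) * (u + v)) (absorbʳ k k) (absorbˡ k k) ⟩
    suc (suc k + suc k) * (suc k * tri k (suc k) + suc k * tri (suc k) k)
      ≡⟨ solve 4 (λ n s x y → n :* (s :* x :+ s :* y) := s :* (n :* (x :+ y))) refl (suc (suc k + suc k)) (suc k) (tri k (suc k)) (tri (suc k) k) ⟩
    suc k * leib (suc k) (suc k) ∎)
    where
    open ≤-Reasoning
    D = leib k k

  -- A number above x is composite here. Its smaller factor is at most s because N ≤ s², so one copy
  -- of `L s` absorbs it; the cofactor is at most half the number, which lowers c by one.
  smooth∣ : ∀ x s N → (∀ p → x < p → p ≤ N → ¬ Prime p) → N ≤ s * s → ∀ c m → 1 ≤ m → m ≤ 2 ^ c * x → m ≤ N → m ∣ L x * L s ^ c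
  smooth∣ x s N no-prime N≤s² zero m 1≤m m≤ _ = ∣-trans (∣L x m 1≤m (≤-trans m≤ (≤-reflexive (+-identityʳ x)))) (m∣m*n 1)
  smooth∣ x s N no-prime N≤s² (suc c) m 1≤m m≤ m≤N with m ≤? x
  ... | yes m≤x = ∣-trans (∣L x m 1≤m m≤x) (m∣m*n _)
  ... | no m≰x with m | ≰⇒> m≰x
  ...   | suc zero | _ = 1∣ _
  ...   | m@(suc (suc _)) | x<m with ¬prime⇒composite (no-prime m x<m m≤N)
  ...     | composite {d} d<m (divides e m≡ed) = factor-case (≤-total d e)
    where
    e>1 : 1 < e
    e>1 = ≰⇒> λ { z≤n → 1+n≢0 m≡ed ; (s≤s z≤n) → <-irrefl (sym (trans m≡ed (+-identityʳ d))) d<m }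
    split : ∀ u v → 1 < u → u * u ≤ m → m ≡ u * v → m ∣ L x * L s ^ suc c
    split u v 1<u u²≤m eq = subst (_∣ L x * L s ^ suc c) (sym eq) (∣-trans
      (*-pres-∣ (∣L s u (<⇒≤ 1<u) u≤s) (smooth∣ x s N no-prime N≤s² c v 1≤v v≤ (≤-trans v≤m m≤N)))
      (∣-reflexive (solve 3 (λ a b c → a :* (b :* c) := b :* (a :* c)) refl (L s) (L x) (L s ^ c))))
      where
      u≤s : u ≤ s
      u≤s = ≮⇒≥ λ s<u → <⇒≱ (*-mono-< s<u s<u) (≤-trans u²≤m (≤-trans m≤N N≤s²))
      1≤v : 1 ≤ v
      1≤v = ≰⇒> λ { z≤n → 1+n≢0 (trans eq (*-zeroʳ u)) }
      2v≤m : 2 * v ≤ m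
      2v≤m = ≤-trans (*-monoˡ-≤ v 1<u) (≤-reflexive (sym eq))
      v≤m : v ≤ m
      v≤m = ≤-trans (m≤n*m v 2) 2v≤m
      v≤ : v ≤ 2 ^ c * x
      v≤ = *-cancelˡ-≤ 2 (≤-trans 2v≤m (≤-trans m≤ (≤-reflexive (*-assoc 2 (2 ^ c) x))))
    factor-case : _ → _
    factor-case (inj₁ d≤e) = split d e (nonTrivial⇒n>1 d) (≤-trans (*-monoˡ-≤ d d≤e) (≤-reflexive (sym m≡ed))) (trans m≡ed (*-comm e d))
    factor-case (inj₂ e≤d) = split e d e>1 (≤-trans (*-monoʳ-≤ e e≤d) (≤-reflexive (sym m≡ed))) m≡ed

  halve : ∀ i → Σ ℕ λ j → 2 + i ≤ j + j × j + j ≤ 3 + i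
  halve zero = 1 , ≤-refl , n≤1+n 2
  halve (suc zero) = 2 , n≤1+n 3 , ≤-refl
  halve (suc (suc i)) with halve i
  ... | j , lo , hi = suc j , s≤s (≤-trans (s≤s lo) (≤-reflexive (sym (+-suc j j)))) ,
    s≤s (≤-trans (≤-reflexive (+-suc j j)) (s≤s hi))

  -- If all primes up to 4x were at most x, then lcm(1..4x) would divide lcm(1..x) lcm(1..s)²
  -- with s² ≥ 4x, and would be smaller than the central binomial coefficients allow.
  prime-between : ∀ i → 8 ≤ i → Σ ℕ λ p → Prime p × 2 ^ i < p × p ≤ 2 ^ (2 + i)
  prime-between i 8≤i with anyUpTo? (λ p → prime? p ×-dec 2 ^ i <? p) (suc (2 ^ (2 + i)))
  ... | yes (p , p≤ , pr , lt) = p , pr , lt , s≤s⁻¹ p≤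
  ... | no none = ⊥-elim (<⇒≱ (m<m+n 1 {1} (s≤s z≤n)) (≤-trans 2s≤2 2s≤1))
    where
    j = proj₁ (halve i)
    x = 2 ^ i
    s = 2 ^ j
    N = 2 ^ (2 + i)
    no-prime : ∀ p → x < p → p ≤ N → ¬ Prime p
    no-prime p lt le pr = none (p , s≤s le , pr , lt)
    N≤s² : N ≤ s * s
    N≤s² = ≤-trans (^-monoʳ-≤ 2 (proj₁ (proj₂ (halve i)))) (≤-reflexive (^-distribˡ-+-* 2 j j))
    N≡4x : N ≡ 2 ^ 2 * x
    N≡4x = ^-distribˡ-+-* 2 2 i
    upper : L N ≤ 4 ^ (x + (s + s))
    upper = begin
      L N                        ≤⟨ ∣⇒≤ {{m*n≢0 (L x) (L s ^ 2) {{>-nonZero (L-pos x)}} {{m^n≢0 (L s) 2 {{>-nonZero (L-pos s)}}}}}}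
                                     (L-least N (λ m 1≤m m≤N → smooth∣ x s N no-prime N≤s² 2 m 1≤m (≤-trans m≤N (≤-reflexive N≡4x)) m≤N)) ⟩
      L x * L s ^ 2              ≤⟨ *-mono-≤ (L-pow i) (^-monoˡ-≤ 2 (L-pow j)) ⟩
      4 ^ x * (4 ^ s) ^ 2        ≡⟨ cong (λ z → 4 ^ x * (4 ^ s * z)) (*-identityʳ (4 ^ s)) ⟩
      4 ^ x * (4 ^ s * 4 ^ s)    ≡⟨ cong (4 ^ x *_) (sym (^-distribˡ-+-* 4 s s)) ⟩
      4 ^ x * 4 ^ (s + s)        ≡⟨ sym (^-distribˡ-+-* 4 x (s + s)) ⟩
      4 ^ (x + (s + s)) ∎
      where open ≤-Reasoning
    p = pred (2 * x)
    p≡ : suc p ≡ 2 * x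
    p≡ = suc-pred (2 * x) {{m*n≢0 2 x {{_}} {{>-nonZero (m^n>0 2 i)}}}}
    lower : 4 ^ p ≤ L N
    lower = begin
      4 ^ p                      ≤⟨ leib-diagonal p ⟩
      leib p p                   ≤⟨ ∣⇒≤ {{>-nonZero (L-pos (suc (p + p)))}} (leib∣ p p (∣L (suc (p + p)))) ⟩
      L (suc (p + p))            ≤⟨ L-mono (≤-trans (n≤1+n _) (≤-reflexive (trans (cong suc (sym (+-suc p p)))
                                     (trans (cong₂ _+_ p≡ p≡) (trans (cong (2 * x +_) (sym (+-identityʳ (2 * x)))) (sym (trans N≡4x (*-assoc 2 2 x)))))))) ⟩
      L N ∎
      where open ≤-Reasoning
    p≤ : p ≤ x + (s + s)
    p≤ = ≮⇒≥ λ lt → <⇒≱ (^-monoʳ-< 4 (s≤s (s≤s z≤n)) lt) (≤-trans lower upper)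
    x≤ : x ≤ suc (s + s)
    x≤ = +-cancelˡ-≤ x _ _ (≤-trans (≤-reflexive (trans (cong (x +_) (sym (+-identityʳ x))) (sym p≡))) (≤-trans (s≤s p≤) (≤-reflexive (sym (+-suc x (s + s))))))
    j+2≤i : 2 + j ≤ i
    j+2≤i = ≮⇒≥ λ lt → <⇒≱ (s≤s 8≤i) (+-cancelʳ-≤ i (suc i) 8 (begin
      suc i + i              ≤⟨ +-mono-≤ lt (s≤s⁻¹ lt) ⟩
      (2 + j) + (1 + j)      ≡⟨ solve 1 (λ j → (con 2 :+ j) :+ (con 1 :+ j) := con 3 :+ (j :+ j)) refl j ⟩
      3 + (j + j)            ≤⟨ +-monoʳ-≤ 3 (proj₂ (proj₂ (halve i))) ⟩
      6 + i                  ≤⟨ m≤n+m (6 + i) 2 ⟩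
      8 + i ∎))
      where open ≤-Reasoning
    4s≤x : 2 ^ 2 * s ≤ x
    4s≤x = ≤-trans (≤-reflexive (sym (^-distribˡ-+-* 2 2 j))) (^-monoʳ-≤ 2 j+2≤i)
    2s≤1 : s + s ≤ 1
    2s≤1 = +-cancelʳ-≤ (s + s) (s + s) 1 (≤-trans (≤-reflexive (solve 1 (λ s → (s :+ s) :+ (s :+ s) := con 4 :* s) refl s)) (≤-trans 4s≤x x≤))
    2s≤2 : 1 + 1 ≤ s + s
    2s≤2 = +-mono-≤ (m^n>0 2 j) (m^n>0 2 j)

  bracket : ∀ B n → 2 ≤ B → 1 ≤ n → Σ ℕ λ i → B ^ i ≤ n × n < B ^ suc i
  bracket B (suc zero) 2≤B _ = 0 , ≤-refl , ≤-trans 2≤B (≤-reflexive (sym (*-identityʳ B)))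
  bracket B (suc n@(suc _)) 2≤B _ with bracket B n 2≤B (s≤s z≤n)
  ... | i , lo , hi with suc n <? B ^ suc i
  ...   | yes lt = i , m≤n⇒m≤1+n lo , lt
  ...   | no ge = suc i , ≮⇒≥ ge , ≤-<-trans hi (^-monoʳ-< B 2≤B {suc i} {suc (suc i)} ≤-refl)

  prime-root : ∀ d Q → 1 ≤ d → Σ ℕ λ N → ∀ n → N ≤ n →
    Σ ℕ λ q → Prime q × Q ≤ q × q ^ d ≤ n × n ≤ (8 * q) ^ d
  prime-root d Q 1≤d = (2 ^ d) ^ I , λ n N≤n → find n N≤n (bracket (2 ^ d) n 2≤B (≤-trans (m^n>0 (2 ^ d) {{m^n≢0 2 d}} I) N≤n))
    where
    -- 8 meets the hypothesis of `prime-between`, Q forces q ≥ 2^Q ≥ Q, and 2 is the width of the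
    -- interval. With 2^(di) ≤ n < 2^(d(i+1)), the prime is taken in (2^(i-2), 2^i], so that q^d ≤ n
    -- and 2^(i+1) ≤ 8q.
    I = 2 + (8 + Q)
    2≤B : 2 ≤ 2 ^ d
    2≤B = ^-monoʳ-≤ 2 1≤d
    Q≤2^ : ∀ Q → Q ≤ 2 ^ Q
    Q≤2^ zero = z≤n
    Q≤2^ (suc Q) = ≤-trans (+-mono-≤ (m^n>0 2 Q) (Q≤2^ Q)) (≤-reflexive (cong (2 ^ Q +_) (sym (+-identityʳ _))))
    swap-^ : ∀ a b → (2 ^ a) ^ b ≡ (2 ^ b) ^ a
    swap-^ a b = trans (^-*-assoc 2 a b) (trans (cong (2 ^_) (*-comm a b)) (sym (^-*-assoc 2 b a)))
    find : ∀ n → (2 ^ d) ^ I ≤ n → Σ ℕ (λ i → (2 ^ d) ^ i ≤ n × n < (2 ^ d) ^ suc i) →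
      Σ ℕ λ q → Prime q × Q ≤ q × q ^ d ≤ n × n ≤ (8 * q) ^ d
    find n N≤n (i , lo , hi) with m≤n⇒∃[o]m+o≡n I≤i
      where
      I≤i : I ≤ i
      I≤i = ≮⇒≥ λ lt → <⇒≱ hi (≤-trans (^-monoʳ-≤ (2 ^ d) {{m^n≢0 2 d}} lt) N≤n)
    ... | o , refl with prime-between (8 + Q + o) (≤-trans (m≤m+n 8 Q) (m≤m+n (8 + Q) o))
    ...   | q , pr , lt , le = q , pr , Q≤q , ≤-trans (^-monoˡ-≤ d le) (≤-trans (≤-reflexive (sym (swap-^ d (I + o)))) lo) ,
            ≤-trans (<⇒≤ hi) (≤-trans (≤-reflexive (swap-^ d (suc (I + o)))) (^-monoˡ-≤ d
              (≤-trans (≤-reflexive (^-distribˡ-+-* 2 3 (8 + Q + o))) (*-monoʳ-≤ 8 (<⇒≤ lt)))))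
      where
      Q≤q : Q ≤ q
      Q≤q = ≤-trans (Q≤2^ Q) (≤-trans (^-monoʳ-≤ 2 (≤-trans (m≤n+m Q 8) (m≤m+n (8 + Q) o))) (<⇒≤ lt))

-- θ between two consecutive layers of a search tree that span many edges.

module DenseLayers where

  open import Defs
  open FiniteSums
  open Shattering using (does-true; does-false)
  open import Data.Nat hiding (_≟_)
  open import Data.Nat.Properties hiding (suc-injective; _≟_)
  open import Data.Fin using (Fin; zero; suc)
  open import Data.Fin.Properties using (_≟_; any?)
  open import Data.Bool using (Bool; true; false; _∧_; _∨_; not)
  import Data.Bool.Properties as Bool
  open import Data.List using (List; []; _∷_; length; map; _++_; applyUpTo)
  open import Data.List.Properties using (length-++; length-map; length-applyUpTo)
  open import Data.List.Relation.Unary.All as All using (All; []; _∷_)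
  import Data.List.Relation.Unary.All.Properties as All
  open import Data.List.Relation.Unary.Any using (here; there)
  open import Data.List.Membership.Propositional using (_∈_; _∉_)
  open import Data.List.Membership.Propositional.Properties using (∈-applyUpTo⁺; ∈-++⁺ˡ; ∈-++⁺ʳ)
  open import Data.Product using (Σ; _×_; _,_; proj₂)
  open import Data.Sum using (_⊎_; inj₁; inj₂)
  open import Data.Empty using (⊥-elim)
  open import Function using (_∘_)
  open import Relation.Nullary
  open import Relation.Nullary.Decidable using (dec-false; _×-dec_)
  open import Relation.Binary.PropositionalEquality
  open import Data.Nat.Solver using (module +-*-Solver)

  ∧-true : ∀ {a b} → a ≡ true → b ≡ true → (a ∧ b) ≡ true
  ∧-true refl refl = refl

  ∧-left : ∀ {a b} → (a ∧ b) ≡ true → a ≡ true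
  ∧-left {true} _ = refl

  ∧-right : ∀ {a b} → (a ∧ b) ≡ true → b ≡ true
  ∧-right {true} e = e

  ∨-case : ∀ {a b} → (a ∨ b) ≡ true → a ≡ true ⊎ b ≡ true
  ∨-case {true} _ = inj₁ refl
  ∨-case {false} e = inj₂ e

  ∨-right : ∀ {a b} → b ≡ true → (a ∨ b) ≡ true
  ∨-right {a} refl = Bool.∨-zeroʳ a

  not-true : ∀ {a} → not a ≡ true → a ≡ false
  not-true {false} _ = refl

  clash : ∀ {a : Bool} {X : Set} → a ≡ true → a ≡ false → X
  clash refl ()

  ¬true⇒false : ∀ {a} → ¬ (a ≡ true) → a ≡ false
  ¬true⇒false {false} _ = refl
  ¬true⇒false {true} h = ⊥-elim (h refl)

  cnt-∧-split : ∀ {n} (P Q : Fin n → Bool) → cnt P ≡ cnt (λ v → P v ∧ Q v) + cnt (λ v → P v ∧ not (Q v))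
  cnt-∧-split {n} P Q = trans (sum-cong n (λ v → split (P v) (Q v))) (sum-+ n _ _)
    where
    split : ∀ a b → ι a ≡ ι (a ∧ b) + ι (a ∧ not b)
    split false b = refl
    split true false = refl
    split true true = refl

  cnt-pos : ∀ {n} (P : Fin n → Bool) i → P i ≡ true → 1 ≤ cnt P
  cnt-pos {n} P i e = ≤-trans (≤-reflexive (sym (ι-true e))) (term≤sum n (ι ∘ P) i)

  pick : ∀ {n} b (Qs : List (Fin n → Bool)) (P : Fin n → Bool) → All (λ Q → cnt (λ v → P v ∧ Q v) ≤ b) Qs →
    length Qs * b < cnt P → Σ (Fin n) λ v → P v ≡ true × All (λ Q → Q v ≡ false) Qs
  pick b [] P _ h with cnt-witness P h
  ... | v , pv = v , pv , []
  pick {n} b (Q ∷ Qs) P (hQ ∷ hQs) h with pick b Qs (λ v → P v ∧ not (Q v))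
      (All.map (λ {Q′} le → ≤-trans (cnt-mono {n} (λ v e → ∧-true (∧-left {P v} (∧-left {P v ∧ not (Q v)} e)) (∧-right {P v ∧ not (Q v)} e))) le) hQs)
      (+-cancelˡ-< b _ _ (<-≤-trans h (≤-trans (≤-reflexive (cnt-∧-split P Q)) (+-monoˡ-≤ _ hQ))))
  ... | v , pv , av = v , ∧-left {P v} pv , not-true (∧-right {P v} pv) ∷ av

  ==-sym : ∀ {n} (x y : Fin n) → (x == y) ≡ (y == x)
  ==-sym x y with x ≟ y
  ... | yes refl = sym (==-refl x)
  ... | no ne = sym (dec-false (y ≟ x) (ne ∘ sym))

  module Cleaning {N : ℕ} (rel : Fin N → Fin N → Bool) (rel-sym : ∀ u v → rel u v ≡ rel v u)
    (rel-irr : ∀ v → rel v v ≡ false) (d : Fin N → ℕ) where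

    deg : (Fin N → Bool) → Fin N → ℕ
    deg S v = cnt (λ u → S u ∧ rel v u)

    weight demand : (Fin N → Bool) → ℕ
    weight S = sumFin N (λ v → ι (S v) * deg S v)
    demand S = sumFin N (λ v → ι (S v) * d v)

    module Remove (S : Fin N → Bool) (v : Fin N) (Sv : S v ≡ true) where
      S′ : Fin N → Bool
      S′ u = S u ∧ not (v == u)

      split : ∀ u → ι (S u) ≡ ι (S′ u) + ι (v == u)
      split u with v ≟ u
      ... | yes refl rewrite Sv = refl
      ... | no _ = trans (cong ι (sym (Bool.∧-identityʳ (S u)))) (sym (+-identityʳ _))

      deg-split : ∀ x → deg S x ≡ deg S′ x + ι (rel x v)
      deg-split x = trans (sum-cong N (λ u → trans (ι-∧ (S u) (rel x u)) (trans (cong (_* ι (rel x u)) (split u))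
          (trans (*-distribʳ-+ (ι (rel x u)) (ι (S′ u)) (ι (v == u))) (cong (_+ ι (v == u) * ι (rel x u)) (sym (ι-∧ (S′ u) (rel x u))))))))
        (trans (sum-+ N _ _) (cong (deg S′ x +_) (sum-delta N v (λ u → ι (rel x u)))))

      sum-split : ∀ (f : Fin N → ℕ) → sumFin N (λ u → ι (S u) * f u) ≡ sumFin N (λ u → ι (S′ u) * f u) + f v
      sum-split f = trans (sum-cong N (λ u → trans (cong (_* f u) (split u)) (*-distribʳ-+ (f u) (ι (S′ u)) (ι (v == u)))))
        (trans (sum-+ N _ _) (cong (sumFin N (λ u → ι (S′ u) * f u) +_) (sum-delta N v f)))

      weight-split : weight S ≡ weight S′ + (deg S v + deg S v)
      weight-split = begin
        weight S                                                             ≡⟨ sum-split (deg S) ⟩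
        sumFin N (λ u → ι (S′ u) * deg S u) + deg S v                        ≡⟨ cong (_+ deg S v) (sum-cong N (λ u → trans (cong (ι (S′ u) *_) (deg-split u)) (*-distribˡ-+ (ι (S′ u)) _ _))) ⟩
        sumFin N (λ u → ι (S′ u) * deg S′ u + ι (S′ u) * ι (rel u v)) + deg S v  ≡⟨ cong (_+ deg S v) (sum-+ N _ _) ⟩
        weight S′ + sumFin N (λ u → ι (S′ u) * ι (rel u v)) + deg S v        ≡⟨ cong (λ z → weight S′ + z + deg S v) back ⟩
        weight S′ + deg S v + deg S v                                        ≡⟨ +-assoc (weight S′) _ _ ⟩
        weight S′ + (deg S v + deg S v) ∎
        where
        open ≡-Reasoning
        back : sumFin N (λ u → ι (S′ u) * ι (rel u v)) ≡ deg S v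
        back = trans (sum-cong N (λ u → trans (cong (λ z → ι (S′ u) * ι z) (rel-sym u v)) (sym (ι-∧ (S′ u) (rel v u)))))
          (sym (trans (deg-split v) (trans (cong (λ z → deg S′ v + ι z) (rel-irr v)) (+-identityʳ _))))

      smaller : cnt S ≡ suc (cnt S′)
      smaller = trans (sum-cong N (λ u → sym (*-identityʳ (ι (S u))))) (trans (sum-split (λ _ → 1))
        (trans (cong (_+ 1) (sum-cong N (λ u → *-identityʳ (ι (S′ u))))) (+-comm _ 1)))

    -- Deleting a vertex v with degree at most d v lowers the weight by at most 2 d v and twice the
    -- demand by exactly 2 d v, so the strict inequality survives; it also keeps the set nonempty,
    -- because an empty set has weight 0.
    clean : ∀ fuel S → cnt S ≤ fuel → demand S + demand S < weight S →
      Σ (Fin N → Bool) λ S′ → (∀ v → S′ v ≡ true → S v ≡ true) × Σ (Fin N) (λ v → S′ v ≡ true) ×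
        (∀ v → S′ v ≡ true → d v < deg S′ v)
    clean fuel S le h with any? (λ v → (S v Bool.≟ true) ×-dec (deg S v ≤? d v))
    ... | no none = S , (λ v e → e) , nonempty , λ v Sv → ≰⇒> (λ le → none (v , Sv , le))
      where
      nonempty : Σ (Fin N) λ v → S v ≡ true
      nonempty with sum-pos-witness N _ (≤-trans (s≤s z≤n) h)
      ... | v , pos = v , pos⇒ pos
        where
        pos⇒ : ∀ {x} → 1 ≤ ι (S v) * x → S v ≡ true
        pos⇒ p with S v
        ... | true = refl
    ... | yes (v , Sv , low) with fuel
    ...   | zero = ⊥-elim (<⇒≱ (≤-reflexive (sym (Remove.smaller S v Sv))) (≤-trans le z≤n))
    ...   | suc fuel′ with clean fuel′ (Remove.S′ S v Sv) (s≤s⁻¹ (≤-trans (≤-reflexive (sym (Remove.smaller S v Sv))) le)) h′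
      where
      open Remove S v Sv using (S′; sum-split; weight-split)
      h′ : demand S′ + demand S′ < weight S′
      h′ = +-cancelʳ-< (d v + d v) _ _ (begin-strict
        demand S′ + demand S′ + (d v + d v)      ≡⟨ +-interchange (demand S′) (demand S′) (d v) (d v) ⟩
        (demand S′ + d v) + (demand S′ + d v)    ≡⟨ sym (cong₂ _+_ (sum-split d) (sum-split d)) ⟩
        demand S + demand S                      <⟨ h ⟩
        weight S                                 ≡⟨ weight-split ⟩
        weight S′ + (deg S v + deg S v)          ≤⟨ +-monoʳ-≤ (weight S′) (+-mono-≤ low low) ⟩
        weight S′ + (d v + d v) ∎)
        where open ≤-Reasoning
    ...     | S″ , sub , ne , min = S″ , (λ u e → ∧-left {S u} (sub u e)) , ne , min

  -- The first summand pays for heavy edges, the slack for light ones. In the slack, suc k + ℓ (suc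
  -- k) bounds the vertices and branches forbidden while ℓ walks are built, and each of them blocks
  -- at most 2 `layerConst ℓ k i` neighbours.
  layerConst : ℕ → ℕ → ℕ → ℕ
  layerSlack : ℕ → ℕ → ℕ → ℕ
  layerConst ℓ k zero = 1
  layerConst ℓ k (suc i) = 2 * layerConst ℓ k i + layerSlack ℓ k i
  layerSlack ℓ k i = (suc k + ℓ * suc k) * (2 * layerConst ℓ k i)

  layerConst-pos : ∀ ℓ k i → 1 ≤ layerConst ℓ k i
  layerConst-pos ℓ k zero = ≤-refl
  layerConst-pos ℓ k (suc i) = ≤-trans (layerConst-pos ℓ k i) (≤-trans (m≤m+n _ _) (m≤m+n (2 * layerConst ℓ k i) (layerSlack ℓ k i)))

  module Layers {N : ℕ} (adj : Fin N → Fin N → Bool) (adj-sym : ∀ {u v} → adj u v ≡ true → adj v u ≡ true)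
    (k ℓ : ℕ) (lev : Fin N → ℕ) (par : Fin N → Fin N)
    (par-adj : ∀ v l → lev v ≡ suc l → suc l ≤ k → adj v (par v) ≡ true)
    (par-lev : ∀ v l → lev v ≡ suc l → suc l ≤ k → lev (par v) ≡ l) where

    V : Set
    V = Fin N

    record ThetaWalks : Set where
      field
        W : Fin ℓ → ℕ → V
        source target : V
        at-source : ∀ p → W p 0 ≡ source
        at-target : ∀ p → W p k ≡ target
        step : ∀ p τ → τ < k → adj (W p τ) (W p (suc τ)) ≡ true
        disjoint : ∀ p p′ τ τ′ → τ ≤ k → τ′ ≤ k → W p τ ≡ W p′ τ′ → τ ≡ τ′ × (p ≡ p′ ⊎ τ ≡ 0 ⊎ τ ≡ k)

    anc : ℕ → V → V
    anc zero v = v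
    anc (suc n) v = par (anc n v)

    anc-lev : ∀ n {v l} → lev v ≡ n + l → n + l ≤ k → lev (anc n v) ≡ l
    anc-lev zero e le = e
    anc-lev (suc n) {v} {l} e le = par-lev (anc n v) l
      (anc-lev n (trans e (sym (+-suc n l))) (≤-trans (≤-reflexive (+-suc n l)) le))
      (≤-trans (m≤n+m (suc l) n) (≤-trans (≤-reflexive (+-suc n l)) le))

    anc-+ : ∀ m n v → anc (m + n) v ≡ anc m (anc n v)
    anc-+ zero n v = refl
    anc-+ (suc m) n v = cong par (anc-+ m n v)

    edgeCount : (V → V → Bool) → ℕ
    edgeCount E = sumFin N (λ a → sumFin N (λ b → ι (E a b)))

    -- The root is not fixed at the start of the search: the recursion descends into a branch and
    -- makes its top the new root, so i counts levels below the current root while `lev` stays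
    -- absolute.
    record Layer (i : ℕ) : Set where
      field
        root : V
        A B : V → Bool
        E : V → V → Bool
        E-A : ∀ {a b} → E a b ≡ true → A a ≡ true
        E-B : ∀ {a b} → E a b ≡ true → B b ≡ true
        E-adj : ∀ {a b} → E a b ≡ true → adj a b ≡ true
        A-lev : ∀ {a} → A a ≡ true → lev a ≡ i + lev root
        B-lev : ∀ {b} → B b ≡ true → lev b ≡ suc (i + lev root)
        A-anc : ∀ {a} → A a ≡ true → anc i a ≡ root
        depth : i + lev root < k

    module Light (i : ℕ) (La : Layer (suc i)) where
      open Layer La
      C D₀ D₁ λA steps : ℕ
      C = layerConst ℓ k i
      D₀ = 2 * C
      D₁ = layerSlack ℓ k i
      λA = suc i + lev root
      steps = k ∸ suc i

      k≡ : k ≡ steps + suc i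
      k≡ = sym (m∸n+n≡m (≤-trans (m≤m+n (suc i) (lev root)) (<⇒≤ depth)))

      steps≥1 : 1 ≤ steps
      steps≥1 = m<n⇒0<n∸m (≤-<-trans (m≤m+n (suc i) (lev root)) depth)

      branch : V → V
      branch = anc i

      share : V → V → ℕ
      share b y = cnt (λ a → E a b ∧ (y == branch a))

      -- Heavy edges are numerous inside one branch, which is handled by recursion; if most edges are
      -- light, walks can be steered into pairwise distinct branches and then climb to the root.
      heavy : V → V → Bool
      heavy b y = does (D₀ ≤? share b y)

      El : V → V → Bool
      El a b = E a b ∧ not (heavy b (branch a))

      rel : V → V → Bool
      rel u v = El u v ∨ El v u

      rel-sym : ∀ u v → rel u v ≡ rel v u
      rel-sym u v = Bool.∨-comm (El u v) (El v u)

      El-lev : ∀ {a b} → El a b ≡ true → lev b ≡ suc (lev a)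
      El-lev {a} {b} e = trans (B-lev (E-B (∧-left {E a b} e))) (cong suc (sym (A-lev (E-A (∧-left {E a b} e)))))

      El-irr : ∀ v → El v v ≡ false
      El-irr v = ¬true⇒false λ e → 1+n≢n (sym (El-lev e))

      rel-irr : ∀ v → rel v v ≡ false
      rel-irr v = cong₂ _∨_ (El-irr v) (El-irr v)

      El-anti : ∀ u v → El u v ≡ true → El v u ≡ false
      El-anti u v e = ¬true⇒false λ e′ → <-irrefl (trans (El-lev e′) (cong suc (El-lev e))) (m<n+m (lev u) {2} (s≤s z≤n))

      rel-adj : ∀ {u v} → rel u v ≡ true → adj u v ≡ true
      rel-adj {u} {v} e with ∨-case {El u v} e
      ... | inj₁ p = E-adj (∧-left {E u v} p)
      ... | inj₂ p = adj-sym (E-adj (∧-left {E v u} p))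

      open Cleaning rel rel-sym rel-irr (λ _ → D₁)

      S₀ : V → Bool
      S₀ v = A v ∨ B v

      ι-rel : ∀ u v → ι (S₀ u) * ι (S₀ v ∧ rel u v) ≡ ι (El u v) + ι (El v u)
      ι-rel u v with El u v in e₁ | El v u in e₂
      ... | true | true = clash e₂ (El-anti u v e₁)
      ... | true | false rewrite E-A (∧-left {E u v} e₁) | E-B (∧-left {E u v} e₁) | Bool.∨-zeroʳ (A v) = refl
      ... | false | true rewrite E-A (∧-left {E v u} e₂) | E-B (∧-left {E v u} e₂) | Bool.∨-zeroʳ (A u) = refl
      ... | false | false rewrite Bool.∧-zeroʳ (S₀ v) = *-zeroʳ (ι (S₀ u))

      weight≡ : weight S₀ ≡ edgeCount El + edgeCount El
      weight≡ = trans (sum-cong N (λ u → trans (sym (sum-*ˡ N (ι (S₀ u)) _)) (trans (sum-cong N (ι-rel u)) (sum-+ N _ _))))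
        (trans (sum-+ N _ _) (cong (edgeCount El +_) (sum-swap N N (λ u v → ι (El v u)))))

      demand≤ : demand S₀ ≤ D₁ * (cnt A + cnt B)
      demand≤ = ≤-trans (≤-reflexive (sum-*ʳ N D₁ _)) (≤-trans (≤-reflexive (*-comm (cnt S₀) D₁)) (*-monoʳ-≤ D₁
        (≤-trans (sum-mono N (λ v → ι-∨ (A v) (B v))) (≤-reflexive (sum-+ N _ _)))))
        where
        ι-∨ : ∀ a b → ι (a ∨ b) ≤ ι a + ι b
        ι-∨ false b = ≤-refl
        ι-∨ true b = s≤s z≤n

      module Clean (S : V → Bool) (min : ∀ v → S v ≡ true → D₁ < deg S v) where

        -- The kind of vertex from which n steps lead into A.
        kind : ℕ → V → Bool
        kind zero = A
        kind (suc zero) = B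
        kind (suc (suc n)) = kind n

        kind-A∨B : ∀ n v → kind n v ≡ true → A v ≡ true ⊎ B v ≡ true
        kind-A∨B zero v e = inj₁ e
        kind-A∨B (suc zero) v e = inj₂ e
        kind-A∨B (suc (suc n)) v e = kind-A∨B n v e

        kind-step : ∀ n u v → rel v u ≡ true → kind (suc n) v ≡ true → kind n u ≡ true
        kind-step zero u v r Bv with ∨-case {El v u} r
        ... | inj₂ e = E-A (∧-left {E u v} e)
        ... | inj₁ e = ⊥-elim (1+n≢n (trans (sym (B-lev Bv)) (A-lev (E-A (∧-left {E v u} e)))))
        kind-step (suc zero) u v r Av with ∨-case {El v u} r
        ... | inj₁ e = E-B (∧-left {E v u} e)
        ... | inj₂ e = ⊥-elim (1+n≢n (trans (sym (B-lev (E-B (∧-left {E u v} e)))) (A-lev Av)))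
        kind-step (suc (suc n)) u v r e = kind-step n u v r e

        -- If a surviving vertex lies in the wrong layer, one of its neighbours lies in the right
        -- one, and the minimum degree supplies a neighbour.
        kind-start : ∀ n {v} → S v ≡ true → S₀ v ≡ true → Σ V λ z → S z ≡ true × kind n z ≡ true
        kind-start zero {v} Sv S₀v with ∨-case {A v} S₀v
        ... | inj₁ Av = v , Sv , Av
        ... | inj₂ Bv with cnt-witness _ (≤-trans (s≤s z≤n) (min v Sv))
        ...   | u , e = u , ∧-left {S u} e , kind-step 0 u v (∧-right {S u} e) Bv
        kind-start (suc zero) {v} Sv S₀v with ∨-case {A v} S₀v
        ... | inj₂ Bv = v , Sv , Bv
        ... | inj₁ Av with cnt-witness _ (≤-trans (s≤s z≤n) (min v Sv))
        ...   | u , e = u , ∧-left {S u} e , kind-step 1 u v (∧-right {S u} e) Av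
        kind-start (suc (suc n)) Sv S₀v = kind-start n Sv S₀v

        -- X lists the vertices already used, Y the branches already taken by the ends of other
        -- walks. The start may belong to X, since all walks of a fan share it.
        record Walk (n : ℕ) (v : V) (X Y : List V) : Set where
          field
            h : ℕ → V
            starts : h 0 ≡ v
            walks : ∀ τ → τ < n → rel (h τ) (h (suc τ)) ≡ true
            kinds : ∀ τ → τ ≤ n → kind (n ∸ τ) (h τ) ≡ true
            avoids : ∀ τ → 1 ≤ τ → τ ≤ n → h τ ∉ X
            simple : ∀ τ τ′ → τ ≤ n → τ′ ≤ n → h τ ≡ h τ′ → τ ≡ τ′
            ends : 1 ≤ n → branch (h n) ∉ Y

        ∉-from : ∀ {X u} → All (λ (Q : V → Bool) → Q u ≡ false) (map _==_ X) → u ∉ X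
        ∉-from {x ∷ X} (e ∷ es) (here refl) = clash (==-refl x) e
        ∉-from {x ∷ X} (e ∷ es) (there m) = ∉-from es m

        ∉-branch : ∀ {Y u} → All (λ (Q : V → Bool) → Q u ≡ false) (map (λ y u → y == branch u) Y) → branch u ∉ Y
        ∉-branch {y ∷ Y} (e ∷ es) (here refl) = clash (==-refl y) e
        ∉-branch {y ∷ Y} (e ∷ es) (there m) = ∉-branch es m

        1≤D₀ : 1 ≤ D₀
        1≤D₀ = ≤-trans (layerConst-pos ℓ k i) (m≤m+n C (C + 0))

        vertex-bound : ∀ (P : V → Bool) X → All (λ Q → cnt (λ v → P v ∧ Q v) ≤ D₀) (map _==_ X)
        vertex-bound P [] = []
        vertex-bound P (x ∷ X) = ≤-trans (cnt-mono {N} (λ v e → ∧-right {P v} e)) (≤-trans (≤-reflexive (sum-delta-1 N x)) 1≤D₀) ∷ vertex-bound P X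

        -- From a vertex of B every surviving edge goes to A and is light. If one such edge enters
        -- branch y, then y is not heavy for v, so fewer than D₀ neighbours of v lie in y.
        branch-bound : ∀ v → B v ≡ true → ∀ Y →
          All (λ Q → cnt (λ u → (S u ∧ rel v u) ∧ Q u) ≤ D₀) (map (λ y u → y == branch u) Y)
        branch-bound v Bv [] = []
        branch-bound v Bv (y ∷ Y) = bound ∷ branch-bound v Bv Y
          where
          P : V → Bool
          P u = (S u ∧ rel v u) ∧ (y == branch u)
          El-of : ∀ u → P u ≡ true → El u v ≡ true
          El-of u e with ∨-case {El v u} (∧-right {S u} (∧-left {S u ∧ rel v u} e))
          ... | inj₂ e′ = e′
          ... | inj₁ e′ = ⊥-elim (1+n≢n (trans (sym (B-lev Bv)) (A-lev (E-A (∧-left {E v u} e′)))))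
          bound : cnt P ≤ D₀
          bound with 1 ≤? cnt P
          ... | no none = ≤-trans (<⇒≤ (≰⇒> none)) 1≤D₀
          ... | yes some with cnt-witness P some
          ...   | u , Pu = ≤-trans (cnt-mono {N} (λ u′ e → ∧-true (∧-left {E u′ v} (El-of u′ e)) (∧-right {S u′ ∧ rel v u′} e)))
                  (<⇒≤ (≰⇒> (does-false (D₀ ≤? share v y) (trans (cong (heavy v) (==-sound {i = y} {j = branch u} (∧-right {S u ∧ rel v u} Pu))) (not-true (∧-right {E u v} (El-of u Pu)))))))

        budget : ℕ
        budget = suc k + ℓ * suc k

        -- Greedy choice: every degree exceeds D₁ = `budget` · D₀, while a forbidden vertex, or at
        -- the last step a forbidden branch, excludes at most D₀ neighbours. Each step adds one
        -- vertex to X, hence the n in the budget.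
        walk : ∀ n v X Y → S v ≡ true → kind n v ≡ true → v ∈ X → n + (length X + length Y) ≤ budget → Walk n v X Y
        walk zero v X Y Sv kv v∈X _ = record
          { h = λ _ → v ; starts = refl ; walks = λ _ () ; kinds = λ { zero z≤n → kv } ; avoids = λ { (suc _) _ () }
          ; simple = λ { zero zero _ _ _ → refl } ; ends = λ () }
        walk (suc n) v X Y Sv kv v∈X le = extend n kv le (select n kv)
          where
          P : V → Bool
          P u = S u ∧ rel v u
          select : ∀ n → kind (suc n) v ≡ true → Σ V λ u → P u ≡ true × u ∉ X × (n ≡ 0 → branch u ∉ Y)
          select zero Bv with pick D₀ (map _==_ X ++ map (λ y u → y == branch u) Y) P (All.++⁺ (vertex-bound P X) (branch-bound v Bv Y))
            (≤-<-trans (*-monoˡ-≤ D₀ (≤-trans (≤-reflexive (trans (length-++ (map _==_ X)) (cong₂ _+_ (length-map _==_ X) (length-map (λ y u → y == branch u) Y))))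
              (≤-trans (m≤n+m _ (suc n)) le))) (min v Sv))
          ... | u , Pu , av = u , Pu , ∉-from (All.++⁻ˡ (map _==_ X) av) , λ _ → ∉-branch (All.++⁻ʳ (map _==_ X) av)
          select (suc _) _ with pick D₀ (map _==_ X) P (vertex-bound P X)
            (≤-<-trans (*-monoˡ-≤ D₀ (≤-trans (≤-reflexive (length-map _==_ X)) (≤-trans (m≤m+n (length X) (length Y)) (≤-trans (m≤n+m _ (suc n)) le)))) (min v Sv))
          ... | u , Pu , av = u , Pu , ∉-from av , λ ()
          extend : ∀ n → kind (suc n) v ≡ true → suc n + (length X + length Y) ≤ budget →
            (Σ V λ u → P u ≡ true × u ∉ X × (n ≡ 0 → branch u ∉ Y)) → Walk (suc n) v X Y
          extend n kv le (u , Pu , u∉X , u∉Y) = record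
            { h = h ; starts = refl
            ; walks = λ { zero _ → trans (cong (rel v) w.starts) (∧-right {S u} Pu) ; (suc τ) (s≤s lt) → w.walks τ lt }
            ; kinds = λ { zero _ → kv ; (suc τ) (s≤s le) → w.kinds τ le }
            ; avoids = λ { (suc τ) _ (s≤s le) → outside τ le }
            ; simple = simple′
            ; ends = λ _ → ends′ n u∉Y rest }
            where
            rest : Walk n u (u ∷ X) Y
            rest = walk n u (u ∷ X) Y (∧-left {S u} Pu) (kind-step n u v (∧-right {S u} Pu) kv) (here refl)
              (≤-trans (≤-reflexive (+-suc n _)) le)
            module w = Walk rest
            h : ℕ → V
            h zero = v
            h (suc τ) = w.h τ
            outside : ∀ τ → τ ≤ n → w.h τ ∉ X
            outside zero _ m = u∉X (subst (_∈ X) w.starts m)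
            outside (suc τ) le m = w.avoids (suc τ) (s≤s z≤n) le (there m)
            simple′ : ∀ τ τ′ → τ ≤ suc n → τ′ ≤ suc n → h τ ≡ h τ′ → τ ≡ τ′
            simple′ zero zero _ _ _ = refl
            simple′ zero (suc τ′) _ (s≤s le) e = ⊥-elim (outside τ′ le (subst (_∈ X) e v∈X))
            simple′ (suc τ) zero (s≤s le) _ e = ⊥-elim (outside τ le (subst (_∈ X) (sym e) v∈X))
            simple′ (suc τ) (suc τ′) (s≤s le) (s≤s le′) e = cong suc (w.simple τ τ′ le le′ e)
            ends′ : ∀ n → (n ≡ 0 → branch u ∉ Y) → (r : Walk n u (u ∷ X) Y) → branch (Walk.h r n) ∉ Y
            ends′ zero f r m = f refl (subst (λ w → branch w ∈ Y) (Walk.starts r) m)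
            ends′ (suc n) f r = Walk.ends r (s≤s z≤n)

        record Fan (m : ℕ) (z : V) (X Y : List V) : Set where
          field
            fan : ∀ (p : Fin m) → Walk steps z X Y
            apart : ∀ p p′ τ τ′ → 1 ≤ τ → τ ≤ steps → 1 ≤ τ′ → τ′ ≤ steps → Walk.h (fan p) τ ≡ Walk.h (fan p′) τ′ → p ≡ p′
            branches : ∀ p p′ → branch (Walk.h (fan p) steps) ≡ branch (Walk.h (fan p′) steps) → p ≡ p′

        weaken : ∀ {n z X X′ Y Y′} → (∀ {x} → x ∈ X → x ∈ X′) → (∀ {y} → y ∈ Y → y ∈ Y′) → Walk n z X′ Y′ → Walk n z X Y
        weaken i j w = record { Walk w ; avoids = λ τ p r m → Walk.avoids w τ p r (i m) ; ends = λ p m → Walk.ends w p (j m) }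

        -- One walk adds `steps` vertices to X and one branch to Y; this accounts for `suc steps`
        -- per walk, on top of the common start.
        build-fan : ∀ m z X Y → S z ≡ true → kind steps z ≡ true → z ∈ X →
          length X + length Y + m * suc steps ≤ suc (ℓ * suc steps) → Fan m z X Y
        build-fan zero z X Y Sz kz z∈X le = record { fan = λ () ; apart = λ () ; branches = λ () }
        build-fan (suc m) z X Y Sz kz z∈X le = record { fan = fan ; apart = apart ; branches = branches }
          where
          steps≤k : steps ≤ k
          steps≤k = m∸n≤m k (suc i)
          w₀ : Walk steps z X Y
          w₀ = walk steps z X Y Sz kz z∈X (≤-trans (+-mono-≤ steps≤k (≤-trans (m≤m+n _ _) (≤-trans le (s≤s (*-monoʳ-≤ ℓ (s≤s steps≤k))))))
            (≤-reflexive (+-suc k _)))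
          module w₀ = Walk w₀
          used : List V
          used = applyUpTo (w₀.h ∘ suc) steps
          X′ = used ++ X
          Y′ = branch (w₀.h steps) ∷ Y
          others : Fan m z X′ Y′
          others = build-fan m z X′ Y′ Sz kz (∈-++⁺ʳ used z∈X) (≤-trans (≤-reflexive (begin
            length X′ + suc (length Y) + m * suc steps
              ≡⟨ cong (λ n → n + suc (length Y) + m * suc steps) (trans (length-++ used) (cong (_+ length X) (length-applyUpTo (w₀.h ∘ suc) steps))) ⟩
            steps + length X + suc (length Y) + m * suc steps
              ≡⟨ solve 4 (λ s x y r → s :+ x :+ (con 1 :+ y) :+ r := x :+ y :+ (con 1 :+ s :+ r)) refl steps (length X) (length Y) (m * suc steps) ⟩
            length X + length Y + (suc steps + m * suc steps) ∎)) le)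
            where
            open ≡-Reasoning
            open +-*-Solver
          module o = Fan others
          fan : Fin (suc m) → Walk steps z X Y
          fan zero = w₀
          fan (suc p) = weaken (∈-++⁺ʳ used) there (o.fan p)
          on-used : ∀ τ → 1 ≤ τ → τ ≤ steps → w₀.h τ ∈ X′
          on-used (suc τ) _ lt = ∈-++⁺ˡ (∈-applyUpTo⁺ (w₀.h ∘ suc) lt)
          apart : ∀ p p′ τ τ′ → 1 ≤ τ → τ ≤ steps → 1 ≤ τ′ → τ′ ≤ steps → Walk.h (fan p) τ ≡ Walk.h (fan p′) τ′ → p ≡ p′
          apart zero zero τ τ′ _ _ _ _ e = refl
          apart zero (suc p′) τ τ′ a b c d e = ⊥-elim (Walk.avoids (o.fan p′) τ′ c d (subst (_∈ X′) e (on-used τ a b)))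
          apart (suc p) zero τ τ′ a b c d e = ⊥-elim (Walk.avoids (o.fan p) τ a b (subst (_∈ X′) (sym e) (on-used τ′ c d)))
          apart (suc p) (suc p′) τ τ′ a b c d e = cong suc (o.apart p p′ τ τ′ a b c d e)
          branches : ∀ p p′ → branch (Walk.h (fan p) steps) ≡ branch (Walk.h (fan p′) steps) → p ≡ p′
          branches zero zero e = refl
          branches zero (suc p′) e = ⊥-elim (Walk.ends (o.fan p′) steps≥1 (here (sym e)))
          branches (suc p) zero e = ⊥-elim (Walk.ends (o.fan p) steps≥1 (here e))
          branches (suc p) (suc p′) e = cong suc (o.branches p p′ e)

        -- Each walk takes `steps` edges inside the two layers and then climbs suc i edges to the
        -- root, which makes k in all. Levels keep the proper part of a climb apart from the walks,
        -- and two climbs meeting below the root would start in the same branch.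
        theta : ∀ z → S z ≡ true → kind steps z ≡ true → ThetaWalks
        theta z Sz kz = record
          { W = W ; source = z ; target = root ; at-source = λ p → trans (W-low p 0 z≤n) (F.starts p)
          ; at-target = λ p → trans (cong (W p) k≡) (trans (W-high p (suc i)) (A-anc (inA p)))
          ; step = step ; disjoint = disjoint }
          where
          Fn : Fan ℓ z (z ∷ []) []
          Fn = build-fan ℓ z (z ∷ []) [] Sz kz (here refl) ≤-refl
          open Fan Fn
          module F (p : Fin ℓ) = Walk (fan p)
          end : Fin ℓ → V
          end p = F.h p steps
          inA : ∀ p → A (end p) ≡ true
          inA p = subst (λ n → kind n (end p) ≡ true) (n∸n≡0 steps) (F.kinds p steps ≤-refl)
          choose : ∀ p τ → Dec (τ ≤ steps) → V
          choose p τ (yes _) = F.h p τ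
          choose p τ (no _) = anc (τ ∸ steps) (end p)
          W : Fin ℓ → ℕ → V
          W p τ = choose p τ (τ ≤? steps)
          W-low : ∀ p τ → τ ≤ steps → W p τ ≡ F.h p τ
          W-low p τ le with τ ≤? steps
          ... | yes _ = refl
          ... | no n = ⊥-elim (n le)
          W-high : ∀ p o → W p (steps + o) ≡ anc o (end p)
          W-high p o with steps + o ≤? steps
          ... | no _ = cong (λ n → anc n (end p)) (m+n∸m≡n steps o)
          ... | yes le with o
          ...   | zero = cong (F.h p) (+-identityʳ steps)
          ...   | suc o = ⊥-elim (m+1+n≰m steps le)
          λA≤k : λA ≤ k
          λA≤k = <⇒≤ depth
          end-lev : ∀ p o l → o + l ≡ suc i → lev (anc o (end p)) ≡ l + lev root
          end-lev p o l e = anc-lev o eq (≤-trans (≤-reflexive (sym (trans (sym (A-lev (inA p))) eq))) λA≤k)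
            where
            eq : lev (end p) ≡ o + (l + lev root)
            eq = trans (A-lev (inA p)) (trans (cong (_+ lev root) (sym e)) (+-assoc o l _))
          low-lev : ∀ p τ → τ ≤ steps → λA ≤ lev (F.h p τ)
          low-lev p τ le with kind-A∨B (steps ∸ τ) (F.h p τ) (F.kinds p τ le)
          ... | inj₁ Av = ≤-reflexive (sym (A-lev Av))
          ... | inj₂ Bv = ≤-trans (n≤1+n _) (≤-reflexive (sym (B-lev Bv)))
          data Pos : ℕ → Set where
            low : ∀ {τ} → τ ≤ steps → Pos τ
            high : ∀ o → suc o ≤ suc i → Pos (steps + suc o)
          pos : ∀ τ → τ ≤ k → Pos τ
          pos τ le with τ ≤? steps
          ... | yes p = low p
          ... | no ¬p with m≤n⇒∃[o]m+o≡n (≰⇒> ¬p)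
          ...   | o , refl = subst Pos (+-suc steps o) (high o (+-cancelˡ-≤ steps _ _ (≤-trans (≤-reflexive (+-suc steps o)) (≤-trans le (≤-reflexive k≡)))))
          step : ∀ p τ → τ < k → adj (W p τ) (W p (suc τ)) ≡ true
          step p τ lt = step-case (τ <? steps)
           where
           step-case : Dec (τ < steps) → adj (W p τ) (W p (suc τ)) ≡ true
           step-case (yes lt′) = subst₂ (λ x y → adj x y ≡ true) (sym (W-low p τ (<⇒≤ lt′))) (sym (W-low p (suc τ) lt′)) (rel-adj (F.walks p τ lt′))
           step-case (no ge) with m≤n⇒∃[o]m+o≡n (≮⇒≥ ge)
           ... | o , refl = subst₂ (λ x y → adj x y ≡ true) (sym (W-high p o)) (sym (trans (cong (W p) (sym (+-suc steps o))) (W-high p (suc o))))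
                   (par-adj (anc o (end p)) l (end-lev p o (suc (i ∸ o)) (trans (+-suc o _) (cong suc (m+[n∸m]≡n o≤i))))
                    (≤-trans (+-monoˡ-≤ (lev root) (s≤s (m∸n≤m i o))) λA≤k))
            where
            l = i ∸ o + lev root
            o≤i : o ≤ i
            o≤i = s≤s⁻¹ (+-cancelˡ-< steps _ _ (≤-trans lt (≤-reflexive k≡)))
          disjoint : ∀ p p′ τ τ′ → τ ≤ k → τ′ ≤ k → W p τ ≡ W p′ τ′ → τ ≡ τ′ × (p ≡ p′ ⊎ τ ≡ 0 ⊎ τ ≡ k)
          disjoint p p′ τ τ′ le le′ e = go (pos τ le) (pos τ′ le′) e
            where
            separate : ∀ p p′ τ o → τ ≤ steps → suc o ≤ suc i → ¬ (W p τ ≡ W p′ (steps + suc o))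
            separate p p′ τ o τ≤ o≤ e = <⇒≱ (≤-<-trans (≤-reflexive (end-lev p′ (suc o) (i ∸ o) (cong suc (m+[n∸m]≡n (s≤s⁻¹ o≤)))))
              (s≤s (+-monoˡ-≤ (lev root) (m∸n≤m i o))))
              (≤-trans (low-lev p τ τ≤) (≤-reflexive (cong lev (trans (sym (W-low p τ τ≤)) (trans e (W-high p′ (suc o)))))))
            go : ∀ {τ τ′} → Pos τ → Pos τ′ → W p τ ≡ W p′ τ′ → τ ≡ τ′ × (p ≡ p′ ⊎ τ ≡ 0 ⊎ τ ≡ k)
            go {τ} (low a) (high o b) e = ⊥-elim (separate p p′ τ o a b e)
            go {τ′ = τ′} (high o b) (low a) e = ⊥-elim (separate p′ p τ′ o a b (sym e))
            go {τ} {τ′} (low a) (low a′) e = low-low τ τ′ a a′ (trans (sym (W-low p τ a)) (trans e (W-low p′ τ′ a′)))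
              where
              low-low : ∀ τ τ′ → τ ≤ steps → τ′ ≤ steps → F.h p τ ≡ F.h p′ τ′ → τ ≡ τ′ × (p ≡ p′ ⊎ τ ≡ 0 ⊎ τ ≡ k)
              low-low zero τ′ a a′ e = F.simple p′ 0 τ′ z≤n a′ (trans (F.starts p′) (trans (sym (F.starts p)) e)) , inj₂ (inj₁ refl)
              low-low (suc τ) zero a a′ e = F.simple p (suc τ) 0 a z≤n (trans e (trans (F.starts p′) (sym (F.starts p)))) ,
                inj₂ (inj₁ (F.simple p (suc τ) 0 a z≤n (trans e (trans (F.starts p′) (sym (F.starts p))))))
              low-low (suc τ) (suc τ′) a a′ e with apart p p′ (suc τ) (suc τ′) (s≤s z≤n) a (s≤s z≤n) a′ e
              ... | refl = F.simple p (suc τ) (suc τ′) a a′ e , inj₁ refl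
            go (high o b) (high o′ b′) e with trans (sym (W-high p (suc o))) (trans e (W-high p′ (suc o′)))
            ... | e′ = cong (λ x → steps + suc x) o≡ , same (m≤n⇒m<n∨m≡n (s≤s⁻¹ b))
              where
              o≡ : o ≡ o′
              o≡ = ∸-cancelˡ-≡ (s≤s⁻¹ b) (s≤s⁻¹ b′) (+-cancelʳ-≡ (lev root) _ _
                (trans (sym (end-lev p (suc o) (i ∸ o) (cong suc (m+[n∸m]≡n (s≤s⁻¹ b)))))
                  (trans (cong lev e′) (end-lev p′ (suc o′) (i ∸ o′) (cong suc (m+[n∸m]≡n (s≤s⁻¹ b′)))))))
              same : o < i ⊎ o ≡ i → p ≡ p′ ⊎ steps + suc o ≡ 0 ⊎ steps + suc o ≡ k
              same (inj₂ o≡i) = inj₂ (inj₂ (trans (cong (λ x → steps + suc x) o≡i) (sym k≡)))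
              same (inj₁ o<i) = inj₁ (branches p p′ (trans (climb p) (trans (cong (anc (i ∸ suc o)) (trans e′ (cong (λ x → anc (suc x) (end p′)) (sym o≡)))) (sym (climb p′)))))
                where
                climb : ∀ p → branch (end p) ≡ anc (i ∸ suc o) (anc (suc o) (end p))
                climb p = trans (cong (λ n → anc n (end p)) (sym (m∸n+n≡m o<i))) (anc-+ (i ∸ suc o) (suc o) (end p))

      light : D₁ * (cnt A + cnt B) < edgeCount El → ThetaWalks
      light h with clean (cnt S₀) S₀ ≤-refl (≤-<-trans (+-mono-≤ demand≤ demand≤) (<-≤-trans (+-mono-< h h) (≤-reflexive (sym weight≡))))
      ... | S , sub , (v , Sv) , min with Clean.kind-start S min steps Sv (sub v Sv)
      ...   | z , Sz , kz = Clean.theta S min z Sz kz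

      Eh : V → V → Bool
      Eh a b = E a b ∧ heavy b (branch a)

      restrict : V → V → V → Bool
      restrict y a b = Eh a b ∧ (y == branch a)

      A′ B′ : V → V → Bool
      A′ y a = A a ∧ (y == branch a)
      B′ y b = B b ∧ heavy b y

      sum-restrict : sumFin N (λ y → edgeCount (restrict y)) ≡ edgeCount Eh
      sum-restrict = trans (sum-swap N N _) (sum-cong N (λ a → trans (sum-swap N N _) (sum-cong N (λ b →
        trans (sum-cong N (λ y → trans (ι-∧ (Eh a b) (y == branch a)) (trans (*-comm (ι (Eh a b)) _) (cong (λ z → ι z * ι (Eh a b)) (==-sym y (branch a))))))
          (sum-delta N (branch a) (λ _ → ι (Eh a b)))))))

      sum-A′ : sumFin N (λ y → cnt (A′ y)) ≡ cnt A
      sum-A′ = trans (sum-swap N N _) (sum-cong N (λ a →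
        trans (sum-cong N (λ y → trans (ι-∧ (A a) (y == branch a)) (trans (*-comm (ι (A a)) _) (cong (λ z → ι z * ι (A a)) (==-sym y (branch a))))))
          (sum-delta N (branch a) (λ _ → ι (A a)))))

      heavy-count : ∀ y → D₀ * cnt (B′ y) ≤ edgeCount (restrict y)
      heavy-count y = ≤-trans (≤-reflexive (sym (sum-*ˡ N D₀ _))) (≤-trans (sum-mono N per-vertex) (≤-reflexive (sum-swap N N (λ b a → ι (restrict y a b)))))
        where
        per-vertex : ∀ b → D₀ * ι (B′ y b) ≤ sumFin N (λ a → ι (restrict y a b))
        per-vertex b with B b | heavy b y in hv
        ... | false | _ = ≤-trans (≤-reflexive (*-zeroʳ D₀)) z≤n
        ... | true | false = ≤-trans (≤-reflexive (*-zeroʳ D₀)) z≤n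
        ... | true | true = ≤-trans (≤-reflexive (*-identityʳ D₀)) (≤-trans (does-true (D₀ ≤? share b y) hv)
          (cnt-mono {N} (λ a e → ∧-true (∧-true (∧-left {E a b} e) (trans (cong (heavy b) (sym (==-sound {i = y} (∧-right {E a b} e)))) hv)) (∧-right {E a b} e))))

      sub-layer : ∀ y → Σ V (λ a → A a ≡ true × y ≡ branch a) → Layer i
      sub-layer y (a₀ , Aa₀ , y≡) = record
        { root = y ; A = A′ y ; B = B′ y ; E = restrict y
        ; E-A = λ {a} {b} e → ∧-true (E-A (∧-left {E a b} (∧-left {Eh a b} e))) (∧-right {Eh a b} e)
        ; E-B = λ {a} {b} e → ∧-true (E-B (∧-left {E a b} (∧-left {Eh a b} e)))
            (trans (cong (heavy b) (==-sound {i = y} {j = branch a} (∧-right {Eh a b} e))) (∧-right {E a b} (∧-left {Eh a b} e)))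
        ; E-adj = λ {a} {b} e → E-adj (∧-left {E a b} (∧-left {Eh a b} e))
        ; A-lev = λ {a} e → trans (A-lev (∧-left {A a} e)) (sym shift)
        ; B-lev = λ {b} e → trans (B-lev (∧-left {B b} e)) (cong suc (sym shift))
        ; A-anc = λ {a} e → sym (==-sound {i = y} {j = branch a} (∧-right {A a} e))
        ; depth = ≤-<-trans (≤-reflexive shift) depth }
        where
        lev-y : lev y ≡ suc (lev root)
        lev-y = trans (cong lev y≡) (anc-lev i (trans (A-lev Aa₀) (sym (+-suc i _))) (≤-trans (≤-reflexive (+-suc i _)) (<⇒≤ depth)))
        shift : i + lev y ≡ suc i + lev root
        shift = trans (cong (i +_) lev-y) (+-suc i (lev root))

      split-edges : edgeCount E ≡ edgeCount Eh + edgeCount El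
      split-edges = trans (sum-cong N (λ a → cnt-∧-split (E a) (λ b → heavy b (branch a)))) (sum-+ N _ _)

    -- At i = 0 the set A contains at most the root, so there are at most |B| edges. Otherwise, if
    -- more than D₀ |A| edges are heavy, some branch y has more than D₀ |A′ y| of them, and by
    -- heaviness at least D₀ |B′ y|; adding and halving, as D₀ is twice the previous constant, gives
    -- the hypothesis inside y. If few are heavy, the light edges suffice.
    layer-theta : ∀ i (La : Layer i) → layerConst ℓ k i * (cnt (Layer.A La) + cnt (Layer.B La)) < edgeCount (Layer.E La) → ThetaWalks
    layer-theta zero La h = ⊥-elim (<⇒≱ h (begin
      edgeCount E                                          ≤⟨ sum-mono N row ⟩
      sumFin N (λ a → ι (root == a) * cnt (E a))           ≡⟨ sum-delta N root (λ a → cnt (E a)) ⟩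
      cnt (E root)                                         ≤⟨ cnt-mono {N} (λ b e → E-B e) ⟩
      cnt B                                                ≤⟨ m≤n+m (cnt B) (cnt A) ⟩
      cnt A + cnt B                                        ≡⟨ sym (+-identityʳ _) ⟩
      1 * (cnt A + cnt B) ∎))
      where
      open ≤-Reasoning
      open Layer La
      row : ∀ a → cnt (E a) ≤ ι (root == a) * cnt (E a)
      row a with root ≟ a
      ... | yes _ = ≤-reflexive (sym (+-identityʳ _))
      -- Every endpoint in A is its own ancestor at distance 0, hence equals the root; other rows
      -- are empty.
      ... | no ne = ≮⇒≥ λ pos → ne (sym (A-anc (E-A (proj₂ (cnt-witness (E a) pos)))))
    layer-theta (suc i) La h with 2 * layerConst ℓ k i * cnt (Layer.A La) <? edgeCount (Light.Eh i La)
    ... | no few = light (+-cancelˡ-< (D₀ * cnt A) _ _ (begin-strict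
        D₀ * cnt A + D₁ * (cnt A + cnt B)                     ≤⟨ +-monoˡ-≤ (D₁ * (cnt A + cnt B)) (*-monoʳ-≤ D₀ (m≤m+n (cnt A) (cnt B))) ⟩
        D₀ * (cnt A + cnt B) + D₁ * (cnt A + cnt B)           ≡⟨ sym (*-distribʳ-+ (cnt A + cnt B) D₀ D₁) ⟩
        layerConst ℓ k (suc i) * (cnt A + cnt B)              <⟨ h ⟩
        edgeCount E                                           ≡⟨ split-edges ⟩
        edgeCount Eh + edgeCount El                           ≤⟨ +-monoˡ-≤ (edgeCount El) (≮⇒≥ few) ⟩
        D₀ * cnt A + edgeCount El ∎))
      where
      open ≤-Reasoning
      open Layer La
      open Light i La
    ... | yes many with sum-<-witness N (λ y → 2 * layerConst ℓ k i * cnt (Light.A′ i La y)) (λ y → edgeCount (Light.restrict i La y))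
        (≤-<-trans (≤-reflexive (trans (sum-*ˡ N (2 * layerConst ℓ k i) (λ y → cnt (Light.A′ i La y))) (cong (2 * layerConst ℓ k i *_) (Light.sum-A′ i La)))) (<-≤-trans many (≤-reflexive (sym (Light.sum-restrict i La)))))
    ...   | y , big = layer-theta i (sub-layer y witness) (*-cancelˡ-< 2 _ _ (begin-strict
        2 * (C * (cnt (A′ y) + cnt (B′ y)))        ≡⟨ sym (*-assoc 2 C _) ⟩
        D₀ * (cnt (A′ y) + cnt (B′ y))             ≡⟨ *-distribˡ-+ D₀ (cnt (A′ y)) (cnt (B′ y)) ⟩
        D₀ * cnt (A′ y) + D₀ * cnt (B′ y)          <⟨ +-mono-<-≤ big (heavy-count y) ⟩
        edgeCount (restrict y) + edgeCount (restrict y)   ≡⟨ cong (edgeCount (restrict y) +_) (sym (+-identityʳ _)) ⟩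
        2 * edgeCount (restrict y) ∎))
      where
      open ≤-Reasoning
      open Layer La
      open Light i La
      witness : Σ V λ a → A a ≡ true × y ≡ branch a
      witness with sum-pos-witness N _ (≤-trans (s≤s z≤n) big)
      ... | a , pos with cnt-witness (restrict y a) pos
      ...   | b , e = a , E-A (∧-left {E a b} (∧-left {Eh a b} e)) , ==-sound {i = y} {j = branch a} (∧-right {Eh a b} e)

-- Growth of breadth-first layers and the resulting bound on a product of degrees.

module Expansion where

  open import Defs
  open FiniteSums
  open Shattering using (does-true)
  open ThetaPaths using (BAdj-sym; dbl; pathView; PathView; first; inner; last)
  open DenseLayers
  open import Data.Nat
  open import Data.Nat.Properties
  open import Data.Fin using (Fin; zero; suc; splitAt; toℕ; _↑ˡ_; _↑ʳ_; join)
  open import Data.Fin.Properties using (any?; toℕ<n; toℕ-fromℕ<; toℕ-injective; splitAt-↑ˡ; splitAt-↑ʳ; join-splitAt)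
  open import Data.Bool using (Bool; true; false; if_then_else_; _∧_; _∨_; not) renaming (T to IsTrue)
  import Data.Bool.Properties as Bool
  open import Data.Product using (Σ; _×_; _,_; proj₁; proj₂)
  open import Data.Sum using (_⊎_; inj₁; inj₂)
  open import Data.Empty using (⊥-elim)
  open import Function using (_∘_)
  open import Relation.Nullary
  open import Relation.Nullary.Decidable using (dec-true; _×-dec_)
  open import Relation.Binary.PropositionalEquality
  open import Data.Nat.Solver using (module +-*-Solver)

  layerConst-mono : ∀ ℓ k {i j} → i ≤ j → layerConst ℓ k i ≤ layerConst ℓ k j
  layerConst-mono ℓ k {i} {zero} z≤n = ≤-refl
  layerConst-mono ℓ k {i} {suc j} le with m≤n⇒m<n∨m≡n le
  ... | inj₂ refl = ≤-refl
  ... | inj₁ lt = ≤-trans (layerConst-mono ℓ k (s≤s⁻¹ lt)) (≤-trans (m≤m+n _ _) (m≤m+n (2 * layerConst ℓ k j) (layerSlack ℓ k j)))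

  -- The value is n when nothing below n works; so `lev`, which searches below `suc k`, gives level
  -- `suc k` to every vertex not reached within k steps.
  least : ℕ → (ℕ → Bool) → ℕ
  least zero f = 0
  least (suc n) f = if f 0 then 0 else suc (least n (f ∘ suc))

  least-true : ∀ n f l → least n f ≡ l → l < n → f l ≡ true
  least-true (suc n) f l e lt with f 0 in eq
  least-true (suc n) f .0 refl lt | true = eq
  least-true (suc n) f .(suc (least n (f ∘ suc))) refl (s≤s lt) | false = least-true n (f ∘ suc) _ refl lt

  least-min : ∀ n f r → f r ≡ true → least n f ≤ r
  least-min zero f r e = z≤n
  least-min (suc n) f r e with f 0 in eq
  ... | true = z≤n
  least-min (suc n) f zero e | false = clash e eq
  least-min (suc n) f (suc r) e | false = s≤s (least-min n (f ∘ suc) r e)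

  flip : ℕ → Bool → Bool
  flip zero s = s
  flip (suc l) s = not (flip l s)

  -- With n⁻ ≤ n, doubling the hypothesis gives 2δn ≤ 6Cn + 2Cn⁺, and 6C ≤ δ lets one δn cancel. The
  -- monotonicity obtained feeds the next layer.
  growth-step : ∀ δ C n⁻ n n⁺ → 1 ≤ C → 6 * C ≤ δ → δ * n ≤ C * (n + n⁺) + C * (n⁻ + n) → n⁻ ≤ n →
    n ≤ n⁺ × δ * n ≤ 2 * C * n⁺
  growth-step δ C n⁻ n n⁺ 1≤C 6C≤δ h n⁻≤n = *-cancelˡ-≤ (2 * C) {{m*n≢0 2 C {{_}} {{>-nonZero 1≤C}}}} (begin
      2 * C * n        ≤⟨ *-monoˡ-≤ n (*-monoˡ-≤ C {2} {6} (s≤s (s≤s z≤n))) ⟩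
      6 * C * n        ≤⟨ *-monoˡ-≤ n 6C≤δ ⟩
      δ * n            ≤⟨ grow ⟩
      2 * C * n⁺ ∎) , grow
    where
    open ≤-Reasoning
    open +-*-Solver
    grow : δ * n ≤ 2 * C * n⁺
    grow = +-cancelˡ-≤ (δ * n) _ _ (begin
      δ * n + δ * n                                     ≤⟨ +-mono-≤ h h ⟩
      (C * (n + n⁺) + C * (n⁻ + n)) + (C * (n + n⁺) + C * (n⁻ + n))
        ≤⟨ +-mono-≤ (+-monoʳ-≤ (C * (n + n⁺)) (*-monoʳ-≤ C (+-monoˡ-≤ n n⁻≤n))) (+-monoʳ-≤ (C * (n + n⁺)) (*-monoʳ-≤ C (+-monoˡ-≤ n n⁻≤n))) ⟩
      (C * (n + n⁺) + C * (n + n)) + (C * (n + n⁺) + C * (n + n))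
        ≡⟨ solve 3 (λ c n p → (c :* (n :+ p) :+ c :* (n :+ n)) :+ (c :* (n :+ p) :+ c :* (n :+ n)) := con 6 :* c :* n :+ con 2 :* c :* p) refl C n n⁺ ⟩
      6 * C * n + 2 * C * n⁺                            ≤⟨ +-monoˡ-≤ (2 * C * n⁺) (*-monoˡ-≤ n 6C≤δ) ⟩
      δ * n + 2 * C * n⁺ ∎)

  module BreadthFirst {N : ℕ} (adj : Fin N → Fin N → Bool) (adj-sym : ∀ {u v} → adj u v ≡ true → adj v u ≡ true)
    (side : Fin N → Bool) (adj-side : ∀ {u v} → adj u v ≡ true → side v ≡ not (side u)) (k ℓ : ℕ) (x : Fin N) where

    V : Set
    V = Fin N

    reach : ℕ → V → Bool
    reach zero v = x == v
    reach (suc r) v = reach r v ∨ does (any? (λ u → (reach r u Bool.≟ true) ×-dec (adj u v Bool.≟ true)))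

    lev : V → ℕ
    lev v = least (suc k) (λ r → reach r v)

    reach-lev : ∀ {v l} → lev v ≡ l → l ≤ k → reach l v ≡ true
    reach-lev {v} {l} e le = least-true (suc k) (λ r → reach r v) l e (s≤s le)

    lev-min : ∀ {v} r → reach r v ≡ true → lev v ≤ r
    lev-min {v} r e = least-min (suc k) (λ r → reach r v) r e

    lev-step : ∀ {v u} → adj v u ≡ true → lev v ≤ k → lev u ≤ suc (lev v)
    lev-step {v} {u} a le = lev-min (suc (lev v)) (∨-right {reach (lev v) u} (dec-true (any? _) (v , reach-lev refl le , a)))

    lev-root : lev x ≡ 0
    lev-root = n≤0⇒n≡0 (lev-min 0 (==-refl x))

    lev0⇒root : ∀ {v} → lev v ≡ 0 → v ≡ x
    lev0⇒root {v} e = sym (==-sound {i = x} {j = v} (reach-lev {v} e z≤n))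

    predecessor : ∀ {v l} → lev v ≡ suc l → suc l ≤ k → Σ V λ u → adj v u ≡ true × lev u ≡ l
    predecessor {v} {l} e le with ∨-case {reach l v} (reach-lev {v} e le)
    ... | inj₁ r = ⊥-elim (<⇒≱ (≤-reflexive (sym e)) (lev-min l r))
    ... | inj₂ d with does-true (any? (λ u → (reach l u Bool.≟ true) ×-dec (adj u v Bool.≟ true))) d
    ...   | u , r , a = u , adj-sym a , ≤-antisym lu≤ (s≤s⁻¹ (≤-trans (≤-reflexive (sym e)) (lev-step a (≤-trans lu≤ (≤-trans (n≤1+n l) le)))))
      where
      lu≤ : lev u ≤ l
      lu≤ = lev-min l r

    par : V → V
    par v with any? (λ u → (adj v u Bool.≟ true) ×-dec (suc (lev u) ≟ lev v))
    ... | yes (u , _) = u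
    ... | no _ = v

    par-spec : ∀ v l → lev v ≡ suc l → suc l ≤ k → adj v (par v) ≡ true × lev (par v) ≡ l
    par-spec v l e le with any? (λ u → (adj v u Bool.≟ true) ×-dec (suc (lev u) ≟ lev v))
    ... | yes (u , a , h) = a , suc-injective (trans h e)
    ... | no none with predecessor e le
    ...   | u , a , h = ⊥-elim (none (u , a , trans (cong suc h) (sym e)))

    open Layers adj adj-sym k ℓ lev par (λ v l e le → proj₁ (par-spec v l e le)) (λ v l e le → proj₂ (par-spec v l e le)) public hiding (V)

    lev-side : ∀ l {v} → lev v ≡ l → l ≤ k → side v ≡ flip l (side x)
    lev-side zero e le = cong side (lev0⇒root e)
    lev-side (suc l) {v} e le with predecessor e le
    ... | u , a , h = trans (adj-side (adj-sym a)) (cong not (lev-side l h (≤-trans (n≤1+n l) le)))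

    at : ℕ → V → Bool
    at l v = does (lev v ≟ l)

    size : ℕ → ℕ
    size l = cnt (at l)

    between : ℕ → V → V → Bool
    between l a b = at l a ∧ (at (suc l) b ∧ adj a b)

    layer : ∀ i → i < k → Layer i
    layer i i<k = record
      { root = x ; A = at i ; B = at (suc i) ; E = between i
      ; E-A = λ {a} {b} e → ∧-left {at i a} e
      ; E-B = λ {a} {b} e → ∧-left {at (suc i) b} (∧-right {at i a} e)
      ; E-adj = λ {a} {b} e → ∧-right {at (suc i) b} (∧-right {at i a} e)
      ; A-lev = λ {a} e → trans (lev-of e) (sym i+0)
      ; B-lev = λ {b} e → trans (lev-of e) (cong suc (sym i+0))
      ; A-anc = λ {a} e → lev0⇒root (anc-lev i {a} {0} (trans (lev-of e) (sym (+-identityʳ i))) (≤-trans (≤-reflexive (+-identityʳ i)) (<⇒≤ i<k)))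
      ; depth = ≤-<-trans (≤-reflexive i+0) i<k }
      where
      i+0 : i + lev x ≡ i
      i+0 = trans (cong (i +_) lev-root) (+-identityʳ i)
      lev-of : ∀ {l v} → at l v ≡ true → lev v ≡ l
      lev-of {l} {v} e = does-true (lev v ≟ l) e

    C : ℕ
    C = layerConst ℓ k k

    module Growth (no-theta : ¬ ThetaWalks) (δ : Bool → ℕ) (degree : ∀ v → lev v ≤ k → δ (side v) ≤ cnt (adj v))
      (δ-large : ∀ s → 6 * C ≤ δ s) where

      layer-edges : ∀ i → i < k → edgeCount (between i) ≤ C * (size i + size (suc i))
      layer-edges i i<k = ≤-trans (≮⇒≥ (λ h → no-theta (layer-theta i (layer i i<k) h)))
        (*-monoˡ-≤ (size i + size (suc i)) (layerConst-mono ℓ k (<⇒≤ i<k)))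

      -- The level test is `suc (lev u) ≟ l` instead of a truncated predecessor, so that nothing
      -- lies below level 0.
      below : ℕ → V → V → Bool
      below l v u = at l v ∧ (does (suc (lev u) ≟ l) ∧ adj v u)

      -- Levels of adjacent vertices differ by at most one, and equal levels would put both ends on
      -- the same side; so every neighbour is counted exactly above or below.
      neighbours : ∀ l → l < k → ∀ v → ι (at l v) * δ (flip l (side x)) ≤ cnt (between l v) + cnt (below l v)
      neighbours l l<k v = go (at l v) refl
        where
        up down : V → Bool
        up u = at (suc l) u ∧ adj v u
        down u = does (suc (lev u) ≟ l) ∧ adj v u
        go : ∀ b → at l v ≡ b → ι b * δ (flip l (side x)) ≤ cnt (λ u → b ∧ up u) + cnt (λ u → b ∧ down u)
        go false _ = z≤n
        go true at-l = begin
          1 * δ (flip l (side x))                      ≡⟨ *-identityˡ _ ⟩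
          δ (flip l (side x))                          ≡⟨ cong δ (sym (lev-side l e (<⇒≤ l<k))) ⟩
          δ (side v)                                   ≤⟨ degree v (≤-trans (≤-reflexive e) (<⇒≤ l<k)) ⟩
          cnt (adj v)                                  ≤⟨ sum-mono N each ⟩
          sumFin N (λ u → ι (up u) + ι (down u))       ≡⟨ sum-+ N _ _ ⟩
          cnt up + cnt down ∎
         where
         open ≤-Reasoning
         e : lev v ≡ l
         e = does-true (lev v ≟ l) at-l
         each : ∀ u → ι (adj v u) ≤ ι (up u) + ι (down u)
         each u = each′ (adj v u) refl
          where
          each′ : ∀ b → adj v u ≡ b → ι b ≤ ι (at (suc l) u ∧ b) + ι (does (suc (lev u) ≟ l) ∧ b)
          each′ false _ = z≤n
          each′ true a with m≤n⇒m<n∨m≡n (lev-step a (≤-trans (≤-reflexive e) (<⇒≤ l<k)))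
          ... | inj₂ above = ≤-trans (≤-reflexive (sym (ι-true (∧-true (dec-true (lev u ≟ suc l) (trans above (cong suc e))) refl)))) (m≤m+n _ _)
          ... | inj₁ lt = ≤-trans (≤-reflexive (sym (ι-true (∧-true (dec-true (suc (lev u) ≟ l) below-l) refl)))) (m≤n+m _ _)
           where
           lu≤l : lev u ≤ l
           lu≤l = ≤-trans (s≤s⁻¹ lt) (≤-reflexive e)
           not-level : ¬ (lev u ≡ l)
           not-level h = s≢not-s (trans (sym (lev-side l e (<⇒≤ l<k))) (trans (adj-side (adj-sym a)) (cong not (lev-side l h (<⇒≤ l<k)))))
             where
             s≢not-s : ∀ {s} → ¬ (s ≡ not s)
             s≢not-s {true} ()
             s≢not-s {false} ()
           below-l : suc (lev u) ≡ l
           below-l with m≤n⇒m<n∨m≡n lu≤l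
           ... | inj₂ h = ⊥-elim (not-level h)
           ... | inj₁ h = ≤-antisym h (≤-trans (≤-reflexive (sym e)) (lev-step (adj-sym a) (≤-trans lu≤l (<⇒≤ l<k))))

      degree-sum : ∀ l → l < k → δ (flip l (side x)) * size l ≤ edgeCount (between l) + edgeCount (below l)
      degree-sum l l<k = ≤-trans (≤-reflexive (trans (*-comm (δ (flip l (side x))) (size l)) (sym (sum-*ʳ N _ _))))
        (≤-trans (sum-mono N (neighbours l l<k)) (≤-reflexive (sum-+ N _ _)))

      below-zero : edgeCount (below 0) ≤ 0
      below-zero = ≤-reflexive (trans (sum-cong N (λ v → trans (cnt-cong {N} (λ u → Bool.∧-zeroʳ (at 0 v))) (sum-0 N))) (sum-0 N))

      below-suc : ∀ l → edgeCount (below (suc l)) ≤ edgeCount (between l)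
      below-suc l = ≤-trans (≤-reflexive (sum-swap N N _)) (sum-mono N (λ u → cnt-mono {N} (λ v e →
        ∧-true (dec-true (lev u ≟ l) (suc-injective (does-true (suc (lev u) ≟ suc l) (∧-left {does (suc (lev u) ≟ suc l)} (∧-right {at (suc l) v} e)))))
          (∧-true (∧-left {at (suc l) v} e) (adj-sym (∧-right {does (suc (lev u) ≟ suc l)} (∧-right {at (suc l) v} e)))))))

      1≤C : 1 ≤ C
      1≤C = layerConst-pos ℓ k k

      growth : ∀ l → l < k → size l ≤ size (suc l) × δ (flip l (side x)) * size l ≤ 2 * C * size (suc l)
      growth zero 0<k = growth-step _ C 0 (size 0) (size 1) 1≤C (δ-large _)
        (≤-trans (degree-sum 0 0<k) (+-mono-≤ (layer-edges 0 0<k) (≤-trans below-zero z≤n))) z≤n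
      growth (suc l) l<k = growth-step _ C (size l) (size (suc l)) (size (2 + l)) 1≤C (δ-large _)
        (≤-trans (degree-sum (suc l) l<k) (+-mono-≤ (layer-edges (suc l) l<k) (≤-trans (below-suc l) (layer-edges l (<⇒≤ l<k)))))
        (proj₁ (growth l (<⇒≤ l<k)))

      prodδ : ℕ → ℕ
      prodδ zero = 1
      prodδ (suc l) = prodδ l * δ (flip l (side x))

      product-bound : ∀ l → l ≤ k → prodδ l ≤ (2 * C) ^ l * size l
      product-bound zero _ = ≤-trans (cnt-pos (at 0) x (dec-true (lev x ≟ 0) lev-root)) (≤-reflexive (sym (+-identityʳ (size 0))))
      product-bound (suc l) le = begin
        prodδ l * d                        ≤⟨ *-monoˡ-≤ d (product-bound l (<⇒≤ le)) ⟩
        (2 * C) ^ l * size l * d           ≡⟨ trans (*-assoc ((2 * C) ^ l) (size l) d) (cong ((2 * C) ^ l *_) (*-comm (size l) d)) ⟩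
        (2 * C) ^ l * (d * size l)         ≤⟨ *-monoʳ-≤ ((2 * C) ^ l) (proj₂ (growth l le)) ⟩
        (2 * C) ^ l * (2 * C * size (suc l)) ≡⟨ trans (sym (*-assoc ((2 * C) ^ l) (2 * C) _)) (cong (_* size (suc l)) (*-comm ((2 * C) ^ l) (2 * C))) ⟩
        (2 * C) ^ suc l * size (suc l) ∎
        where
        open ≤-Reasoning
        d = δ (flip l (side x))

      total : prodδ k ≤ (2 * C) ^ k * N
      total = ≤-trans (product-bound k ≤-refl) (*-monoʳ-≤ ((2 * C) ^ k) (cnt≤n (at k)))

  module UpperBound (t c′ : ℕ) {m n : ℕ} (G : BipGraph m n) where

    k ℓ N C : ℕ
    k = suc (dbl t)
    ℓ = suc c′
    N = m + n
    C = layerConst ℓ k k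

    bip : BVertex m n → BVertex m n → Bool
    bip (inj₁ i) (inj₁ _) = false
    bip (inj₁ i) (inj₂ j) = G i j
    bip (inj₂ j) (inj₁ i) = G i j
    bip (inj₂ _) (inj₂ _) = false

    isLeft : BVertex m n → Bool
    isLeft (inj₁ _) = true
    isLeft (inj₂ _) = false

    bip-sym : ∀ a b → bip a b ≡ bip b a
    bip-sym (inj₁ _) (inj₁ _) = refl
    bip-sym (inj₁ _) (inj₂ _) = refl
    bip-sym (inj₂ _) (inj₁ _) = refl
    bip-sym (inj₂ _) (inj₂ _) = refl

    bip-irr : ∀ a → bip a a ≡ false
    bip-irr (inj₁ _) = refl
    bip-irr (inj₂ _) = refl

    bip-left : ∀ a b → bip a b ≡ true → isLeft b ≡ not (isLeft a)
    bip-left (inj₁ _) (inj₂ _) _ = refl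
    bip-left (inj₂ _) (inj₁ _) _ = refl

    true⇒IsTrue : ∀ {b} → b ≡ true → IsTrue b
    true⇒IsTrue refl = _

    bip-BAdj : ∀ a b → bip a b ≡ true → BAdj G a b
    bip-BAdj (inj₁ _) (inj₂ _) e = true⇒IsTrue e
    bip-BAdj (inj₂ _) (inj₁ _) e = true⇒IsTrue e

    vertex : Fin N → BVertex m n
    vertex = splitAt m

    adj : Fin N → Fin N → Bool
    adj u v = bip (vertex u) (vertex v)

    sideOf : Fin N → Bool
    sideOf = isLeft ∘ vertex

    module Subgraph (δ : Bool → ℕ) (δ-large : ∀ s → 6 * C ≤ δ s) (free : ThetaFree k ℓ G) (S : Fin N → Bool)
      (S-deg : ∀ v → S v ≡ true → δ (sideOf v) < cnt (λ u → S u ∧ adj v u))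
      (x : Fin N) (Sx : S x ≡ true) (x-left : sideOf x ≡ true) where

      adjS : Fin N → Fin N → Bool
      adjS u v = (S u ∧ S v) ∧ adj u v

      adjS-sym : ∀ {u v} → adjS u v ≡ true → adjS v u ≡ true
      adjS-sym {u} {v} e = ∧-true (∧-true (∧-right {S u} (∧-left {S u ∧ S v} e)) (∧-left {S u} (∧-left {S u ∧ S v} e)))
        (trans (bip-sym (vertex v) (vertex u)) (∧-right {S u ∧ S v} e))

      open BreadthFirst adjS adjS-sym sideOf (λ {u} {v} e → bip-left (vertex u) (vertex v) (∧-right {S u ∧ S v} e)) k ℓ x
        hiding (V; C)

      reached : ∀ v → lev v ≤ k → S v ≡ true
      reached v le = go (lev v) refl le
        where
        go : ∀ l → lev v ≡ l → l ≤ k → S v ≡ true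
        go zero e _ = trans (cong S (lev0⇒root e)) Sx
        go (suc l) e le with predecessor e le
        ... | u , a , _ = ∧-left {S v} (∧-left {S v ∧ S u} a)

      no-theta : ¬ ThetaWalks
      no-theta θ = free (f , f-injective , f-adj)
        where
        open ThetaWalks θ
        -- The two shared ends are read off path `zero`, which exists because ℓ is a successor.
        rep : ThetaVertex k ℓ → Fin ℓ × ℕ
        rep (inj₁ false) = zero , 0
        rep (inj₁ true) = zero , k
        rep (inj₂ (p , s)) = p , suc (toℕ s)
        f : ThetaVertex k ℓ → BVertex m n
        f v = vertex (W (proj₁ (rep v)) (proj₂ (rep v)))
        vertex-injective : ∀ {a b} → vertex a ≡ vertex b → a ≡ b
        vertex-injective {a} {b} e = trans (sym (join-splitAt m n a)) (trans (cong (join m n) e) (join-splitAt m n b))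
        inner< : ∀ (s : Fin (k ∸ 1)) → suc (toℕ s) < k
        inner< s = s≤s (toℕ<n s)
        rep≤ : ∀ v → proj₂ (rep v) ≤ k
        rep≤ (inj₁ false) = z≤n
        rep≤ (inj₁ true) = ≤-refl
        rep≤ (inj₂ (p , s)) = <⇒≤ (inner< s)
        f-injective : ∀ {a b} → f a ≡ f b → a ≡ b
        f-injective {a} {b} e = same a b (disjoint _ _ _ _ (rep≤ a) (rep≤ b) (vertex-injective e))
          where
          same : ∀ a b → (let (p , τ) = rep a ; (p′ , τ′) = rep b in τ ≡ τ′ × (p ≡ p′ ⊎ τ ≡ 0 ⊎ τ ≡ k)) → a ≡ b
          same (inj₁ false) (inj₁ false) _ = refl
          same (inj₁ true) (inj₁ true) _ = refl
          same (inj₁ false) (inj₁ true) (() , _)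
          same (inj₁ true) (inj₁ false) (() , _)
          same (inj₁ false) (inj₂ _) (() , _)
          same (inj₂ _) (inj₁ false) (() , _)
          same (inj₁ true) (inj₂ (p , s)) (e , _) = ⊥-elim (<-irrefl (sym e) (inner< s))
          same (inj₂ (p , s)) (inj₁ true) (e , _) = ⊥-elim (<-irrefl e (inner< s))
          same (inj₂ (p , s)) (inj₂ (p′ , s′)) (e , inj₁ refl) = cong (λ s → inj₂ (p , s)) (toℕ-injective (suc-injective e))
          same (inj₂ (p , s)) (inj₂ (p′ , s′)) (e , inj₂ (inj₁ ()))
          same (inj₂ (p , s)) (inj₂ (p′ , s′)) (e , inj₂ (inj₂ e′)) = ⊥-elim (<-irrefl e′ (inner< s))
        on-path : ∀ p τ → τ ≤ k → f (pathVertex k ℓ p τ) ≡ vertex (W p τ)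
        on-path p τ le = go (pathView k ℓ p τ (s≤s z≤n) le)
          where
          go : ∀ {τ} → PathView k ℓ p τ → f (pathVertex k ℓ p τ) ≡ vertex (W p τ)
          go (first e) = trans (cong f e) (cong vertex (trans (at-source zero) (sym (at-source p))))
          go (last e) = trans (cong f e) (cong vertex (trans (at-target zero) (sym (at-target p))))
          go (inner {s} q e) = trans (cong f e) (cong (λ τ → vertex (W p (suc τ))) (toℕ-fromℕ< q))
        path-adj : ∀ p τ → τ < k → bip (f (pathVertex k ℓ p τ)) (f (pathVertex k ℓ p (suc τ))) ≡ true
        path-adj p τ lt = trans (cong₂ bip (on-path p τ (<⇒≤ lt)) (on-path p (suc τ) lt)) (∧-right {S (W p τ) ∧ S (W p (suc τ))} (step p τ lt))
        f-adj : ∀ u v → ThetaAdj k ℓ u v → BAdj G (f u) (f v)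
        f-adj u v (p , τ , lt , inj₁ (refl , refl)) = bip-BAdj (f (pathVertex k ℓ p τ)) (f (pathVertex k ℓ p (suc τ))) (path-adj p τ lt)
        f-adj u v (p , τ , lt , inj₂ (refl , refl)) = BAdj-sym G (f (pathVertex k ℓ p τ)) (f (pathVertex k ℓ p (suc τ)))
          (bip-BAdj (f (pathVertex k ℓ p τ)) (f (pathVertex k ℓ p (suc τ))) (path-adj p τ lt))

      min-degree : ∀ v → lev v ≤ k → δ (sideOf v) ≤ cnt (adjS v)
      min-degree v le = ≤-trans (<⇒≤ (S-deg v Sv)) (cnt-mono {N} (λ u e → ∧-true (∧-true Sv (∧-left {S u} e)) (∧-right {S u} e)))
        where
        Sv = reached v le

      open Growth no-theta δ min-degree δ-large

      -- Sides alternate over the k = 2t + 1 growth steps that start on the left: t pairs of both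
      -- degrees and one further left degree.
      degree-product : (δ true * δ false) ^ t * δ true ≤ (2 * C) ^ k * N
      degree-product = ≤-trans (≤-reflexive (sym (cong₂ _*_ (evens t) (cong δ (flip-even t))))) total
        where
        flip-even : ∀ t → flip (dbl t) (sideOf x) ≡ true
        flip-even zero = x-left
        flip-even (suc t) = trans (Bool.not-involutive _) (flip-even t)
        evens : ∀ t → prodδ (dbl t) ≡ (δ true * δ false) ^ t
        evens zero = refl
        evens (suc t) = trans (cong₂ (λ a b → prodδ (dbl t) * δ a * δ (not b)) (flip-even t) (flip-even t))
          (trans (*-assoc (prodδ (dbl t)) _ _) (trans (*-comm _ (δ true * δ false)) (cong (δ true * δ false *_) (evens t))))

    module _ (δ : Bool → ℕ) (δ-large : ∀ s → 6 * C ≤ δ s) (free : ThetaFree k ℓ G)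
      (dense : m * δ true + n * δ false < edges G) where

      open Cleaning adj (λ u v → bip-sym (vertex u) (vertex v)) (λ v → bip-irr (vertex v)) (δ ∘ sideOf)

      everything : Fin N → Bool
      everything _ = true

      by-sides : ∀ (f : Fin N → ℕ) → sumFin N f ≡ sumFin m (λ i → f (i ↑ˡ n)) + sumFin n (λ j → f (m ↑ʳ j))
      by-sides = sum-++ m n

      demand≡ : demand everything ≡ m * δ true + n * δ false
      demand≡ = trans (by-sides _) (cong₂ _+_
        (trans (sum-cong m (λ i → trans (+-identityʳ _) (cong (δ ∘ isLeft) (splitAt-↑ˡ m i n)))) (sum-const m _))
        (trans (sum-cong n (λ j → trans (+-identityʳ _) (cong (δ ∘ isLeft) (splitAt-↑ʳ m n j)))) (sum-const n _)))

      weight≡ : weight everything ≡ edges G + edges G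
      weight≡ = trans (by-sides _) (cong₂ _+_
        (sum-cong m (λ i → trans (+-identityʳ _) (trans (by-sides _) (cong₂ _+_
          (trans (sum-cong m (λ i′ → cong ι (cong₂ bip (splitAt-↑ˡ m i n) (splitAt-↑ˡ m i′ n)))) (sum-0 m))
          (sum-cong n (λ j → cong ι (cong₂ bip (splitAt-↑ˡ m i n) (splitAt-↑ʳ m n j))))))))
        (trans (sum-cong n (λ j → trans (+-identityʳ _) (trans (by-sides _) (trans (cong₂ _+_
          (sum-cong m (λ i → cong ι (cong₂ bip (splitAt-↑ʳ m n j) (splitAt-↑ˡ m i n))))
          (trans (sum-cong n (λ j′ → cong ι (cong₂ bip (splitAt-↑ʳ m n j) (splitAt-↑ʳ m n j′)))) (sum-0 n))) (+-identityʳ _)))))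
          (sum-swap n m (λ j i → ι (G i j)))))

      cleaned : Σ (Fin N → Bool) λ S → (∀ v → S v ≡ true → true ≡ true) × Σ (Fin N) (λ v → S v ≡ true) ×
        (∀ v → S v ≡ true → δ (sideOf v) < deg S v)
      cleaned = clean (cnt everything) everything ≤-refl
        (≤-<-trans (≤-reflexive (cong₂ _+_ demand≡ demand≡)) (<-≤-trans (+-mono-< dense dense) (≤-reflexive (sym weight≡))))

      product-of-degrees : (δ true * δ false) ^ t * δ true ≤ (2 * C) ^ k * N
      product-of-degrees = fromSubgraph cleaned
        where
        fromSubgraph : Σ (Fin N → Bool) (λ S → (∀ v → S v ≡ true → true ≡ true) × Σ (Fin N) (λ v → S v ≡ true) ×
          (∀ v → S v ≡ true → δ (sideOf v) < deg S v)) → (δ true * δ false) ^ t * δ true ≤ (2 * C) ^ k * N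
        fromSubgraph (S , _ , (v , Sv) , S-deg) = choose v Sv refl
          where
          choose : ∀ v → S v ≡ true → ∀ {s} → sideOf v ≡ s → (δ true * δ false) ^ t * δ true ≤ (2 * C) ^ k * N
          choose v Sv {true} e = Subgraph.degree-product δ δ-large free S S-deg v Sv e
          -- If the vertex that survived is on the right, its positive degree provides a surviving
          -- left neighbour to start from.
          choose v Sv {false} e with cnt-witness (λ u → S u ∧ adj v u) (≤-trans (s≤s z≤n) (S-deg v Sv))
          ... | u , h = Subgraph.degree-product δ δ-large free S S-deg u (∧-left {S u} h)
            (trans (bip-left (vertex v) (vertex u) (∧-right {S u} h)) (cong not e))

-- Choice of the parameters and arithmetic of the exponents.

module Exponents where

  open import Defs
  open FiniteSums
  open Polynomials
  open Shattering using (shatterConst)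
  open RandomGraph using (module AlgebraicGraph)
  open ThetaPaths using (dbl; dbl≡2*)
  open PrimeField using (prime-domain)
  open PrimeGaps using (^-distribʳ-*; prime-root)
  open DenseLayers using (layerConst; layerConst-pos)
  open Expansion using (module UpperBound)
  open import Data.Nat
  open import Data.Nat.Properties
  open import Data.Nat.DivMod using (m/n*n≤m; /-monoˡ-≤; m*n/n≡m; m≡m%n+[m/n]*n; m%n<n)
  open import Data.Nat.Primality using (Prime)
  open import Data.Nat.Solver using (module +-*-Solver)
  open import Data.Integer as ℤ using (ℤ; +_; ∣_∣)
  import Data.Integer.Properties as ℤ
  open import Data.Rational using (ℚ; mkℚ; 1ℚ; ↥_; ↧ₙ_; toℚᵘ) renaming (_≤_ to _≤ℚ_; _<_ to _<ℚ_; _/_ to _/ℚ_)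
  import Data.Rational.Properties as ℚ
  import Data.Rational.Unnormalised as ℚᵘ
  import Data.Rational.Unnormalised.Properties as ℚᵘ
  open import Data.Product using (Σ; _×_; _,_; proj₁; proj₂)
  open import Data.Bool using (Bool; true; false)
  open import Relation.Nullary
  open import Relation.Binary.PropositionalEquality

  ^-dbl : ∀ e t → e ^ dbl t ≡ (e * e) ^ t
  ^-dbl e zero = refl
  ^-dbl e (suc t) = trans (cong (λ z → e * (e * z)) (^-dbl e t)) (sym (*-assoc e e _))

  ^-cancel-≤ : ∀ d {a b} → 1 ≤ d → a ^ d ≤ b ^ d → a ≤ b
  ^-cancel-≤ (suc d) {a} {b} _ h = ≮⇒≥ λ lt → <⇒≱ (^-monoˡ-< (suc d) lt) h

  ^-cancel-< : ∀ d {a b} → a ^ d < b ^ d → a < b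
  ^-cancel-< d {a} {b} h = ≰⇒> λ le → <⇒≱ h (^-monoˡ-≤ d le)

  edges-empty : ∀ {m} (G : BipGraph m 0) → edges G ≡ 0
  edges-empty {m} G = sum-0 m

  -- Each side may demand at most a quarter of the edges, so the total demand stays at half of them.
  dense-enough : ∀ m n e dL dR → 1 ≤ e → dL * (4 * m) ≤ e → dR * (4 * n) ≤ e → m * dL + n * dR < e
  dense-enough m n e dL dR 1≤e fitL fitR = *-cancelˡ-< 4 _ _ (begin-strict
    4 * (m * dL + n * dR)              ≡⟨ solve 5 (λ w m a n b → w :* (m :* a :+ n :* b) := a :* (w :* m) :+ b :* (w :* n)) refl 4 m dL n dR ⟩
    dL * (4 * m) + dR * (4 * n)        ≤⟨ +-mono-≤ fitL fitR ⟩
    e + e                              <⟨ m<m+n (e + e) (≤-trans 1≤e (m≤m+n e e)) ⟩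
    (e + e) + (e + e)                  ≡⟨ solve 1 (λ e → (e :+ e) :+ (e :+ e) := con 4 :* e) refl e ⟩
    4 * e ∎)
    where
    open ≤-Reasoning
    open +-*-Solver

  -- Of the 2t + 1 factors e, t + 1 are bounded through left degrees and t through right ones, which
  -- matches the degree product. This leaves m^(t+1) n^t times m + n ≤ 2n, that is (mn)^(t+1) up to
  -- constants; 2 ≤ 2^k puts the last 2 under the power.
  dense-numeric : ∀ t k w C m n e dL dR → (∀ x → x ^ k ≡ x * (x * x) ^ t) → 2 ≤ 2 ^ k → m ≤ n →
    e ≤ w * m * dL → e ≤ w * n * dR → (dL * dR) ^ t * dL ≤ (2 * C) ^ k * (m + n) →
    e ^ k ≤ (2 * (w * (2 * C))) ^ k * (m * n) ^ suc t
  dense-numeric t k w C m n e dL dR odd-power 2≤2^k m≤n coverL coverR degrees = begin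
    e ^ k                                                      ≡⟨ odd-power e ⟩
    e * (e * e) ^ t                                            ≤⟨ *-mono-≤ coverL (^-monoˡ-≤ t (*-mono-≤ coverL coverR)) ⟩
    w * m * dL * (w * m * dL * (w * n * dR)) ^ t
      ≡⟨ cong (λ z → w * m * dL * z ^ t) (solve 5 (λ w m a n b → w :* m :* a :* (w :* n :* b) := w :* w :* (m :* n) :* (a :* b)) refl w m dL n dR) ⟩
    w * m * dL * (w * w * (m * n) * (dL * dR)) ^ t
      ≡⟨ cong (w * m * dL *_) (trans (^-distribʳ-* t (w * w * (m * n)) (dL * dR)) (cong (_* (dL * dR) ^ t) (^-distribʳ-* t (w * w) (m * n)))) ⟩
    w * m * dL * ((w * w) ^ t * (m * n) ^ t * (dL * dR) ^ t)
      ≡⟨ solve 6 (λ w m a x y z → w :* m :* a :* (x :* y :* z) := w :* m :* x :* y :* (z :* a)) refl w m dL ((w * w) ^ t) ((m * n) ^ t) ((dL * dR) ^ t) ⟩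
    w * m * (w * w) ^ t * (m * n) ^ t * ((dL * dR) ^ t * dL)
      ≤⟨ *-monoʳ-≤ (w * m * (w * w) ^ t * (m * n) ^ t) (≤-trans degrees (*-monoʳ-≤ ((2 * C) ^ k) (+-monoˡ-≤ n m≤n))) ⟩
    w * m * (w * w) ^ t * (m * n) ^ t * ((2 * C) ^ k * (n + n))
      ≡⟨ solve 6 (λ w m x y z n → w :* m :* x :* y :* (z :* (n :+ n)) := con 2 :* ((w :* x) :* z) :* (m :* n :* y)) refl w m ((w * w) ^ t) ((m * n) ^ t) ((2 * C) ^ k) n ⟩
    2 * (w * (w * w) ^ t * (2 * C) ^ k) * (m * n) ^ suc t
      ≤⟨ *-monoˡ-≤ ((m * n) ^ suc t) (*-monoˡ-≤ (w * (w * w) ^ t * (2 * C) ^ k) 2≤2^k) ⟩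
    2 ^ k * (w * (w * w) ^ t * (2 * C) ^ k) * (m * n) ^ suc t  ≡⟨ cong (_* (m * n) ^ suc t) constants ⟩
    (2 * (w * (2 * C))) ^ k * (m * n) ^ suc t ∎
    where
    open ≤-Reasoning
    open +-*-Solver
    constants : 2 ^ k * (w * (w * w) ^ t * (2 * C) ^ k) ≡ (2 * (w * (2 * C))) ^ k
    constants = trans (cong (λ z → 2 ^ k * (z * (2 * C) ^ k)) (sym (odd-power w)))
      (trans (cong (2 ^ k *_) (sym (^-distribʳ-* k w (2 * C)))) (sym (^-distribʳ-* k 2 (w * (2 * C)))))

  module UpperNumerics (t c′ p r : ℕ) (p≤r : p ≤ r) (1≤r : 1 ≤ r)
    (ratio : dbl t * r ≤ p * suc (suc (dbl t))) where
    open +-*-Solver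

    k C U : ℕ
    k = suc (dbl t)
    C = layerConst (suc c′) k k
    -- 32 C is 2 · (8 · 2C), the constant of `dense-numeric` at w = 8; it also exceeds the 24 C
    -- required in `dense-case`.
    U = 32 * C

    1≤C : 1 ≤ C
    1≤C = layerConst-pos (suc c′) k k

    1≤U : 1 ≤ U
    1≤U = ≤-trans 1≤C (m≤n*m C 32)

    -- The hypothesis a ≥ (k - 1)/(k + 1) in integers; it makes a linear number of edges acceptable,
    -- so that only graphs with more than U n edges need the layers.
    2kr≤ : 2 * k * r ≤ (p + r) * (k + 1)
    2kr≤ = begin
      2 * k * r                           ≡⟨ solve 2 (λ d r → con 2 :* (con 1 :+ d) :* r := d :* r :+ (con 2 :+ d) :* r) refl (dbl t) r ⟩
      dbl t * r + (2 + dbl t) * r         ≤⟨ +-monoˡ-≤ ((2 + dbl t) * r) ratio ⟩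
      p * (2 + dbl t) + (2 + dbl t) * r   ≡⟨ solve 3 (λ p d r → p :* (con 2 :+ d) :+ (con 2 :+ d) :* r := (p :+ r) :* (con 1 :+ d :+ con 1)) refl p (dbl t) r ⟩
      (p + r) * (k + 1) ∎
      where open ≤-Reasoning

    module _ {m n : ℕ} (G : BipGraph m n) (free : ThetaFree k (suc c′) G) (m≤ : m ^ r ≤ n ^ p) where

      e : ℕ
      e = edges G

      Goal : Set
      Goal = e ^ (2 * k * r) ≤ U ^ (2 * k * r) * n ^ ((p + r) * (k + 1))

      sparse : 1 ≤ n → e ≤ U * n → Goal
      sparse 1≤n le = begin
        e ^ (2 * k * r)                        ≤⟨ ^-monoˡ-≤ (2 * k * r) le ⟩
        (U * n) ^ (2 * k * r)                  ≡⟨ ^-distribʳ-* (2 * k * r) U n ⟩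
        U ^ (2 * k * r) * n ^ (2 * k * r)      ≤⟨ *-monoʳ-≤ (U ^ (2 * k * r)) (^-monoʳ-≤ n {{>-nonZero 1≤n}} 2kr≤) ⟩
        U ^ (2 * k * r) * n ^ ((p + r) * (k + 1)) ∎
        where open ≤-Reasoning

      power : e ^ k ≤ U ^ k * (m * n) ^ suc t → Goal
      power h = begin
        e ^ (2 * k * r)                                    ≡⟨ ^2kr e ⟩
        (e ^ k) ^ (2 * r)                                  ≤⟨ ^-monoˡ-≤ (2 * r) h ⟩
        (U ^ k * (m * n) ^ suc t) ^ (2 * r)                ≡⟨ ^-distribʳ-* (2 * r) (U ^ k) _ ⟩
        (U ^ k) ^ (2 * r) * ((m * n) ^ suc t) ^ (2 * r)    ≡⟨ cong₂ _*_ (sym (^2kr U)) regroup ⟩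
        U ^ (2 * k * r) * (m ^ r * n ^ r) ^ (k + 1)        ≤⟨ *-monoʳ-≤ (U ^ (2 * k * r)) (^-monoˡ-≤ (k + 1) (*-monoˡ-≤ (n ^ r) m≤)) ⟩
        U ^ (2 * k * r) * (n ^ p * n ^ r) ^ (k + 1)        ≡⟨ cong (λ z → U ^ (2 * k * r) * z ^ (k + 1)) (sym (^-distribˡ-+-* n p r)) ⟩
        U ^ (2 * k * r) * (n ^ (p + r)) ^ (k + 1)          ≡⟨ cong (U ^ (2 * k * r) *_) (^-*-assoc n (p + r) (k + 1)) ⟩
        U ^ (2 * k * r) * n ^ ((p + r) * (k + 1)) ∎
        where
        open ≤-Reasoning
        ^2kr : ∀ x → x ^ (2 * k * r) ≡ (x ^ k) ^ (2 * r)
        ^2kr x = trans (cong (x ^_) (solve 2 (λ k r → con 2 :* k :* r := k :* (con 2 :* r)) refl k r)) (sym (^-*-assoc x k (2 * r)))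
        regroup : ((m * n) ^ suc t) ^ (2 * r) ≡ (m ^ r * n ^ r) ^ (k + 1)
        regroup = trans (^-*-assoc (m * n) (suc t) (2 * r)) (trans
          (cong ((m * n) ^_) (trans (solve 2 (λ t r → (con 1 :+ t) :* (con 2 :* r) := r :* (con 1 :+ con 2 :* t :+ con 1)) refl t r)
            (cong (λ z → r * (suc z + 1)) (sym (dbl≡2* t)))))
          (trans (sym (^-*-assoc (m * n) r (k + 1))) (cong (_^ (k + 1)) (^-distribʳ-* r m n))))

      -- The degree threshold of a side of size x is a quarter of its average degree, rounded down.
      -- At least 24 C x edges make it at least 6 C, as the growth of layers requires; being
      -- positive, it loses at most a factor 2 by rounding, whence 8 = 2 · 4.
      div-bounds : ∀ x → .{{_ : NonZero (4 * x)}} → 24 * C * x ≤ e → 6 * C ≤ e / (4 * x) × e / (4 * x) * (4 * x) ≤ e × e ≤ 8 * x * (e / (4 * x))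
      div-bounds x le = lower , m/n*n≤m e (4 * x) , upper
        where
        open ≤-Reasoning
        lower : 6 * C ≤ e / (4 * x)
        lower = ≤-trans (≤-reflexive (sym (m*n/n≡m (6 * C) (4 * x)))) (/-monoˡ-≤ (4 * x)
          (≤-trans (≤-reflexive (solve 4 (λ a b c x → a :* c :* (b :* x) := a :* b :* c :* x) refl 6 4 C x)) le))
        upper : e ≤ 8 * x * (e / (4 * x))
        upper = begin
          e                                    ≡⟨ m≡m%n+[m/n]*n e (4 * x) ⟩
          e % (4 * x) + d * (4 * x)            ≤⟨ +-monoˡ-≤ (d * (4 * x)) (<⇒≤ (m%n<n e (4 * x))) ⟩
          4 * x + d * (4 * x)                  ≤⟨ +-monoˡ-≤ (d * (4 * x)) (m≤n*m (4 * x) d {{>-nonZero (≤-trans 1≤C (≤-trans (m≤n*m C 6) lower))}}) ⟩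
          d * (4 * x) + d * (4 * x)            ≡⟨ solve 3 (λ w d x → d :* (w :* x) :+ d :* (w :* x) := (w :+ w) :* x :* d) refl 4 d x ⟩
          8 * x * d ∎
          where d = e / (4 * x)

      dense-case : .{{_ : NonZero (4 * m)}} .{{_ : NonZero (4 * n)}} → m ≤ n → 1 ≤ e → 24 * C * n ≤ e → Goal
      dense-case m≤n 1≤e le = combine (div-bounds m (≤-trans (*-monoʳ-≤ (24 * C) m≤n) le)) (div-bounds n le)
        where
        dL = e / (4 * m)
        dR = e / (4 * n)
        combine : 6 * C ≤ dL × dL * (4 * m) ≤ e × e ≤ 8 * m * dL → 6 * C ≤ dR × dR * (4 * n) ≤ e × e ≤ 8 * n * dR → Goal
        combine (largeL , fitL , coverL) (largeR , fitR , coverR) = power (≤-trans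
          (dense-numeric t k 8 C m n e dL dR (λ x → cong (x *_) (^-dbl x t)) (^-monoʳ-≤ 2 (s≤s (z≤n {dbl t}))) m≤n coverL coverR
            (UpperBound.product-of-degrees t c′ G δ (λ { true → largeL ; false → largeR }) free (dense-enough m n e dL dR 1≤e fitL fitR)))
          (≤-reflexive (cong (λ u → u ^ k * (m * n) ^ suc t) (solve 3 (λ a b c → a :* (b :* (a :* c)) := a :* b :* a :* c) refl 2 8 C))))
          where
          δ : Bool → ℕ
          δ true = dL
          δ false = dR

    bound : ∀ {m} n (G : BipGraph m n) → ThetaFree k (suc c′) G → m ^ r ≤ n ^ p →
      edges G ^ (2 * k * r) ≤ U ^ (2 * k * r) * n ^ ((p + r) * (k + 1))
    bound zero G free m≤ = ≤-trans (≤-reflexive (trans (cong (_^ (2 * k * r)) (edges-empty G))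
      (0^n (2 * k * r) {{m*n≢0 (2 * k) r {{_}} {{>-nonZero 1≤r}}}}))) z≤n
      where
      0^n : ∀ n .{{_ : NonZero n}} → 0 ^ n ≡ 0
      0^n (suc n) = refl
    bound {m} (suc n) G free m≤ with edges G ≤? U * suc n
    ... | yes le = sparse G free m≤ (s≤s z≤n) le
    ... | no gt = go m G free m≤ (≰⇒> gt)
      where
      go : ∀ m (G : BipGraph m (suc n)) → ThetaFree k (suc c′) G → m ^ r ≤ suc n ^ p → U * suc n < edges G →
        edges G ^ (2 * k * r) ≤ U ^ (2 * k * r) * suc n ^ ((p + r) * (k + 1))
      go (suc m) G free m≤ gt = dense-case G free m≤ (^-cancel-≤ r 1≤r (≤-trans m≤ (^-monoʳ-≤ (suc n) p≤r))) (≤-trans (s≤s z≤n) gt)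
        (≤-trans (*-monoˡ-≤ (suc n) (*-monoˡ-≤ C {24} {32} (m≤m+n 24 8))) (<⇒≤ gt))

  module LowerNumerics (t₁ p r : ℕ) (1≤r : 1 ≤ r) where
    open +-*-Solver

    t ke k A B s m h K H T c E₁ κ D N₀ e j : ℕ
    t = suc t₁
    ke = t + suc t
    k = suc (dbl t)
    A = ke * p
    B = ke * r
    s = t * (p + r)
    m = A + (B + (s + 1))
    h = suc m
    K = ke * h
    H = suc (K * (K * (A + B)))
    T = s * (H * K)
    c = K * 1 + K * (K * 1)
    E₁ = solveDeg K (K * 1 + 1)
    -- κ is chosen so that every numerator degree plus one is at most (D + 1) κ. With D = H κ^T the
    -- equations number at most H (κ (D + 1))^T = D (D + 1)^T, fewer than the (D + 1)^(T+1)
    -- unknowns.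
    κ = suc (suc T * E₁ * suc c)
    D = H * κ ^ T
    N₀ = h * suc D
    e = suc t * (p + r)
    j = suc T ∸ h

    -- The summands make room for `H` distinct hash points, for an element separating the first
    -- vertices of N₀ paths, and for the union bound.
    Q : ℕ
    Q = H + suc (N₀ * (N₀ * B)) + suc (shatterConst D T j)

    pN≡ : ∀ T E → pN T E ≡ suc E ^ T
    pN≡ zero E = refl
    pN≡ (suc T) E = cong (suc E *_) (pN≡ T E)

    D-large : H * pN T (suc T * (suc D * E₁) * suc c) < pN (suc T) D
    D-large = begin-strict
      H * pN T (suc T * (suc D * E₁) * suc c)        ≡⟨ cong (H *_) (pN≡ T _) ⟩
      H * suc (suc T * (suc D * E₁) * suc c) ^ T     ≤⟨ *-monoʳ-≤ H (^-monoˡ-≤ T bound) ⟩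
      H * (suc D * κ) ^ T                            ≡⟨ cong (H *_) (^-distribʳ-* T (suc D) κ) ⟩
      H * (suc D ^ T * κ ^ T)                        ≡⟨ solve 3 (λ h x y → h :* (x :* y) := (h :* y) :* x) refl H (suc D ^ T) (κ ^ T) ⟩
      D * suc D ^ T                                  <⟨ *-monoˡ-< (suc D ^ T) {{m^n≢0 (suc D) T}} (n<1+n D) ⟩
      suc D * suc D ^ T                              ≡⟨ sym (pN≡ (suc T) D) ⟩
      pN (suc T) D ∎
      where
      open ≤-Reasoning
      bound : suc (suc T * (suc D * E₁) * suc c) ≤ suc D * κ
      bound = ≤-trans (s≤s (≤-trans (≤-reflexive (solve 4 (λ a d e c → a :* (d :* e) :* c := d :* (a :* e :* c)) refl (suc T) (suc D) E₁ (suc c)))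
        (m≤n+m _ D))) (≤-reflexive (sym (*-suc (suc D) (suc T * E₁ * suc c))))

    -- The balance that fixes s = t (p + r): the k edges of a path impose s conditions each, and its
    -- t blocks have A + B = k (p + r) coordinates each.
    dim : s * K ≡ h * (t * (A + B))
    dim = solve 5 (λ t p r k h → t :* (p :+ r) :* (k :* h) := h :* (t :* (k :* p :+ k :* r))) refl t p r ke h

    dims : A + B ≡ s + e
    dims = solve 3 (λ t p r → (t :+ (con 1 :+ t)) :* p :+ (t :+ (con 1 :+ t)) :* r := t :* (p :+ r) :+ (con 1 :+ t) :* (p :+ r)) refl t p r

    1≤s : 1 ≤ s
    1≤s = *-mono-≤ {1} {t} (s≤s z≤n) (≤-trans 1≤r (m≤n+m r p))

    h≤T : h ≤ suc T
    h≤T = begin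
      h                 ≤⟨ m≤n*m h ke ⟩
      K                 ≤⟨ m≤n*m K H ⟩
      H * K             ≤⟨ m≤n*m (H * K) s {{>-nonZero 1≤s}} ⟩
      T                 ≤⟨ n≤1+n T ⟩
      suc T ∎
      where open ≤-Reasoning

    h+j : h + j ≡ suc T
    h+j = m+[n∸m]≡n h≤T

    ke≡k : ke ≡ k
    ke≡k = trans (solve 1 (λ t → t :+ (con 1 :+ t) := con 1 :+ con 2 :* t) refl t) (cong suc (sym (dbl≡2* t)))

    roots : Σ ℕ λ N → ∀ n → N ≤ n → Σ ℕ λ q → Prime q × Q ≤ q × q ^ B ≤ n × n ≤ (8 * q) ^ B
    roots = prime-root B Q (≤-trans 1≤r (m≤n*m r ke))

    graph : ∀ q → Prime q → Q ≤ q → ∀ m′ n′ →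
      Σ (BipGraph (q ^ A + m′) (q ^ B + n′)) λ G → ThetaFree k N₀ G × q ^ e ≤ edges G
    graph q pr Q≤q = AlgebraicGraph.Build.lower-graph (prime-domain q pr) t₁ A B s D dim
      (≤-trans (≤-trans (m≤m+n H _) (m≤m+n _ (suc (shatterConst D T j)))) Q≤q)
      (≤-trans (≤-trans (m≤n+m _ H) (m≤m+n _ (suc (shatterConst D T j)))) Q≤q)
      j h+j D-large (≤-trans (m≤n+m _ (H + suc (N₀ * (N₀ * B)))) Q≤q) e dims

    L : ℕ
    L = 8 ^ e

    bound : ∀ n → proj₁ roots ≤ n → ∀ m → n ^ p < suc m ^ r →
      Σ (BipGraph m n) λ G → ThetaFree k N₀ G × n ^ ((p + r) * (k + 1)) ≤ L ^ (2 * k * r) * edges G ^ (2 * k * r)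
    bound n N≤n m m-floor = fromPrime (proj₂ roots n N≤n)
      where
      fromPrime : Σ ℕ (λ q → Prime q × Q ≤ q × q ^ B ≤ n × n ≤ (8 * q) ^ B) →
        Σ (BipGraph m n) λ G → ThetaFree k N₀ G × n ^ ((p + r) * (k + 1)) ≤ L ^ (2 * k * r) * edges G ^ (2 * k * r)
      fromPrime (q , pr , Q≤q , lo , hi) = transport (m≤n⇒∃[o]m+o≡n qA≤m) (m≤n⇒∃[o]m+o≡n lo)
        where
        -- As A r = B p, the powers compare: (q^A)^r = (q^B)^p ≤ n^p < (m + 1)^r. So the algebraic
        -- graph fits into the prescribed sides and is padded to them.
        qA≤m : q ^ A ≤ m
        qA≤m = s≤s⁻¹ (^-cancel-< r (≤-<-trans (≤-trans (≤-reflexive powers) (^-monoˡ-≤ p lo)) m-floor))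
          where
          powers : (q ^ A) ^ r ≡ (q ^ B) ^ p
          powers = trans (^-*-assoc q A r) (trans (cong (q ^_) (solve 3 (λ k p r → k :* p :* r := k :* r :* p) refl ke p r)) (sym (^-*-assoc q B p)))
        size : ∀ E → q ^ e ≤ E → n ^ ((p + r) * (k + 1)) ≤ L ^ (2 * k * r) * E ^ (2 * k * r)
        size E le = begin
          n ^ ((p + r) * (k + 1))                              ≤⟨ ^-monoˡ-≤ ((p + r) * (k + 1)) hi ⟩
          ((8 * q) ^ B) ^ ((p + r) * (k + 1))                  ≡⟨ ^-*-assoc (8 * q) B _ ⟩
          (8 * q) ^ (B * ((p + r) * (k + 1)))                  ≡⟨ cong ((8 * q) ^_) exponents ⟩
          (8 * q) ^ (e * (2 * k * r))                          ≡⟨ ^-distribʳ-* (e * (2 * k * r)) 8 q ⟩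
          8 ^ (e * (2 * k * r)) * q ^ (e * (2 * k * r))        ≡⟨ sym (cong₂ _*_ (^-*-assoc 8 e _) (^-*-assoc q e _)) ⟩
          L ^ (2 * k * r) * (q ^ e) ^ (2 * k * r)              ≤⟨ *-monoʳ-≤ (L ^ (2 * k * r)) (^-monoˡ-≤ (2 * k * r) le) ⟩
          L ^ (2 * k * r) * E ^ (2 * k * r) ∎
          where
          open ≤-Reasoning
          exponents : B * ((p + r) * (k + 1)) ≡ e * (2 * k * r)
          exponents = trans (cong₂ (λ x y → x * r * ((p + r) * (suc y + 1))) ke≡k (dbl≡2* t)) (trans
            (solve 4 (λ k p r t → k :* r :* ((p :+ r) :* (con 1 :+ con 2 :* t :+ con 1)) := (con 1 :+ t) :* (p :+ r) :* (con 2 :* k :* r)) refl k p r t)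
            refl)
        transport : Σ ℕ (λ m′ → q ^ A + m′ ≡ m) → Σ ℕ (λ n′ → q ^ B + n′ ≡ n) →
          Σ (BipGraph m n) λ G → ThetaFree k N₀ G × n ^ ((p + r) * (k + 1)) ≤ L ^ (2 * k * r) * edges G ^ (2 * k * r)
        transport (m′ , em) (n′ , en) = subst₂ (λ m n₁ → Σ (BipGraph m n₁) λ G → ThetaFree k N₀ G ×
            n ^ ((p + r) * (k + 1)) ≤ L ^ (2 * k * r) * edges G ^ (2 * k * r)) em en
          (let (G , free , many) = graph q pr Q≤q m′ n′ in G , free , size (edges G) many)

  -- Cross-multiplied forms of the two bounds on a. The lower bound is nonnegative, so the numerator
  -- of a cannot be negative and taking its absolute value changes nothing.
  ratios : ∀ i d a → (+ i /ℚ suc d) ≤ℚ a → a <ℚ 1ℚ → i * ↧ₙ a ≤ ∣ ↥ a ∣ * suc d × ∣ ↥ a ∣ ≤ ↧ₙ a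
  ratios i d a@(mkℚ _ _ _) low high = go (ℚᵘ.≤-respˡ-≃ (ℚ.toℚᵘ-fromℚᵘ (ℚᵘ.mkℚᵘ (+ i) d)) (ℚ.toℚᵘ-mono-≤ low))
    where
    signs : ∀ z r → + (i * r) ℤ.≤ z ℤ.* + suc d → z ℤ.* + 1 ℤ.< + 1 ℤ.* + r → i * r ≤ ∣ z ∣ * suc d × ∣ z ∣ ≤ r
    signs (+ z) r le lt = ℤ.drop‿+≤+ (subst (+ (i * r) ℤ.≤_) (sym (ℤ.pos-* z (suc d))) le) ,
      <⇒≤ (ℤ.drop‿+<+ (subst₂ ℤ._<_ (ℤ.*-identityʳ (+ z)) (ℤ.*-identityˡ (+ r)) lt))
    signs ℤ.-[1+ z ] r () lt
    go : ℚᵘ.mkℚᵘ (+ i) d ℚᵘ.≤ toℚᵘ a → i * ↧ₙ a ≤ ∣ ↥ a ∣ * suc d × ∣ ↥ a ∣ ≤ ↧ₙ a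
    go (ℚᵘ.*≤* le) = signs (↥ a) (↧ₙ a) (subst (ℤ._≤ ↥ a ℤ.* + suc d) (sym (ℤ.pos-* i (↧ₙ a))) le) (ℚ.drop-*<* high)

  Conclusion : ℕ → ℚ → Set
  Conclusion k a =
      Σ ℕ λ c →
      Σ ℕ λ U → Σ ℕ λ L → 1 ≤ U × 1 ≤ L ×
      Σ ℕ λ N → (n : ℕ) → N ≤ n →
        (m : ℕ) → IsFloorPow n ∣ ↥ a ∣ (↧ₙ a) m →
          ((G : BipGraph m n) → ThetaFree k c G →
            edges G ^ (2 * k * ↧ₙ a)
              ≤ U ^ (2 * k * ↧ₙ a) * n ^ ((∣ ↥ a ∣ + ↧ₙ a) * (k + 1)))
          × Σ (BipGraph m n) (λ G → ThetaFree k c G ×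
            n ^ ((∣ ↥ a ∣ + ↧ₙ a) * (k + 1))
              ≤ L ^ (2 * k * ↧ₙ a) * edges G ^ (2 * k * ↧ₙ a))

  odd-case : ∀ t₁ a → let k = suc (dbl (suc t₁)) in (+ (k ∸ 1) /ℚ suc k) ≤ℚ a → a <ℚ 1ℚ → Conclusion k a
  odd-case t₁ a low high = N₀ , U , L , 1≤U , m^n>0 8 e , proj₁ roots ,
    λ n N≤n m (m≤ , m>) → (λ G free → U-bound n G free m≤) , L-bound n N≤n m m>
    where
    open LowerNumerics t₁ ∣ ↥ a ∣ (↧ₙ a) (s≤s z≤n) renaming (bound to L-bound)
    -- The upper bound expects c as a successor, and `suc (D + m * suc D)` is definitionally N₀ =
    -- `suc m * suc D`; so both bounds concern the same θ.
    open UpperNumerics t (D + m * suc D) ∣ ↥ a ∣ (↧ₙ a) (proj₂ (ratios (dbl (suc t₁)) (suc (dbl (suc t₁))) a low high)) (s≤s z≤n) (proj₁ (ratios (dbl (suc t₁)) (suc (dbl (suc t₁))) a low high))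
      using (U; 1≤U) renaming (bound to U-bound)

-- The theorem, with the odd number k rewritten as `suc (dbl t)`.

open import Defs
open import Data.Nat using (ℕ; zero; suc; s≤s; _+_; _*_; _∸_; _^_; _≤_; _≥_; _<_)
open import Data.Integer using (+_; ∣_∣)
open import Data.Rational using (ℚ; _/_; 1ℚ; ↥_; ↧ₙ_) renaming (_≤_ to _≤ℚ_; _<_ to _<ℚ_)
open import Data.Product using (Σ; _×_; _,_)
open Exponents using (Conclusion; odd-case)
open ThetaPaths using (dbl; dbl≡2*)
open import Relation.Binary.PropositionalEquality using (_≡_; refl; sym; trans; cong; subst)

theorem4p1 : (k : ℕ) → 3 ≤ k → Σ ℕ (λ j → k ≡ suc (2 * j)) →
    (a : ℚ) → (+ (k ∸ 1) / suc k) ≤ℚ a → a <ℚ 1ℚ →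
    Σ ℕ λ c →
    Σ ℕ λ U → Σ ℕ λ L → 1 ≤ U × 1 ≤ L ×
    Σ ℕ λ N → (n : ℕ) → N ≤ n →
    (m : ℕ) → IsFloorPow n ∣ ↥ a ∣ (↧ₙ a) m →
    ((G : BipGraph m n) → ThetaFree k c G →
    edges G ^ (2 * k * ↧ₙ a)
    ≤ U ^ (2 * k * ↧ₙ a) * n ^ ((∣ ↥ a ∣ + ↧ₙ a) * (k + 1)))
    × Σ (BipGraph m n) (λ G → ThetaFree k c G ×
    n ^ ((∣ ↥ a ∣ + ↧ₙ a) * (k + 1))
    ≤ L ^ (2 * k * ↧ₙ a) * edges G ^ (2 * k * ↧ₙ a))
-- Here k = 1, against 3 ≤ k; the remaining case has t ≥ 1, on which the construction of the graph
-- relies.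
theorem4p1 k 3≤k (zero , refl) with 3≤k
... | s≤s ()
theorem4p1 k 3≤k (suc t₁ , k≡) a =
  subst (λ k → (+ (k ∸ 1) / suc k) ≤ℚ a → a <ℚ 1ℚ → Conclusion k a) (sym (trans k≡ (cong suc (sym (dbl≡2* (suc t₁)))))) (odd-case t₁ a)
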